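{- Let $G$ be a connected graph containing none of the bull, the claw, or $C_5$ as an induced subgraph. Then at least one of the following holds: (i) $G$ contains $K_6$; (ii) $G$ contains $\overline{C}_7\oplus K_2$; (iii) $G$ contains $\overline{C}_9\oplus K_1$; (iv) $\alpha(G)=2$ and $|V(G)|\geq 11$; (v) $\alpha(G)=2$ and $\Delta(G)\geq 9$; (vi) $G$ is (isomorphic to) a clique expansion $C_{2n+1}[k_1,\ldots,k_{2n+1}]$ for some $n\geq1$ with $k_1+\cdots+k_{2n+1}-5n>0$; (vii) $G$ is $5$-colorable.
   Context: A bull is the graph with vertices $v_1,\ldots,v_5$ and edges $v_1v_2,v_2v_3,v_3v_4,v_4v_5,v_2v_4$; a claw is $K_{1,3}$. "$G$ contains $H$" means $G$ has a (not necessarily induced) subgraph isomorphic to $H$. $\overline{C}_m$ is the complement of the $m$-cycle. $G\oplus H$ denotes the join of $G$ and $H$: disjoint union plus all edges between $V(G)$ and $V(H)$. $\alpha(G)$ is the independence number and $\Delta(G)$ the maximum degree. For $p\geq 3$ and positive integers $k_1,\ldots,k_p$, the clique expansion $C_p[k_1,\ldots,k_p]$ replaces vertex $v_i$ of the cycle $v_1\ldots v_p$ by a clique of size $k_i$, with complete adjacency between cliques of cyclically consecutive vertices and no edges between other distinct cliques. -}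

module Defs where

open import Data.Nat using (ℕ; zero; suc; _+_; _*_; _≤_; _<_; _≡ᵇ_)
open import Data.Fin using (Fin; toℕ; splitAt; _≟_)
import Data.Fin
open import Data.Bool using (Bool; true; false; _∧_; _∨_; not)
open import Data.Bool.Properties using (∨-comm)
open import Data.Sum using (_⊎_; inj₁; inj₂)
open import Data.Product using (Σ; ∃; ∃-syntax; _×_; _,_)
open import Data.List using (List; []; _∷_; filter; length)
open import Data.List using (allFin) renaming (filter to lfilter)
open import Relation.Nullary using (¬_; does; yes; no)
open import Relation.Binary.PropositionalEquality using (_≡_; refl; _≢_; sym; cong₂)
open import Function.Bundles using (_⤖_; Bijection)
open import Function.Definitions using (Injective)

record Graph : Set where
  field
    n      : ℕ
    adj    : Fin n → Fin n → Bool
    adj-sym : ∀ u v → adj u v ≡ adj v u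
    adj-irrefl : ∀ u → adj u u ≡ false
open Graph public

simpleAdj : ∀ {m} → (Fin m → Fin m → Bool) → Fin m → Fin m → Bool
simpleAdj r u v = not (does (u ≟ v)) ∧ (r u v ∨ r v u)

private
  dec-sym : ∀ {m} (u v : Fin m) → does (u ≟ v) ≡ does (v ≟ u)
  dec-sym u v with u ≟ v | v ≟ u
  ... | yes _ | yes _ = refl
  ... | no _  | no _  = refl
  ... | yes p | no q  = Data.Empty.⊥-elim (q (sym p))
    where import Data.Empty
  ... | no p  | yes q = Data.Empty.⊥-elim (p (sym q))
    where import Data.Empty

  dec-refl : ∀ {m} (u : Fin m) → does (u ≟ u) ≡ true
  dec-refl u with u ≟ u
  ... | yes _ = refl
  ... | no p  = Data.Empty.⊥-elim (p refl)
    where import Data.Empty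

fromRel : (m : ℕ) → (Fin m → Fin m → Bool) → Graph
fromRel m r = record
  { n = m
  ; adj = simpleAdj r
  ; adj-sym = λ u v → cong₂ (λ a b → not a ∧ b) (dec-sym u v) (∨-comm (r u v) (r v u))
  ; adj-irrefl = λ u → lemma u
  }
  where
    lemma : ∀ u → simpleAdj r u u ≡ false
    lemma u rewrite dec-refl u = refl

Edge : (G : Graph) → Fin (n G) → Fin (n G) → Set
Edge G u v = adj G u v ≡ true

consec : (p : ℕ) → Fin p → Fin p → Bool
consec p i j = (suc (toℕ i) ≡ᵇ toℕ j) ∨ ((suc (toℕ i) ≡ᵇ p) ∧ (toℕ j ≡ᵇ 0))

K : ℕ → Graph
K m = fromRel m (λ _ _ → true)

C : ℕ → Graph
C m = fromRel m (consec m)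

coC : ℕ → Graph
coC m = fromRel m (λ i j → not (consec m i j ∨ consec m j i))

joinRel : (G H : Graph) → Fin (n G + n H) → Fin (n G + n H) → Bool
joinRel G H x y with splitAt (n G) x | splitAt (n G) y
... | inj₁ a | inj₁ b = adj G a b
... | inj₂ a | inj₂ b = adj H a b
... | inj₁ _ | inj₂ _ = true
... | inj₂ _ | inj₁ _ = true

_⊕_ : Graph → Graph → Graph
G ⊕ H = fromRel (n G + n H) (joinRel G H)

bullRel : Fin 5 → Fin 5 → Bool
bullRel u v = e (toℕ u) (toℕ v)
  where
    e : ℕ → ℕ → Bool
    e 0 1 = true
    e 1 2 = true
    e 2 3 = true
    e 3 4 = true
    e 1 3 = true
    e _ _ = false

bull : Graph
bull = fromRel 5 bullRel

claw : Graph
claw = fromRel 4 (λ u v → toℕ u ≡ᵇ 0)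

Contains : Graph → Graph → Set
Contains G H = Σ (Fin (n H) → Fin (n G)) λ f →
  Injective _≡_ _≡_ f × (∀ u v → Edge H u v → Edge G (f u) (f v))

ContainsInduced : Graph → Graph → Set
ContainsInduced G H = Σ (Fin (n H) → Fin (n G)) λ f →
  Injective _≡_ _≡_ f × (∀ u v → adj G (f u) (f v) ≡ adj H u v)

_≅_ : Graph → Graph → Set
G ≅ H = Σ (Fin (n G) ⤖ Fin (n H)) λ f →
  ∀ u v → adj H (Bijection.to f u) (Bijection.to f v) ≡ adj G u v

data Reach (G : Graph) (u : Fin (n G)) : Fin (n G) → Set where
  here : Reach G u u
  step : ∀ {v w} → Reach G u v → Edge G v w → Reach G u w

Connected : Graph → Set
Connected G = ∀ u v → Reach G u v

HasIndep : Graph → ℕ → Set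
HasIndep G k = Σ (Fin k → Fin (n G)) λ f →
  Injective _≡_ _≡_ f × (∀ i j → adj G (f i) (f j) ≡ false)

IndependenceNumber : Graph → ℕ → Set
IndependenceNumber G k = HasIndep G k × (∀ m → HasIndep G m → m ≤ k)

degree : (G : Graph) → Fin (n G) → ℕ
degree G v = length (lfilter (λ u → adj G v u Data.Bool.≟ true) (allFin (n G)))
  where import Data.Bool

MaxDegree≥ : Graph → ℕ → Set
MaxDegree≥ G d = ∃[ v ] d ≤ degree G v

Colorable : Graph → ℕ → Set
Colorable G c = Σ (Fin (n G) → Fin c) λ col → ∀ u v → Edge G u v → col u ≢ col v

sumF : (p : ℕ) → (Fin p → ℕ) → ℕ
sumF zero k = 0
sumF (suc p) k = k Data.Fin.zero + sumF p (λ i → k (Data.Fin.suc i))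

block : (p : ℕ) (k : Fin p → ℕ) → Fin (sumF p k) → Fin p
block zero k ()
block (suc p) k x with splitAt (k Data.Fin.zero) x
... | inj₁ _ = Data.Fin.zero
... | inj₂ y = Data.Fin.suc (block p (λ i → k (Data.Fin.suc i)) y)

cliqueExpansion : (p : ℕ) → (Fin p → ℕ) → Graph
cliqueExpansion p k = fromRel (sumF p k) λ x y →
  does (block p k x ≟ block p k y) ∨ consec p (block p k x) (block p k y)

{-# OPTIONS --safe #-}
module Submission where

-- If G has no independent triple, the complement H of G has neither triangles nor 5-cycles, and a
-- matching of H with |G| − 5 edges is a 5-colouring of G.  For at most ten vertices such a matching
-- is grown edge by edge; a matching that cannot grow exposes K₆, C̄₇ ⊕ K₂ or a vertex of degree 9.
-- An independent triple forces an induced P₅.  Along a maximal induced path with at least five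
-- vertices, bulls and claws force every vertex to be a twin of a path vertex or to be adjacent to
-- exactly the two ends, so that G is a clique expansion of a cycle, one clique of which may be
-- empty.  If adjacent cliques have at most five vertices together, and if the total is at most 5m
-- on a cycle of length 2m or 2m+1, the cliques fit on consecutive arcs of residues mod 5.

-- The complements of K₆, C̄₇ ⊕ K₂ and C̄₉ ⊕ K₁ are six isolated vertices, C₇ with two and C₉ with
-- one isolated vertex. On their 6, 9 and 10 vertices a maximum matching is one edge short of the
-- |G| - 5 that a 5-colouring asks for. The isolated vertex next to C₉ has degree 9 in G, so this
-- obstruction surfaces as (v). Since eleven vertices already give (iv), growing a matching is a
-- problem on at most ten labels and can be settled by evaluation. The other half wants paths with
-- five vertices because most contradictions look to one side of a position and have to be reflected
-- near an end; five vertices leave room on at least one side. A path without a vertex joining its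
-- ends is treated as a cycle with an empty last clique, so that one colouring argument serves paths
-- and cycles. The bound 5m is forced: an independent set in an expansion of a cycle of length 2m or
-- 2m+1 has at most m vertices, so five colours reach at most 5m vertices.

open import Defs
open import Data.Bool using (Bool; true; false; _∧_; _∨_; not; T)
open import Data.Bool.ListAction using (all; any)
import Data.Bool.Properties as 𝔹
open import Data.Bool.Properties using (T-∧; T-∨; T-≡)
import Data.Char as Char
open import Data.Empty using (⊥; ⊥-elim)
open import Data.Fin using (Fin; zero; suc; toℕ; fromℕ<; inject≤; splitAt; join; _↑ˡ_; _↑ʳ_)
import Data.Fin.Properties as F
open import Data.List using (List; []; _∷_; _++_; length; allFin)
import Data.List as List
open import Data.List.Membership.Propositional using (_∈_)
open import Data.List.Membership.Propositional.Properties using (∈-filter⁺; ∈-allFin)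
open import Data.List.Relation.Unary.All using (All; []; _∷_)
open import Data.List.Relation.Unary.Any using (index)
open import Data.List.Relation.Unary.Any.Properties using (lookup-index)
open import Data.Nat
open import Data.Nat.DivMod
open import Data.Nat.Properties
open import Data.Nat.Tactic.RingSolver using (solve-∀)
open import Data.Product using (Σ; ∃-syntax; _×_; _,_; proj₁; proj₂)
open import Data.String using (String; toList)
open import Data.Sum using (_⊎_; inj₁; inj₂; [_,_]′)
import Data.Sum as Sum
open import Data.Unit using (tt)
open import Function using (_∘_; _$_; const)
open import Function.Bundles using (Equivalence; Bijection; mk⤖)
open import Relation.Binary.Definitions using (tri<; tri≈; tri>)
open import Relation.Binary.PropositionalEquality
open import Relation.Nullary using (¬_; Dec; yes; no; does; contradiction; ¬?; _×-dec_)
open import Relation.Nullary.Decidable using (from-yes; _⊎-dec_)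

-- Every vertex forms a NonEdge with itself.
NonEdge : (G : Graph) → Fin (n G) → Fin (n G) → Set
NonEdge G u v = adj G u v ≡ false

module _ (G : Graph) where

  private V = Fin (n G)

  ~-sym : ∀ {u v} → Edge G u v → Edge G v u
  ~-sym = trans (adj-sym G _ _)

  ≁-sym : ∀ {u v} → NonEdge G u v → NonEdge G v u
  ≁-sym = trans (adj-sym G _ _)

  clash : ∀ {u v} {A : Set} → Edge G u v → NonEdge G u v → A
  clash e ne with trans (sym e) ne
  ... | ()

  -- Both adjacencies are symmetric and irreflexive, so a pattern need only be verified on the pairs
  -- with i before j.
  induced : ∀ H (f : Fin (n H) → V) → (∀ i j → T (toℕ i <ᵇ toℕ j) → adj G (f i) (f j) ≡ adj H i j) →
            ∀ i j → adj G (f i) (f j) ≡ adj H i j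
  induced H f upper i j with <-cmp (toℕ i) (toℕ j)
  ... | tri< lt _ _ = upper i j (<⇒<ᵇ lt)
  ... | tri> _ _ gt = trans (adj-sym G _ _) (trans (upper j i (<⇒<ᵇ gt)) (adj-sym H j i))
  ... | tri≈ _ eq _ with F.toℕ-injective eq
  ...   | refl = trans (adj-irrefl G _) (sym (adj-irrefl H i))

NoIndependentTriple : Graph → Set
NoIndependentTriple G = ∀ a b c → a ≢ b → b ≢ c → a ≢ c → NonEdge G a b → NonEdge G b c → NonEdge G a c → ⊥

-- Certificates for graphs with at most ten vertices

∧-split : ∀ {a b} → T (a ∧ b) → T a × T b
∧-split = Equivalence.to T-∧

-- Labellings are total functions on ℕ of which only an initial segment counts; positions can then
-- be computed with freely, without carrying bounds in their types.
InjectiveBelow : ∀ {A : Set} → ℕ → (ℕ → A) → Set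
InjectiveBelow N f = ∀ {i j} → i < N → j < N → f i ≡ f j → i ≡ j

-- Position i of a list, with the junk value 0 beyond its end.
at : List ℕ → ℕ → ℕ
at []       _       = 0
at (x ∷ _)  zero    = x
at (_ ∷ xs) (suc i) = at xs i

unique : List ℕ → Bool
unique []       = true
unique (x ∷ xs) = all (λ y → not (x ≡ᵇ y)) xs ∧ unique xs

at-all : ∀ p xs {i} → T (all p xs) → i < length xs → T (p (at xs i))
at-all p (x ∷ xs) {zero}  h _       = proj₁ (∧-split h)
at-all p (x ∷ xs) {suc i} h (s≤s l) = at-all p xs (proj₂ (∧-split {p x} h)) l

at-fresh : ∀ {x xs i} → T (all (λ y → not (x ≡ᵇ y)) xs) → i < length xs → x ≢ at xs i
at-fresh {x} {xs} {i} h l refl with at xs i ≡ᵇ at xs i | ≡⇒≡ᵇ (at xs i) (at xs i) refl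
                                  | at-all (λ y → not (x ≡ᵇ y)) xs h l
... | true | _ | ()

at-injective : ∀ xs → T (unique xs) → InjectiveBelow (length xs) (at xs)
at-injective (x ∷ xs) h {zero}  {zero}  _ _ _ = refl
at-injective (x ∷ xs) h {zero}  {suc j} _ (s≤s l) e = contradiction e (at-fresh {xs = xs} (proj₁ (∧-split h)) l)
at-injective (x ∷ xs) h {suc i} {zero}  (s≤s l) _ e = contradiction (sym e) (at-fresh {xs = xs} (proj₁ (∧-split h)) l)
at-injective (x ∷ xs) h {suc i} {suc j} (s≤s k) (s≤s l) e =
  cong suc (at-injective xs (proj₂ (∧-split {all _ xs} h)) k l e)

labels : ℕ → List ℕ → Bool
labels N xs = all (_<ᵇ N) xs ∧ unique xs

relabel : ∀ {A : Set} {N} {ρ : ℕ → A} xs → T (labels N xs) →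
          InjectiveBelow N ρ → InjectiveBelow (length xs) (ρ ∘ at xs)
relabel {N = N} xs h inj i< j< e with ∧-split {all (_<ᵇ N) xs} h
... | bounded , uniq = at-injective xs uniq i< j<
  (inj (<ᵇ⇒< _ N (at-all (_<ᵇ N) xs bounded i<)) (<ᵇ⇒< _ N (at-all (_<ᵇ N) xs bounded j<)) e)

-- (b , i , j) says that the adjacency of the vertices labelled i and j is b.
Fact : Set
Fact = Bool × ℕ × ℕ

-- A refutation by cases: split i j branches on the adjacency of i and j, the non-adjacent case first.
-- Edges of the complement make up triple, pentagon and matching (consecutive pairs), edges of the
-- graph make up clique, antiheptagon (C̄₇ ⊕ K₂) and apex (a vertex with nine neighbours).
-- use k σ appeals to the k-th most recent case, relabelled along σ.
data Tree : Set where
  split        : ℕ → ℕ → Tree → Tree → Tree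
  triple       : ℕ → ℕ → ℕ → Tree
  pentagon     : ℕ → ℕ → ℕ → ℕ → ℕ → Tree
  clique       : List ℕ → Tree
  antiheptagon : List ℕ → Tree
  matching     : List ℕ → Tree
  apex         : ℕ → List ℕ → Tree
  use          : ℕ → List ℕ → Tree

same : Bool → Bool → Bool
same true  b = b
same false b = not b

same-sound : ∀ b c → T (same b c) → b ≡ c
same-sound true  true  _ = refl
same-sound false false _ = refl

states : Bool → ℕ → ℕ → Fact → Bool
states b i j (c , k , l) = same b c ∧ ((i ≡ᵇ k) ∧ (j ≡ᵇ l) ∨ (i ≡ᵇ l) ∧ (j ≡ᵇ k))

known : List Fact → Bool → ℕ → ℕ → Bool
known A b i j = any (states b i j) A

pairsKnown : List Fact → List ℕ → Bool
pairsKnown A (x ∷ y ∷ xs) = known A false x y ∧ pairsKnown A xs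
pairsKnown A _            = true

double : ℕ → ℕ
double zero    = zero
double (suc i) = suc (suc (double i))

every : ∀ {k} → (Fin k → Bool) → Bool
every {zero}  p = true
every {suc k} p = p zero ∧ every (p ∘ suc)

every-sound : ∀ {k} (p : Fin k → Bool) → T (every p) → ∀ i → T (p i)
every-sound {suc k} p h zero    = proj₁ (∧-split h)
every-sound {suc k} p h (suc i) = every-sound (p ∘ suc) (proj₂ (∧-split {p zero} h)) i

module Checker (N m : ℕ) where

  -- Only the edges of H are looked up, as containment is not meant to be induced.
  embeds : List Fact → (H : Graph) → List ℕ → Bool
  embeds A H xs = labels N xs ∧ (n H ≡ᵇ length xs) ∧
    every λ u → every λ v → not (adj H u v) ∨ known A true (at xs (toℕ u)) (at xs (toℕ v))

  -- `done` holds the hypotheses of the cases already settled, the latest at the head, and `A` the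
  -- facts of the current branch. The leaves test their labels for range and repetition, because a
  -- non-edge by itself does not make two vertices distinct.
  check  : List (List Fact) → List Fact → Tree → Bool
  -- Only the hypotheses of the cited case must be known after renaming; the branch may have
  -- gathered more.
  citing : List Fact → List ℕ → List (List Fact) → ℕ → Bool

  check done A (split i j s t) =
    check done ((false , i , j) ∷ A) s ∧ check done ((true , i , j) ∷ A) t
  check done A (triple a b c) = labels N (a ∷ b ∷ c ∷ []) ∧
    known A false a b ∧ known A false b c ∧ known A false a c
  check done A (pentagon a b c d e) = labels N (a ∷ b ∷ c ∷ d ∷ e ∷ []) ∧
    known A false a b ∧ known A false b c ∧ known A false c d ∧ known A false d e ∧ known A false e a
  check done A (clique xs) = embeds A (K 6) xs
  check done A (antiheptagon xs) = embeds A (coC 7 ⊕ K 2) xs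
  check done A (matching xs) = labels N xs ∧ (length xs ≡ᵇ double (suc m)) ∧ pairsKnown A xs
  check done A (apex v xs) = labels N xs ∧ (length xs ≡ᵇ 9) ∧ all (known A true v) xs
  check done A (use k σ) = labels N σ ∧ (length σ ≡ᵇ N) ∧ citing A σ done k

  citing A σ []         _       = false
  citing A σ (B ∷ _)    zero    = all (λ { (b , i , j) → known A b (at σ i) (at σ j) }) B
  citing A σ (_ ∷ done) (suc k) = citing A σ done k

  -- A case can cite only those before it, which keeps the appeals well founded.
  checkAll : List (List Fact) → List (List Fact × Tree) → List Fact → Tree → Bool
  checkAll done []             A t = check done A t
  checkAll done ((B , s) ∷ ls) A t = check done B s ∧ checkAll (B ∷ done) ls A t

-- Soundness of the certificates

module _ (G : Graph) where

  private V = Fin (n G)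

  Holds : (ℕ → V) → Fact → Set
  Holds ρ (b , i , j) = adj G (ρ i) (ρ j) ≡ b

  Matching : ℕ → (ℕ → V) → Set
  Matching k ρ = ∀ i → i < k → NonEdge G (ρ (double i)) (ρ (suc (double i)))

  Matched : ℕ → Set
  Matched k = ∃[ ρ ] InjectiveBelow (double k) ρ × Matching k ρ

  -- `degree` is the length of a filtered list, and distinct neighbours occupy distinct positions in
  -- it.
  degree≥ : ∀ {d} v (f : ℕ → V) → InjectiveBelow d f → (∀ i → i < d → Edge G v (f i)) → d ≤ degree G v
  degree≥ {d} v f inj e = F.injective⇒≤ {f = position} position-inj
    where
    nbrs = List.filter (λ u → adj G v u 𝔹.≟ true) (allFin (n G))
    mem : ∀ i → f (toℕ {d} i) ∈ nbrs
    mem i = ∈-filter⁺ (λ u → adj G v u 𝔹.≟ true) (∈-allFin _) (e (toℕ i) (F.toℕ<n i))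
    position : Fin d → Fin (length nbrs)
    position i = index (mem i)
    position-inj : ∀ {i j} → position i ≡ position j → i ≡ j
    position-inj {i} {j} eq = F.toℕ-injective (inj (F.toℕ<n i) (F.toℕ<n j)
      (trans (lookup-index (mem i)) (trans (cong (List.lookup nbrs) eq) (sym (lookup-index (mem j))))))

  module _ (noTriple : NoIndependentTriple G)
           (noC5 : ¬ ContainsInduced G (C 5)) where

    edge-from-nonedges : ∀ {a b c} → a ≢ b → b ≢ c → a ≢ c → NonEdge G a b → NonEdge G b c → Edge G a c
    edge-from-nonedges {a} {b} {c} p q r x y = 𝔹.¬-not λ z → noTriple a b c p q r x y z

    -- C₅ is its own complement: without independent triples, vertices two apart on a pentagon of
    -- non-edges are adjacent, and visiting every second vertex traces an induced C₅.
    noCoPentagon : (ρ : ℕ → V) → InjectiveBelow 5 ρ →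
      NonEdge G (ρ 0) (ρ 1) → NonEdge G (ρ 1) (ρ 2) → NonEdge G (ρ 2) (ρ 3) → NonEdge G (ρ 3) (ρ 4) → NonEdge G (ρ 4) (ρ 0) → ⊥
    noCoPentagon ρ inj e₀ e₁ e₂ e₃ e₄ = noC5 (f , f-inj , induced G (C 5) f upper)
      where
      σ : ℕ → ℕ
      σ i = at (0 ∷ 2 ∷ 4 ∷ 1 ∷ 3 ∷ []) i
      f : Fin 5 → V
      f i = ρ (σ (toℕ i))
      inj′ : InjectiveBelow 5 (ρ ∘ σ)
      inj′ = relabel {N = 5} {ρ = ρ} (0 ∷ 2 ∷ 4 ∷ 1 ∷ 3 ∷ []) tt inj
      f-inj : ∀ {i j} → f i ≡ f j → i ≡ j
      f-inj {i} {j} e = F.toℕ-injective (inj′ (F.toℕ<n i) (F.toℕ<n j) e)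
      ne : ∀ i j {i< : T (i <ᵇ 5)} {j< : T (j <ᵇ 5)} {d : T (not (i ≡ᵇ j))} → ρ i ≢ ρ j
      ne i j {i<} {j<} {d} e with inj (<ᵇ⇒< i 5 i<) (<ᵇ⇒< j 5 j<) e
      ... | refl with i ≡ᵇ i | ≡⇒≡ᵇ i i refl
      ne i j {i<} {j<} {()} e | refl | true | _
      c₀ = edge-from-nonedges (ne 0 1) (ne 1 2) (ne 0 2) e₀ e₁
      c₁ = edge-from-nonedges (ne 1 2) (ne 2 3) (ne 1 3) e₁ e₂
      c₂ = edge-from-nonedges (ne 2 3) (ne 3 4) (ne 2 4) e₂ e₃
      c₃ = edge-from-nonedges (ne 3 4) (ne 4 0) (ne 3 0) e₃ e₄
      c₄ = edge-from-nonedges (ne 4 0) (ne 0 1) (ne 4 1) e₄ e₀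
      upper : ∀ i j → T (toℕ i <ᵇ toℕ j) → adj G (f i) (f j) ≡ adj (C 5) i j
      upper zero (suc zero) _ = c₀
      upper zero (suc (suc zero)) _ = trans (adj-sym G _ _) e₄
      upper zero (suc (suc (suc zero))) _ = e₀
      upper zero (suc (suc (suc (suc zero)))) _ = trans (adj-sym G _ _) c₃
      upper (suc zero) (suc (suc zero)) _ = c₂
      upper (suc zero) (suc (suc (suc zero))) _ = trans (adj-sym G _ _) e₁
      upper (suc zero) (suc (suc (suc (suc zero)))) _ = e₂
      upper (suc (suc zero)) (suc (suc (suc zero))) _ = c₄
      upper (suc (suc zero)) (suc (suc (suc (suc zero)))) _ = trans (adj-sym G _ _) e₃
      upper (suc (suc (suc zero))) (suc (suc (suc (suc zero)))) _ = c₁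

    known-sound : ∀ {ρ} A {b i j} → All (Holds ρ) A → T (known A b i j) → adj G (ρ i) (ρ j) ≡ b
    known-sound {ρ} (f@(c , k , l) ∷ A) {b} {i} {j} (h ∷ hs) t with Equivalence.to (T-∨ {states b i j f}) t
    ... | inj₂ t′ = known-sound A hs t′
    ... | inj₁ s with ∧-split {same b c} s
    ...   | bc , r with same-sound b c bc | Equivalence.to (T-∨ {(i ≡ᵇ k) ∧ (j ≡ᵇ l)}) r
    ...     | refl | inj₁ e = trans (cong₂ (λ x y → adj G (ρ x) (ρ y))
                (≡ᵇ⇒≡ i k (proj₁ (∧-split e))) (≡ᵇ⇒≡ j l (proj₂ (∧-split {i ≡ᵇ k} e)))) h
    ...     | refl | inj₂ e = trans (adj-sym G _ _) (trans (cong₂ (λ x y → adj G (ρ x) (ρ y))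
                (≡ᵇ⇒≡ j k (proj₂ (∧-split {i ≡ᵇ l} e))) (≡ᵇ⇒≡ i l (proj₁ (∧-split {i ≡ᵇ l} e)))) h)

    module _ (N m : ℕ) where
      open Checker N m

      Outcome : Set
      Outcome = Contains G (K 6) ⊎ Contains G (coC 7 ⊕ K 2) ⊎ MaxDegree≥ G 9 ⊎ Matched (suc m)

      -- Quantifying over all labellings is what allows `use` to rename a settled case.
      Valid : List Fact → Set
      Valid A = ∀ ρ → InjectiveBelow N ρ → All (Holds ρ) A → Outcome

      embeds-sound : ∀ {ρ} A H xs → InjectiveBelow N ρ → All (Holds ρ) A → T (embeds A H xs) → Contains G H
      embeds-sound {ρ} A H xs inj hs t with ∧-split {labels N xs} t
      ... | ls , t₁ with ∧-split {n H ≡ᵇ length xs} t₁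
      ...   | len , t₂ = (λ u → ρ (at xs (toℕ u))) ,
                (λ {u} {v} e → F.toℕ-injective (relabel xs ls inj (bound u) (bound v) e)) , edge
        where
        bound : ∀ u → toℕ u < length xs
        bound u = <-≤-trans (F.toℕ<n u) (≤-reflexive (≡ᵇ⇒≡ (n H) (length xs) len))
        edge : ∀ u v → Edge H u v → Edge G (ρ (at xs (toℕ u))) (ρ (at xs (toℕ v)))
        edge u v uv with adj H u v | every-sound _ (every-sound _ t₂ u) v
        edge u v refl | true | k = known-sound A hs k

      pairs-sound : ∀ {ρ} A xs k → All (Holds ρ) A → T (pairsKnown A xs) → length xs ≡ double k → Matching k (ρ ∘ at xs)
      pairs-sound A (x ∷ y ∷ xs) (suc k) hs t len zero    _       = known-sound A hs (proj₁ (∧-split t))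
      pairs-sound A (x ∷ y ∷ xs) (suc k) hs t len (suc i) (s≤s l) =
        pairs-sound A xs k hs (proj₂ (∧-split {known A false x y} t)) (suc-injective (suc-injective len)) i l

      transport : ∀ {ρ} A σ B → All (Holds ρ) A →
        T (all (λ { (b , i , j) → known A b (at σ i) (at σ j) }) B) → All (Holds (ρ ∘ at σ)) B
      transport A σ []              hs t = []
      transport A σ ((b , i , j) ∷ B) hs t =
        known-sound A hs (proj₁ (∧-split t)) ∷ transport A σ B hs (proj₂ (∧-split {known A b (at σ i) (at σ j)} t))

      citing-sound : ∀ {ρ} A σ done k → All Valid done → InjectiveBelow N (ρ ∘ at σ) → All (Holds ρ) A →
        T (citing A σ done k) → Outcome
      citing-sound A σ (B ∷ _)    zero    (v ∷ _)  inj hs t = v _ inj (transport A σ B hs t)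
      citing-sound A σ (_ ∷ done) (suc k) (_ ∷ vs) inj hs t = citing-sound A σ done k vs inj hs t

      check-sound : ∀ {done} A t → All Valid done → T (check done A t) → Valid A
      check-sound A (split i j s t) vs c ρ inj hs with ∧-split {check _ ((false , i , j) ∷ A) s} c | adj G (ρ i) (ρ j) in eq
      ... | cs , ct | false = check-sound _ s vs cs ρ inj (eq ∷ hs)
      ... | cs , ct | true  = check-sound _ t vs ct ρ inj (eq ∷ hs)
      check-sound A (triple a b c) vs t ρ inj hs with ∧-split {labels N (a ∷ b ∷ c ∷ [])} t
      ... | ls , t₁ with ∧-split {known A false a b} t₁
      ...   | ab , t₂ with ∧-split {known A false b c} t₂
      ...     | bc , ac = ⊥-elim (noTriple (ρ a) (ρ b) (ρ c) (d 0 1 tt tt λ ()) (d 1 2 tt tt λ ()) (d 0 2 tt tt λ ())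
                 (known-sound A hs ab) (known-sound A hs bc) (known-sound A hs ac))
        where
        d : ∀ i j → T (i <ᵇ 3) → T (j <ᵇ 3) → i ≢ j → ρ (at (a ∷ b ∷ c ∷ []) i) ≢ ρ (at (a ∷ b ∷ c ∷ []) j)
        d i j i< j< i≢j e = i≢j (relabel (a ∷ b ∷ c ∷ []) ls inj (<ᵇ⇒< i 3 i<) (<ᵇ⇒< j 3 j<) e)
      check-sound A (pentagon a b c d e) vs t ρ inj hs with ∧-split {labels N (a ∷ b ∷ c ∷ d ∷ e ∷ [])} t
      ... | ls , t₁ with ∧-split {known A false a b} t₁
      ...   | e₀ , t₂ with ∧-split {known A false b c} t₂
      ...     | e₁ , t₃ with ∧-split {known A false c d} t₃
      ...       | e₂ , t₄ with ∧-split {known A false d e} t₄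
      ...         | e₃ , e₄ = ⊥-elim (noCoPentagon (ρ ∘ at (a ∷ b ∷ c ∷ d ∷ e ∷ []))
                     (relabel (a ∷ b ∷ c ∷ d ∷ e ∷ []) ls inj)
                     (known-sound A hs e₀) (known-sound A hs e₁) (known-sound A hs e₂) (known-sound A hs e₃) (known-sound A hs e₄))
      check-sound A (clique xs) vs t ρ inj hs = inj₁ (embeds-sound A (K 6) xs inj hs t)
      check-sound A (antiheptagon xs) vs t ρ inj hs = inj₂ (inj₁ (embeds-sound A (coC 7 ⊕ K 2) xs inj hs t))
      check-sound A (matching xs) vs t ρ inj hs with ∧-split {labels N xs} t
      ... | ls , t₁ with ∧-split {length xs ≡ᵇ double (suc m)} t₁
      ...   | len , pk with ≡ᵇ⇒≡ (length xs) (double (suc m)) len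
      ...     | eq = inj₂ (inj₂ (inj₂ (ρ ∘ at xs , subst (λ k → InjectiveBelow k (ρ ∘ at xs)) eq (relabel xs ls inj) ,
                       pairs-sound A xs (suc m) hs pk eq)))
      check-sound A (apex v xs) vs t ρ inj hs with ∧-split {labels N xs} t
      ... | ls , t₁ with ∧-split {length xs ≡ᵇ 9} t₁
      ...   | len , kn with ≡ᵇ⇒≡ (length xs) 9 len
      ...     | eq = inj₂ (inj₂ (inj₁ (ρ v , degree≥ (ρ v) (ρ ∘ at xs)
                       (subst (λ k → InjectiveBelow k (ρ ∘ at xs)) eq (relabel xs ls inj))
                       (λ i i< → known-sound A hs (at-all (known A true v) xs kn (≤-trans i< (≤-reflexive (sym eq))))))))
      check-sound {done} A (use k σ) vs t ρ inj hs with ∧-split {labels N σ} t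
      ... | ls , t₁ with ∧-split {length σ ≡ᵇ N} t₁
      ...   | len , ci = citing-sound A σ done k vs
                (subst (λ k → InjectiveBelow k (ρ ∘ at σ)) (≡ᵇ⇒≡ (length σ) N len) (relabel σ ls inj)) hs ci

      checkAll-sound : ∀ {done} ls A t → All Valid done → T (checkAll done ls A t) → Valid A
      checkAll-sound []             A t vs c = check-sound A t vs c
      checkAll-sound ((B , s) ∷ ls) A t vs c with ∧-split {check _ B s} c
      ... | cB , c′ = checkAll-sound ls A t (check-sound B s vs cB ∷ vs) c′

-- 48 is the code of the digit 0.
⟦_⟧ : String → List ℕ
⟦ s ⟧ = List.map (λ c → Char.toℕ c ∸ 48) (toList s)

pairUp : Bool → List ℕ → List Fact
pairUp b (i ∷ j ∷ ks) = (b , i , j) ∷ pairUp b ks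
pairUp b _            = []

facts : String → String → List Fact
facts s t = pairUp false ⟦ s ⟧ ++ pairUp true ⟦ t ⟧

-- treeₘ shows how a matching of size m of the complement grows on 6 + m labels, the matched pairs
-- being 01, 23, …  The trees were found by a computer search, which replaced cases symmetric to
-- earlier ones by use.
tree0 : Tree
tree0 =
  split 0 1 (matching ⟦ "01" ⟧) $
  split 0 2 (matching ⟦ "02" ⟧) $
  split 0 3 (matching ⟦ "03" ⟧) $
  split 0 4 (matching ⟦ "04" ⟧) $
  split 0 5 (matching ⟦ "05" ⟧) $
  split 1 2 (matching ⟦ "12" ⟧) $
  split 1 3 (matching ⟦ "13" ⟧) $
  split 1 4 (matching ⟦ "14" ⟧) $
  split 1 5 (matching ⟦ "15" ⟧) $
  split 2 3 (matching ⟦ "23" ⟧) $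
  split 2 4 (matching ⟦ "24" ⟧) $
  split 2 5 (matching ⟦ "25" ⟧) $
  split 3 4 (matching ⟦ "34" ⟧) $
  split 3 5 (matching ⟦ "35" ⟧) $
  split 4 5 (matching ⟦ "45" ⟧) $
  clique ⟦ "012345" ⟧

-- Here 2 to 6 are pairwise adjacent. Given the non-edge 02, any non-edge 1x with x ≠ 2 completes
-- the augmenting path 2-0-1-x; if there is none, 1 completes a K₆.
cases1 : List (List Fact × Tree)
cases1 =
  (facts "0102" "23242526343536454656" ,
    (split 1 2 (triple 0 1 2) $
     split 1 3 (matching ⟦ "0213" ⟧) $
     split 1 4 (matching ⟦ "0214" ⟧) $
     split 1 5 (matching ⟦ "0215" ⟧) $
     split 1 6 (matching ⟦ "0216" ⟧) $
     clique ⟦ "123456" ⟧)) ∷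
  []

tree1 : Tree
tree1 =
  split 2 3 (matching ⟦ "0123" ⟧) $
  split 2 4 (matching ⟦ "0124" ⟧) $
  split 2 5 (matching ⟦ "0125" ⟧) $
  split 2 6 (matching ⟦ "0126" ⟧) $
  split 3 4 (matching ⟦ "0134" ⟧) $
  split 3 5 (matching ⟦ "0135" ⟧) $
  split 3 6 (matching ⟦ "0136" ⟧) $
  split 4 5 (matching ⟦ "0145" ⟧) $
  split 4 6 (matching ⟦ "0146" ⟧) $
  split 5 6 (matching ⟦ "0156" ⟧) $
  split 0 2 (use 0 ⟦ "0123456" ⟧) $
  split 0 3 (use 0 ⟦ "0132456" ⟧) $
  split 0 4 (use 0 ⟦ "0142356" ⟧) $
  split 0 5 (use 0 ⟦ "0152346" ⟧) $
  split 0 6 (use 0 ⟦ "0162345" ⟧) $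
  clique ⟦ "023456" ⟧

-- The unmatched labels 4 to 7 are pairwise adjacent. The second case has a non-edge from the pair
-- 01 to an unmatched label, the first one such non-edge from each of the two pairs.
cases2 : List (List Fact × Tree)
cases2 =
  (facts "01042325" "14151617454647565767" ,
    (split 3 5 (triple 2 3 5) $
     split 3 4 (matching ⟦ "012534" ⟧) $
     split 3 6 (matching ⟦ "012536" ⟧) $
     split 3 7 (matching ⟦ "012537" ⟧) $
     split 1 3 (matching ⟦ "041325" ⟧) $
     clique ⟦ "134567" ⟧)) ∷
  (facts "010423" "454647565767" ,
    (split 1 4 (triple 0 1 4) $
     split 1 5 (matching ⟦ "041523" ⟧) $
     split 1 6 (matching ⟦ "041623" ⟧) $
     split 1 7 (matching ⟦ "041723" ⟧) $
     split 2 5 (use 0 ⟦ "01234567" ⟧) $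
     split 2 6 (use 0 ⟦ "01234657" ⟧) $
     split 2 7 (use 0 ⟦ "01234756" ⟧) $
     split 3 5 (use 0 ⟦ "01324567" ⟧) $
     split 3 6 (use 0 ⟦ "01324657" ⟧) $
     split 3 7 (use 0 ⟦ "01324756" ⟧) $
     split 2 4
       (split 3 4 (triple 2 3 4) $
        split 1 3 (pentagon 0 1 3 2 4) $
        clique ⟦ "134567" ⟧) $
     split 1 2
       (split 1 3 (triple 1 2 3) $
        split 3 4 (pentagon 0 1 2 3 4) $
        clique ⟦ "134567" ⟧) $
     clique ⟦ "124567" ⟧)) ∷
  []

tree2 : Tree
tree2 =
  split 4 5 (matching ⟦ "012345" ⟧) $
  split 4 6 (matching ⟦ "012346" ⟧) $
  split 4 7 (matching ⟦ "012347" ⟧) $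
  split 5 6 (matching ⟦ "012356" ⟧) $
  split 5 7 (matching ⟦ "012357" ⟧) $
  split 6 7 (matching ⟦ "012367" ⟧) $
  split 0 4 (use 0 ⟦ "01234567" ⟧) $
  split 0 5 (use 0 ⟦ "01235467" ⟧) $
  split 0 6 (use 0 ⟦ "01236457" ⟧) $
  split 0 7 (use 0 ⟦ "01237456" ⟧) $
  split 1 4 (use 0 ⟦ "10234567" ⟧) $
  split 1 5 (use 0 ⟦ "10235467" ⟧) $
  split 1 6 (use 0 ⟦ "10236457" ⟧) $
  split 1 7 (use 0 ⟦ "10237456" ⟧) $
  split 2 4 (use 0 ⟦ "23014567" ⟧) $
  split 2 5 (use 0 ⟦ "23015467" ⟧) $
  split 2 6 (use 0 ⟦ "23016457" ⟧) $
  split 2 7 (use 0 ⟦ "23017456" ⟧) $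
  split 0 2
    (split 1 2 (triple 0 1 2) $
     clique ⟦ "124567" ⟧) $
  clique ⟦ "024567" ⟧

cases3 : List (List Fact × Tree)
cases3 =
  (facts "010612142345" "13161718363738676878" ,
    (split 1 5 (triple 1 4 5) $
     split 5 6 (pentagon 0 1 4 5 6) $
     split 3 5 (pentagon 1 2 3 5 4) $
     split 5 7 (matching ⟦ "06142357" ⟧) $
     split 5 8 (matching ⟦ "06142358" ⟧) $
     clique ⟦ "135678" ⟧)) ∷
  (facts "0106122345" "161718676878" ,
    (split 0 2 (triple 0 1 2) $
     split 1 3 (triple 1 2 3) $
     split 3 6 (pentagon 0 1 2 3 6) $
     split 3 7 (matching ⟦ "06123745" ⟧) $
     split 3 8 (matching ⟦ "06123845" ⟧) $
     split 1 4 (use 0 ⟦ "012345678" ⟧) $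
     split 1 5 (use 0 ⟦ "012354678" ⟧) $
     split 4 7
       (split 5 7 (triple 4 5 7) $
        split 5 6 (matching ⟦ "01234756" ⟧) $
        split 5 8 (matching ⟦ "01234758" ⟧) $
        split 3 5 (matching ⟦ "06123547" ⟧) $
        clique ⟦ "135678" ⟧) $
     split 4 8
       (split 5 8 (triple 4 5 8) $
        split 5 6 (matching ⟦ "01234856" ⟧) $
        split 5 7 (matching ⟦ "01234857" ⟧) $
        split 3 5 (matching ⟦ "06123548" ⟧) $
        clique ⟦ "135678" ⟧) $
     split 4 6
       (split 0 4 (triple 0 4 6) $
        split 5 6 (triple 4 5 6) $
        split 2 4 (pentagon 0 1 2 4 6) $
        split 5 7 (matching ⟦ "01234657" ⟧) $
        split 5 8 (matching ⟦ "01234658" ⟧) $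
        split 3 5
          (split 0 5 (use 0 ⟦ "450132678" ⟧) $
           split 2 5 (triple 2 3 5) $
           split 3 4 (triple 3 4 5) $
           split 0 3 (pentagon 0 3 5 4 6) $
           split 2 6 (pentagon 2 3 5 4 6) $
           split 2 7 (matching ⟦ "01273546" ⟧) $
           split 2 8 (matching ⟦ "01283546" ⟧) $
           split 0 7 (matching ⟦ "07123546" ⟧) $
           split 0 8 (matching ⟦ "08123546" ⟧) $
           -- The non-edges 01, 12, 23, 35, 54, 46, 60 close a C₇; its chords and its joins to 7 and
           -- 8 are edges by now.
           antiheptagon ⟦ "012354678" ⟧) $
        clique ⟦ "135678" ⟧) $
     split 3 4
       (split 2 4 (triple 2 3 4) $
        split 3 5 (triple 3 4 5) $
        split 0 4 (pentagon 0 1 2 3 4) $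
        split 5 7 (matching ⟦ "06123457" ⟧) $
        split 5 8 (matching ⟦ "06123458" ⟧) $
        split 5 6
          (split 0 5 (triple 0 5 6) $
           split 2 5 (pentagon 0 1 2 5 6) $
           split 0 3 (pentagon 0 3 4 5 6) $
           split 2 6 (pentagon 2 3 4 5 6) $
           split 2 7 (matching ⟦ "01273456" ⟧) $
           split 2 8 (matching ⟦ "01283456" ⟧) $
           split 0 7 (matching ⟦ "07123456" ⟧) $
           split 0 8 (matching ⟦ "08123456" ⟧) $
           antiheptagon ⟦ "012345678" ⟧) $
        clique ⟦ "135678" ⟧) $
     clique ⟦ "134678" ⟧)) ∷
  (facts "01232645" "131415161718676878" ,
    (split 3 6 (triple 2 3 6) $
     split 3 7 (matching ⟦ "01263745" ⟧) $
     split 3 8 (matching ⟦ "01263845" ⟧) $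
     split 3 4 (use 0 ⟦ "234501678" ⟧) $
     split 3 5 (use 0 ⟦ "235401678" ⟧) $
     split 4 6
       (split 5 6 (triple 4 5 6) $
        split 5 7 (matching ⟦ "01234657" ⟧) $
        split 5 8 (matching ⟦ "01234658" ⟧) $
        clique ⟦ "135678" ⟧) $
     split 4 7
       (split 5 7 (triple 4 5 7) $
        split 5 6 (matching ⟦ "01234756" ⟧) $
        split 5 8 (matching ⟦ "01234758" ⟧) $
        clique ⟦ "135678" ⟧) $
     split 4 8
       (split 5 8 (triple 4 5 8) $
        split 5 6 (matching ⟦ "01234856" ⟧) $
        split 5 7 (matching ⟦ "01234857" ⟧) $
        clique ⟦ "135678" ⟧) $
     clique ⟦ "134678" ⟧)) ∷
  (facts "01062345" "676878" ,
    (split 1 6 (triple 0 1 6) $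
     split 1 7 (matching ⟦ "06172345" ⟧) $
     split 1 8 (matching ⟦ "06182345" ⟧) $
     split 1 2 (use 1 ⟦ "012345678" ⟧) $
     split 1 3 (use 1 ⟦ "013245678" ⟧) $
     split 1 4 (use 1 ⟦ "014523678" ⟧) $
     split 1 5 (use 1 ⟦ "015423678" ⟧) $
     split 2 6 (use 0 ⟦ "012345678" ⟧) $
     split 2 7 (use 0 ⟦ "012345768" ⟧) $
     split 2 8 (use 0 ⟦ "012345867" ⟧) $
     split 3 6 (use 0 ⟦ "013245678" ⟧) $
     split 3 7 (use 0 ⟦ "013245768" ⟧) $
     split 3 8 (use 0 ⟦ "013245867" ⟧) $
     split 4 6 (use 0 ⟦ "014523678" ⟧) $
     split 4 7 (use 0 ⟦ "014523768" ⟧) $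
     split 4 8 (use 0 ⟦ "014523867" ⟧) $
     split 2 4
       (split 3 4 (triple 2 3 4) $
        clique ⟦ "134678" ⟧) $
     clique ⟦ "124678" ⟧)) ∷
  (facts "010223" "060708161718262728363738464748676878" ,
    (split 1 2 (triple 0 1 2) $
     split 0 3 (triple 0 2 3) $
     split 1 4
       (split 0 4 (triple 0 1 4) $
        split 3 4 (pentagon 0 1 4 3 2) $
        clique ⟦ "034678" ⟧) $
     split 2 4
       (split 0 4 (triple 0 2 4) $
        split 3 4 (triple 2 3 4) $
        clique ⟦ "034678" ⟧) $
     clique ⟦ "124678" ⟧)) ∷
  []

tree3 : Tree
tree3 =
  split 6 7 (matching ⟦ "01234567" ⟧) $
  split 6 8 (matching ⟦ "01234568" ⟧) $
  split 7 8 (matching ⟦ "01234578" ⟧) $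
  split 0 6 (use 1 ⟦ "012345678" ⟧) $
  split 0 7 (use 1 ⟦ "012345768" ⟧) $
  split 0 8 (use 1 ⟦ "012345867" ⟧) $
  split 1 6 (use 1 ⟦ "102345678" ⟧) $
  split 1 7 (use 1 ⟦ "102345768" ⟧) $
  split 1 8 (use 1 ⟦ "102345867" ⟧) $
  split 2 6 (use 1 ⟦ "230145678" ⟧) $
  split 2 7 (use 1 ⟦ "230145768" ⟧) $
  split 2 8 (use 1 ⟦ "230145867" ⟧) $
  split 3 6 (use 1 ⟦ "320145678" ⟧) $
  split 3 7 (use 1 ⟦ "320145768" ⟧) $
  split 3 8 (use 1 ⟦ "320145867" ⟧) $
  split 4 6 (use 1 ⟦ "450123678" ⟧) $
  split 4 7 (use 1 ⟦ "450123768" ⟧) $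
  split 4 8 (use 1 ⟦ "450123867" ⟧) $
  split 5 6 (use 1 ⟦ "540123678" ⟧) $
  split 5 7 (use 1 ⟦ "540123768" ⟧) $
  split 5 8 (use 1 ⟦ "540123867" ⟧) $
  split 0 2 (use 0 ⟦ "012345678" ⟧) $
  split 0 3 (use 0 ⟦ "013245678" ⟧) $
  split 0 4 (use 0 ⟦ "014523678" ⟧) $
  split 2 4
    (split 3 4 (triple 2 3 4) $
     clique ⟦ "034678" ⟧) $
  clique ⟦ "024678" ⟧

-- With ten labels the complement can be a C₉ and an isolated vertex, which has no matching with
-- five edges. The `apex` leaves catch it by that vertex, adjacent to the nine others.
cases4 : List (List Fact × Tree)
cases4 =
  (facts "0102040618234567" "03050735375789" ,
    (split 0 8 (triple 0 1 8) $
     split 3 8 (pentagon 0 1 8 3 2) $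
     split 5 8 (pentagon 0 1 8 5 4) $
     split 7 8 (pentagon 0 1 8 7 6) $
     split 3 9 (matching ⟦ "0218394567" ⟧) $
     split 5 9 (matching ⟦ "0418235967" ⟧) $
     split 7 9 (matching ⟦ "0618234579" ⟧) $
     split 0 9 (matching ⟦ "0918234567" ⟧) $
     clique ⟦ "035789" ⟧)) ∷
  (facts "020406294567" "030507083537383957587889" ,
    (split 0 9 (triple 0 2 9) $
     split 5 9 (pentagon 0 2 9 5 4) $
     split 7 9 (pentagon 0 2 9 7 6) $
     clique ⟦ "035789" ⟧)) ∷
  (facts "040613284567" "030507083537383957587889" ,
    (split 5 9 (matching ⟦ "0413285967" ⟧) $
     split 7 9 (matching ⟦ "0613284579" ⟧) $
     split 0 9 (matching ⟦ "0913284567" ⟧) $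
     clique ⟦ "035789" ⟧)) ∷
  (facts "01042328455967" "13141618193738394649697889" ,
    (split 4 8 (matching ⟦ "0123485967" ⟧) $
     split 3 4 (matching ⟦ "0128345967" ⟧) $
     split 3 6
       (split 7 9 (matching ⟦ "0128364579" ⟧) $
        split 4 7 (matching ⟦ "0128364759" ⟧) $
        split 1 7 (matching ⟦ "0417283659" ⟧) $
        clique ⟦ "134789" ⟧) $
     split 6 8
       (split 7 9 (matching ⟦ "0123456879" ⟧) $
        split 4 7 (matching ⟦ "0123475968" ⟧) $
        split 1 7 (matching ⟦ "0417235968" ⟧) $
        clique ⟦ "134789" ⟧) $
     clique ⟦ "134689" ⟧)) ∷
  (facts "010623284567" "030507081314161819353738394649575859697889" ,
    (split 7 9 (use 0 ⟦ "0123674589" ⟧) $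
     split 0 9
       (split 1 5
          (split 4 8 (matching ⟦ "0915234867" ⟧) $
           split 3 4 (matching ⟦ "0915283467" ⟧) $
           use 0 ⟦ "5423106789" ⟧) $
        split 1 7
          (split 6 8 (matching ⟦ "0917234568" ⟧) $
           split 3 6 (matching ⟦ "0917283645" ⟧) $
           use 0 ⟦ "7623104589" ⟧) $
        clique ⟦ "135789" ⟧) $
     clique ⟦ "035789" ⟧)) ∷
  (facts "01040623284567" "03050708141618193537383946495758697889" ,
    (split 1 3 (use 2 ⟦ "0123456789" ⟧) $
     split 5 9 (use 1 ⟦ "0123456789" ⟧) $
     use 0 ⟦ "0123456789" ⟧)) ∷
  (facts "0102040623284567" "030507141618193537465789" ,
    (split 0 8 (triple 0 2 8) $
     split 3 8 (triple 2 3 8) $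
     split 5 8 (pentagon 0 2 8 5 4) $
     split 7 8 (pentagon 0 2 8 7 6) $
     split 3 9 (matching ⟦ "0128394567" ⟧) $
     split 4 9
       (split 5 9 (triple 4 5 9) $
        use 4 ⟦ "0145236789" ⟧) $
     split 6 9
       (split 7 9 (triple 6 7 9) $
        use 4 ⟦ "0167234589" ⟧) $
     use 0 ⟦ "0123456789" ⟧)) ∷
  (facts "01020406234567" "03051214243589" ,
    (split 1 6 (triple 0 1 6) $
     split 2 6 (triple 0 2 6) $
     split 4 6 (triple 0 4 6) $
     split 0 7 (triple 0 6 7) $
     split 3 7 (pentagon 0 2 3 7 6) $
     split 5 7 (pentagon 0 4 5 7 6) $
     split 1 8 (use 6 ⟦ "0123456789" ⟧) $
     split 1 9 (use 6 ⟦ "0123456798" ⟧) $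
     split 2 8 (use 0 ⟦ "0123456789" ⟧) $
     split 2 9 (use 0 ⟦ "0123456798" ⟧) $
     split 4 8 (use 0 ⟦ "0145236789" ⟧) $
     split 4 9 (use 0 ⟦ "0145236798" ⟧) $
     split 6 8 (use 0 ⟦ "0167234589" ⟧) $
     split 6 9
       (split 0 9 (triple 0 6 9) $
        split 7 9 (triple 6 7 9) $
        split 3 9 (pentagon 0 2 3 9 6) $
        split 5 9 (pentagon 0 4 5 9 6) $
        split 7 8 (matching ⟦ "0123456978" ⟧) $
        split 1 7 (use 4 ⟦ "0167234598" ⟧) $
        split 3 8 (use 3 ⟦ "0167234598" ⟧) $
        use 2 ⟦ "0167234598" ⟧) $
     clique ⟦ "124689" ⟧)) ∷
  (facts "0102041823264567" "0305063536475689" ,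
    (split 0 8 (triple 0 1 8) $
     split 3 8 (pentagon 0 1 8 3 2) $
     split 6 8 (pentagon 0 1 8 6 2) $
     split 5 8 (pentagon 0 1 8 5 4) $
     split 3 9 (matching ⟦ "0218394567" ⟧) $
     split 5 9 (matching ⟦ "0418235967" ⟧) $
     split 0 9 (matching ⟦ "0918234567" ⟧) $
     split 6 9
       (split 7 9 (triple 6 7 9) $
        split 4 9 (pentagon 0 2 6 9 4) $
        split 7 8 (matching ⟦ "0123456978" ⟧) $
        split 3 7 (matching ⟦ "0218374569" ⟧) $
        use 4 ⟦ "2367015498" ⟧) $
     clique ⟦ "035689" ⟧)) ∷
  (facts "010204082326454667" "030506121417181924273536383947565859787989" ,
    (split 2 8 (triple 0 2 8) $
     split 4 8 (triple 0 4 8) $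
     split 2 9
       (split 0 9 (triple 0 2 9) $
        split 6 9 (triple 2 6 9) $
        split 1 3 (matching ⟦ "0813294567" ⟧) $
        split 6 8
          (split 4 9
             (split 5 7 (matching ⟦ "0123495768" ⟧) $
              split 3 7 (matching ⟦ "0129374568" ⟧) $
              split 1 5 (matching ⟦ "0815234967" ⟧) $
              clique ⟦ "135789" ⟧) $
           use 4 ⟦ "2301546789" ⟧) $
        use 4 ⟦ "0123764598" ⟧) $
     split 4 9
       (split 6 9 (triple 4 6 9) $
        split 1 5 (matching ⟦ "0815234967" ⟧) $
        use 4 ⟦ "4501326789" ⟧) $
     clique ⟦ "124789" ⟧)) ∷
  (facts "0102042326454867" "0305061214171819242735363839475689" ,
    (split 0 8 (triple 0 4 8) $
     split 5 8 (triple 4 5 8) $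
     split 6 8 (pentagon 0 2 6 8 4) $
     split 5 9 (matching ⟦ "0123485967" ⟧) $
     split 6 9
       (split 2 9 (triple 2 6 9) $
        split 7 9 (triple 6 7 9) $
        split 4 9 (pentagon 0 2 6 9 4) $
        split 7 8 (matching ⟦ "0123456978" ⟧) $
        split 5 7 (matching ⟦ "0123485769" ⟧) $
        split 2 8
          (split 0 9
             (split 3 7 (matching ⟦ "0128374569" ⟧) $
              split 1 3 (matching ⟦ "0913284567" ⟧) $
              split 1 5 (matching ⟦ "0915234867" ⟧) $
              clique ⟦ "135789" ⟧) $
           use 5 ⟦ "6745102389" ⟧) $
        use 5 ⟦ "4567320198" ⟧) $
     split 0 9
       (split 2 9 (triple 0 2 9) $
        split 7 9 (pentagon 0 2 6 7 9) $
        split 1 5 (matching ⟦ "0915234867" ⟧) $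
        use 5 ⟦ "0145762389" ⟧) $
     clique ⟦ "035689" ⟧)) ∷
  (facts "0102040823294567" "030506141718193536383947485668697889" ,
    (split 0 9 (triple 0 2 9) $
     split 5 9 (pentagon 0 2 9 5 4) $
     split 1 3 (matching ⟦ "0813294567" ⟧) $
     use 6 ⟦ "0123764598" ⟧)) ∷
  (facts "01040823264567" "1214171819242527282935363839464748495668697889" ,
    (split 7 9
       (split 1 3 (matching ⟦ "0813264579" ⟧) $
        split 1 6 (matching ⟦ "0816234579" ⟧) $
        split 5 8 (use 8 ⟦ "0176452398" ⟧) $
        split 5 9
          (split 1 5 (use 8 ⟦ "5476102398" ⟧) $
           split 3 4
             (split 5 7 (triple 5 7 9) $
              split 3 7 (pentagon 3 4 5 9 7) $
              antiheptagon ⟦ "234597618" ⟧) $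
           clique ⟦ "134689" ⟧) $
        use 8 ⟦ "2301675489" ⟧) $
     clique ⟦ "124789" ⟧)) ∷
  (facts "0102040823264567" "0305061214171819242527353638394647484956686989" ,
    (split 2 8 (triple 0 2 8) $
     split 7 8 (pentagon 0 2 6 7 8) $
     split 2 9 (use 1 ⟦ "0123456789" ⟧) $
     use 0 ⟦ "0123456789" ⟧)) ∷
  (facts "01020423264567" "030506071214243589" ,
    (split 3 6 (triple 2 3 6) $
     split 2 7 (triple 2 6 7) $
     split 1 7 (pentagon 0 1 7 6 2) $
     split 5 6 (pentagon 0 2 6 5 4) $
     split 4 7 (pentagon 0 2 6 7 4) $
     split 2 5 (use 6 ⟦ "2301546789" ⟧) $
     split 1 8 (use 5 ⟦ "0123456789" ⟧) $
     split 1 9 (use 5 ⟦ "0123456798" ⟧) $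
     split 3 8 (use 5 ⟦ "2301674589" ⟧) $
     split 3 9 (use 5 ⟦ "2301674598" ⟧) $
     split 4 6
       (split 5 8 (use 5 ⟦ "4501672389" ⟧) $
        split 5 9 (use 5 ⟦ "4501672398" ⟧) $
        split 7 8 (use 5 ⟦ "6723450189" ⟧) $
        split 7 9 (use 5 ⟦ "6723450198" ⟧) $
        split 0 8 (use 4 ⟦ "0123456789" ⟧) $
        split 0 9 (use 4 ⟦ "0123456798" ⟧) $
        split 2 8 (use 4 ⟦ "2301674589" ⟧) $
        split 2 9 (use 4 ⟦ "2301674598" ⟧) $
        split 4 8 (use 4 ⟦ "4501672389" ⟧) $
        split 4 9
          (split 6 8
             (split 5 7 (matching ⟦ "0123495768" ⟧) $
              use 9 ⟦ "4567320189" ⟧) $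
           apex 8 ⟦ "012345679" ⟧) $
        clique ⟦ "124789" ⟧) $
     split 4 8 (use 3 ⟦ "0123456789" ⟧) $
     split 4 9 (use 3 ⟦ "0123456798" ⟧) $
     split 6 8 (use 3 ⟦ "2301674589" ⟧) $
     split 6 9 (use 3 ⟦ "2301674598" ⟧) $
     split 0 8 (use 0 ⟦ "0123456789" ⟧) $
     split 0 9 (use 0 ⟦ "0123456798" ⟧) $
     split 2 8 (use 0 ⟦ "2301674589" ⟧) $
     split 2 9 (use 0 ⟦ "2301674598" ⟧) $
     split 5 8
       (split 7 8
          (split 5 9
             (split 1 6 (matching ⟦ "0416235978" ⟧) $
              use 10 ⟦ "0176452389" ⟧) $
           split 7 9
             (split 1 6 (use 11 ⟦ "0176234598" ⟧) $
              use 9 ⟦ "0176234598" ⟧) $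
           apex 9 ⟦ "012345678" ⟧) $
        use 8 ⟦ "2354016789" ⟧) $
     split 7 8
       (split 1 6 (use 11 ⟦ "0176234589" ⟧) $
        use 9 ⟦ "0176234589" ⟧) $
     apex 8 ⟦ "012345679" ⟧)) ∷
  (facts "0102041823456769" "0305070809353839585989" ,
    (split 7 9 (triple 6 7 9) $
     split 7 8 (matching ⟦ "0123456978" ⟧) $
     split 3 7 (matching ⟦ "0218374569" ⟧) $
     split 5 7 (matching ⟦ "0418235769" ⟧) $
     clique ⟦ "035789" ⟧)) ∷
  (facts "01020416182345" "030506080935383958596989" ,
    (split 6 8 (triple 1 6 8) $
     split 3 6 (pentagon 0 1 6 3 2) $
     split 5 6 (pentagon 0 1 6 5 4) $
     clique ⟦ "035689" ⟧)) ∷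
  (facts "0204182336455767" "030506070809242627343537383946475859697989" ,
    (split 5 6 (triple 5 6 7) $
     split 2 5 (pentagon 2 3 6 7 5) $
     split 4 9 (matching ⟦ "0218364957" ⟧) $
     split 2 9 (matching ⟦ "0418293657" ⟧) $
     split 1 9
       (split 7 8 (matching ⟦ "0219364578" ⟧) $
        split 4 8 (matching ⟦ "0219364857" ⟧) $
        split 6 8 (matching ⟦ "0419235768" ⟧) $
        split 2 8 (matching ⟦ "0419283657" ⟧) $
        antiheptagon ⟦ "023675489" ⟧) $
     apex 9 ⟦ "012345678" ⟧)) ∷
  (facts "0102041823364567" "03050607080912162635373839575859697989" ,
    (split 7 8
       (split 6 8 (triple 6 7 8) $
        split 1 3 (pentagon 1 3 6 7 8) $
        split 2 8 (pentagon 2 3 6 7 8) $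
        split 2 9 (matching ⟦ "0129364578" ⟧) $
        split 1 9 (matching ⟦ "0219364578" ⟧) $
        split 4 9 (use 5 ⟦ "4532016798" ⟧) $
        apex 9 ⟦ "012345678" ⟧) $
     clique ⟦ "035789" ⟧)) ∷
  (facts "0102041823364567" "03050607080912141624262735383946475859697989" ,
    (split 3 7 (triple 3 6 7) $
     split 3 4 (use 4 ⟦ "4532016789" ⟧) $
     split 5 7 (use 1 ⟦ "0123456789" ⟧) $
     use 0 ⟦ "0123456789" ⟧)) ∷
  (facts "01020418234567" "03050607121424262735464789" ,
    (split 0 8 (triple 0 1 8) $
     split 3 8 (pentagon 0 1 8 3 2) $
     split 5 8 (pentagon 0 1 8 5 4) $
     split 3 9 (matching ⟦ "0218394567" ⟧) $
     split 5 9 (matching ⟦ "0418235967" ⟧) $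
     split 0 9 (matching ⟦ "0918234567" ⟧) $
     split 6 9 (use 4 ⟦ "0123456789" ⟧) $
     split 7 9 (use 4 ⟦ "0123457689" ⟧) $
     split 1 6 (use 3 ⟦ "0123456789" ⟧) $
     split 1 7 (use 3 ⟦ "0123457689" ⟧) $
     split 3 6 (use 0 ⟦ "0123456789" ⟧) $
     split 3 7 (use 0 ⟦ "0123457689" ⟧) $
     split 5 6 (use 0 ⟦ "0145236789" ⟧) $
     split 6 8
       (split 5 7 (use 1 ⟦ "0145237689" ⟧) $
        split 7 8 (triple 6 7 8) $
        clique ⟦ "035789" ⟧) $
     clique ⟦ "035689" ⟧)) ∷
  (facts "010417283645" "030507083537383958787989" ,
    (split 5 7 (pentagon 0 1 7 5 4) $
     split 5 9 (matching ⟦ "0417283659" ⟧) $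
     split 0 9 (matching ⟦ "0917283645" ⟧) $
     clique ⟦ "035789" ⟧)) ∷
  (facts "0102042328364567" "03050607081214181924262735383946475889" ,
    (split 3 7 (triple 3 6 7) $
     split 1 6 (pentagon 0 1 6 3 2) $
     split 7 8 (pentagon 2 3 6 7 8) $
     split 7 9 (matching ⟦ "0128364579" ⟧) $
     split 3 4 (use 7 ⟦ "4532016789" ⟧) $
     split 1 7 (use 0 ⟦ "0123456789" ⟧) $
     split 4 9
       (split 0 9 (triple 0 4 9) $
        split 5 9 (triple 4 5 9) $
        split 5 7 (matching ⟦ "0128364957" ⟧) $
        split 1 3 (use 6 ⟦ "3210674589" ⟧) $
        use 18 ⟦ "6745321098" ⟧) $
     split 5 7
       (split 5 6 (triple 5 6 7) $
        split 2 5 (pentagon 2 3 6 7 5) $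
        split 1 3
          (split 1 5 (pentagon 1 3 6 7 5) $
           split 5 9 (matching ⟦ "0413285967" ⟧) $
           split 0 9 (matching ⟦ "0913284567" ⟧) $
           use 4 ⟦ "3210674589" ⟧) $
        split 4 8
          (split 1 5 (use 1 ⟦ "5410762389" ⟧) $
           split 2 9 (use 0 ⟦ "4523016798" ⟧) $
           split 6 8 (pentagon 4 5 7 6 8) $
           split 6 9 (matching ⟦ "0123485769" ⟧) $
           split 5 9 (matching ⟦ "0123485967" ⟧) $
           antiheptagon ⟦ "236754819" ⟧) $
        clique ⟦ "134789" ⟧) $
     split 0 9 (use 18 ⟦ "6701325498" ⟧) $
     split 5 9
       (split 4 8 (matching ⟦ "0123485967" ⟧) $
        use 18 ⟦ "6754320198" ⟧) $
     clique ⟦ "035789" ⟧)) ∷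
  (facts "01042345596768" "12141819242937384989" ,
    (split 7 8 (triple 6 7 8) $
     split 7 9 (matching ⟦ "0123456879" ⟧) $
     split 1 7 (matching ⟦ "0417235968" ⟧) $
     use 19 ⟦ "0167452389" ⟧)) ∷
  (facts "0104232845565967" "03050708131418193435373839464849587889" ,
    (split 5 7 (triple 5 6 7) $
     split 6 9 (triple 5 6 9) $
     split 1 6 (pentagon 0 1 6 5 4) $
     split 7 9 (use 20 ⟦ "5423671089" ⟧) $
     use 19 ⟦ "0123674589" ⟧)) ∷
  (facts "01165967" "03050607081314181934353637383946474849565758687889" ,
    (split 1 7 (triple 1 6 7) $
     split 7 9
       (split 6 9 (triple 6 7 9) $
        split 0 9 (pentagon 0 1 6 7 9) $
        split 1 5 (pentagon 1 5 9 7 6) $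
        antiheptagon ⟦ "016795438" ⟧) $
     clique ⟦ "134789" ⟧)) ∷
  (facts "0102042328455667" "03050607081214181924262735363738394647585989" ,
    (split 5 7 (triple 5 6 7) $
     split 1 6 (pentagon 0 1 6 5 4) $
     split 2 5 (use 11 ⟦ "2354016789" ⟧) $
     split 4 8 (use 3 ⟦ "0145236789" ⟧) $
     split 0 9
       (split 2 9 (triple 0 2 9) $
        split 4 9 (triple 0 4 9) $
        split 6 9 (pentagon 0 4 5 6 9) $
        split 1 3 (matching ⟦ "0913284567" ⟧) $
        split 7 9 (use 2 ⟦ "5410672389" ⟧) $
        split 7 8
          (split 6 8 (triple 6 7 8) $
           split 1 7 (pentagon 0 1 7 8 2) $
           split 3 4
             (split 1 5 (use 22 ⟦ "5476102389" ⟧) $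
              use 0 ⟦ "5401673298" ⟧) $
           use 22 ⟦ "5401673298" ⟧) $
        use 21 ⟦ "0123674589" ⟧) $
     split 4 9 (use 3 ⟦ "0145236798" ⟧) $
     split 7 9
       (split 6 9 (triple 6 7 9) $
        split 3 4 (matching ⟦ "0128345679" ⟧) $
        use 22 ⟦ "5423671089" ⟧) $
     split 7 8
       (split 6 8 (triple 6 7 8) $
        split 6 9 (matching ⟦ "0123456978" ⟧) $
        split 2 9 (use 2 ⟦ "5410672398" ⟧) $
        apex 9 ⟦ "012345678" ⟧) $
     clique ⟦ "035789" ⟧)) ∷
  (facts "0102042328456768" "03050708141819353738394657585989" ,
    (split 7 8 (triple 6 7 8) $
     split 1 6 (pentagon 0 1 6 8 2) $
     split 7 9 (matching ⟦ "0123456879" ⟧) $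
     split 0 9
       (split 4 9 (triple 0 4 9) $
        split 6 9 (pentagon 0 2 8 6 9) $
        use 15 ⟦ "0123457698" ⟧) $
     clique ⟦ "035789" ⟧)) ∷
  (facts "0102042328456769" "0305070812141819242735373839475758597889" ,
    (split 7 9 (triple 6 7 9) $
     split 0 9
       (split 2 9 (triple 0 2 9) $
        split 4 9 (triple 0 4 9) $
        split 1 7 (pentagon 0 1 7 6 9) $
        split 1 3 (matching ⟦ "0913284567" ⟧) $
        split 4 8
          (split 1 5 (matching ⟦ "0915234867" ⟧) $
           clique ⟦ "135789" ⟧) $
        use 23 ⟦ "2367540198" ⟧) $
     clique ⟦ "035789" ⟧)) ∷
  (facts "01020423284567" "030506071214181924262735464789" ,
    (split 0 8 (triple 0 2 8) $
     split 3 8 (triple 2 3 8) $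
     split 5 8 (pentagon 0 2 8 5 4) $
     split 3 9 (matching ⟦ "0128394567" ⟧) $
     split 3 6 (use 6 ⟦ "0123456789" ⟧) $
     split 3 7 (use 6 ⟦ "0123457689" ⟧) $
     split 5 9
       (split 4 9 (triple 4 5 9) $
        split 2 9 (pentagon 0 2 9 5 4) $
        split 4 8 (matching ⟦ "0123485967" ⟧) $
        split 3 4 (matching ⟦ "0128345967" ⟧) $
        split 1 3 (matching ⟦ "0413285967" ⟧) $
        split 6 8 (use 5 ⟦ "0123456789" ⟧) $
        split 7 8 (use 5 ⟦ "0123457689" ⟧) $
        split 5 6 (use 4 ⟦ "0123456789" ⟧) $
        split 5 7 (use 4 ⟦ "0123457689" ⟧) $
        split 1 6 (use 3 ⟦ "0123456789" ⟧) $
        split 6 9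
          (split 7 9 (triple 6 7 9) $
           split 1 7
             (split 0 9 (pentagon 0 1 7 6 9) $
              split 1 5 (pentagon 1 5 9 6 7) $
              antiheptagon ⟦ "017695438" ⟧) $
           use 24 ⟦ "2367540198" ⟧) $
        clique ⟦ "134689" ⟧) $
     split 5 6 (use 2 ⟦ "0123456789" ⟧) $
     split 5 7 (use 2 ⟦ "0123457689" ⟧) $
     split 6 8 (use 1 ⟦ "0123456789" ⟧) $
     split 7 8 (use 1 ⟦ "0123457689" ⟧) $
     split 6 9 (use 0 ⟦ "0123456789" ⟧) $
     split 0 9
       (split 4 9 (triple 0 4 9) $
        split 1 3 (matching ⟦ "0913284567" ⟧) $
        split 7 9 (use 0 ⟦ "0123457689" ⟧) $
        split 1 6
          (split 1 7 (triple 1 6 7) $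
           use 24 ⟦ "0123764589" ⟧) $
        use 24 ⟦ "0123674589" ⟧) $
     clique ⟦ "035689" ⟧)) ∷
  (facts "01020423456768" "03050712141819242728293547484989" ,
    (split 7 8 (triple 6 7 8) $
     split 7 9 (matching ⟦ "0123456879" ⟧) $
     split 1 7
       (split 3 7 (pentagon 0 1 7 3 2) $
        split 5 7 (pentagon 0 1 7 5 4) $
        split 3 9 (matching ⟦ "0217394568" ⟧) $
        split 5 9 (matching ⟦ "0417235968" ⟧) $
        split 0 9 (matching ⟦ "0917234568" ⟧) $
        split 6 9 (use 27 ⟦ "0167234598" ⟧) $
        apex 9 ⟦ "012345678" ⟧) $
     clique ⟦ "124789" ⟧)) ∷
  (facts "010204234567" "03050607121424263589" ,
    (split 2 7 (use 16 ⟦ "0123457689" ⟧) $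
     split 4 6 (use 16 ⟦ "0145236789" ⟧) $
     split 4 7 (use 16 ⟦ "0145237689" ⟧) $
     split 1 8 (use 10 ⟦ "0123456789" ⟧) $
     split 1 9 (use 10 ⟦ "0123456798" ⟧) $
     split 2 8 (use 1 ⟦ "0123456789" ⟧) $
     split 2 9 (use 1 ⟦ "0123456798" ⟧) $
     split 4 8 (use 1 ⟦ "0145236789" ⟧) $
     split 4 9 (use 1 ⟦ "0145236798" ⟧) $
     split 6 8 (use 0 ⟦ "0123456789" ⟧) $
     split 6 9 (use 0 ⟦ "0123456798" ⟧) $
     split 1 6
       (split 1 7 (triple 1 6 7) $
        split 7 8 (use 0 ⟦ "0123457689" ⟧) $
        split 7 9 (use 0 ⟦ "0123457698" ⟧) $
        clique ⟦ "124789" ⟧) $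
     clique ⟦ "124689" ⟧)) ∷
  (facts "010204234567" "031289" ,
    (split 1 4 (triple 0 1 4) $
     split 2 4 (triple 0 2 4) $
     split 0 5 (triple 0 4 5) $
     split 3 5 (pentagon 0 2 3 5 4) $
     split 0 6 (use 24 ⟦ "0123456789" ⟧) $
     split 0 7 (use 24 ⟦ "0123457689" ⟧) $
     split 2 6 (use 17 ⟦ "0123456789" ⟧) $
     use 0 ⟦ "0123456789" ⟧)) ∷
  (facts "0102081423456769" "0304071215161718192527283447585989" ,
    (split 7 9 (triple 6 7 9) $
     split 7 8 (matching ⟦ "0123456978" ⟧) $
     split 5 7 (matching ⟦ "0814235769" ⟧) $
     split 2 9
       (split 0 9 (triple 0 2 9) $
        split 3 9 (triple 2 3 9) $
        split 4 9 (pentagon 0 1 4 9 2) $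
        split 6 8 (pentagon 0 2 9 6 8) $
        split 3 7 (pentagon 2 3 7 6 9) $
        split 3 8 (matching ⟦ "0129384567" ⟧) $
        split 3 5 (matching ⟦ "0814293567" ⟧) $
        split 5 6
          (split 4 8 (use 29 ⟦ "6723541098" ⟧) $
           use 28 ⟦ "0167542398" ⟧) $
        use 29 ⟦ "4523106798" ⟧) $
     clique ⟦ "125789" ⟧)) ∷
  (facts "0102081423364567" "12151618192526285859697989" ,
    (split 3 7 (triple 3 6 7) $
     split 6 8 (pentagon 0 2 3 6 8) $
     split 5 6 (use 1 ⟦ "6732540189" ⟧) $
     split 2 9 (use 10 ⟦ "4567102398" ⟧) $
     clique ⟦ "125689" ⟧)) ∷
  (facts "010214234567" "03040507121315161718192526272829343646475859697989" ,
    (split 5 6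
       (split 5 7 (triple 5 6 7) $
        split 3 9 (use 13 ⟦ "5432670198" ⟧) $
        split 3 5 (use 3 ⟦ "5432670189" ⟧) $
        split 7 8
          (split 0 9 (use 11 ⟦ "4532107689" ⟧) $
           split 4 9 (matching ⟦ "0123495678" ⟧) $
           apex 9 ⟦ "012345678" ⟧) $
        clique ⟦ "125789" ⟧) $
     split 6 8
       (split 7 8 (triple 6 7 8) $
        split 0 9 (use 1 ⟦ "0123456798" ⟧) $
        split 5 7
          (split 4 9 (matching ⟦ "0123495768" ⟧) $
           split 3 9 (matching ⟦ "0214395768" ⟧) $
           apex 9 ⟦ "012345678" ⟧) $
        clique ⟦ "125789" ⟧) $
     clique ⟦ "125689" ⟧)) ∷
  (facts "01020814234567" "0304050607121315161725262734464789" ,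
    (split 1 8 (triple 0 1 8) $
     split 2 8 (triple 0 2 8) $
     split 5 8 (pentagon 0 1 4 5 8) $
     split 5 9 (matching ⟦ "0814235967" ⟧) $
     split 1 9 (matching ⟦ "0819234567" ⟧) $
     split 6 9 (use 2 ⟦ "0123456789" ⟧) $
     split 7 9 (use 2 ⟦ "0123457689" ⟧) $
     split 3 6 (use 1 ⟦ "0123456789" ⟧) $
     split 3 7 (use 1 ⟦ "0123457689" ⟧) $
     split 2 9
       (split 0 9 (triple 0 2 9) $
        split 3 9 (triple 2 3 9) $
        split 4 9 (pentagon 0 1 4 9 2) $
        split 3 8 (matching ⟦ "0129384567" ⟧) $
        split 3 5 (matching ⟦ "0814293567" ⟧) $
        split 5 6 (use 10 ⟦ "4523106798" ⟧) $
        split 5 7 (use 10 ⟦ "4523107698" ⟧) $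
        split 6 8
          (split 7 8 (triple 6 7 8) $
           clique ⟦ "135789" ⟧) $
        clique ⟦ "135689" ⟧) $
     use 0 ⟦ "0123456789" ⟧)) ∷
  (facts "0102142336455867" "03040506070809121315172526272934383946475689" ,
    (split 4 8 (triple 4 5 8) $
     split 4 9 (matching ⟦ "0123495867" ⟧) $
     split 7 9 (matching ⟦ "0214365879" ⟧) $
     split 6 9 (use 13 ⟦ "1032456798" ⟧) $
     use 1 ⟦ "1045236789" ⟧)) ∷
  (facts "01021423364567" "0304050607080912131516171819242526273435464789" ,
    (split 3 7 (triple 3 6 7) $
     split 5 6 (use 5 ⟦ "6732540189" ⟧) $
     split 2 8 (use 1 ⟦ "2301674589" ⟧) $
     split 2 9 (use 1 ⟦ "2301674598" ⟧) $
     split 3 8 (use 1 ⟦ "3267014589" ⟧) $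
     split 3 9 (use 1 ⟦ "3267014598" ⟧) $
     split 5 8 (use 0 ⟦ "0123456789" ⟧) $
     split 5 9 (use 0 ⟦ "0123456798" ⟧) $
     split 7 8 (use 0 ⟦ "2301674589" ⟧) $
     split 6 8
       (split 7 9 (matching ⟦ "0123456879" ⟧) $
        split 5 7 (use 1 ⟦ "6732540189" ⟧) $
        clique ⟦ "035789" ⟧) $
     use 2 ⟦ "0123457698" ⟧)) ∷
  (facts "0123456769" "030405070809343537383947485789" ,
    (split 7 9 (triple 6 7 9) $
     split 7 8 (matching ⟦ "0123456978" ⟧) $
     split 4 9
       (split 5 9 (triple 4 5 9) $
        split 5 8 (matching ⟦ "0123495867" ⟧) $
        clique ⟦ "035789" ⟧) $
     clique ⟦ "034789" ⟧)) ∷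
  (facts "01021423284567" "0304050607080912131517252627343536374647565789" ,
    (split 3 8 (triple 2 3 8) $
     split 4 8 (pentagon 0 1 4 8 2) $
     split 3 9 (matching ⟦ "0128394567" ⟧) $
     split 6 9 (use 0 ⟦ "0123456789" ⟧) $
     split 7 9 (use 0 ⟦ "0123457689" ⟧) $
     split 4 9
       (split 5 8 (use 0 ⟦ "0123765498" ⟧) $
        split 5 9 (triple 4 5 9) $
        use 0 ⟦ "0145762398" ⟧) $
     use 4 ⟦ "1045236789" ⟧)) ∷
  (facts "01021423456768" "030405070809121517181924252728293435374748495789" ,
    (split 7 8 (triple 6 7 8) $
     split 7 9 (matching ⟦ "0123456879" ⟧) $
     split 3 9
       (split 5 8 (matching ⟦ "0214395867" ⟧) $
        split 5 9
          (split 3 8 (matching ⟦ "0214385967" ⟧) $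
           use 15 ⟦ "0167234589" ⟧) $
        use 37 ⟦ "0167235489" ⟧) $
     split 3 8
       (split 5 9 (use 37 ⟦ "1067453289" ⟧) $
        use 15 ⟦ "0167234598" ⟧) $
     clique ⟦ "034789" ⟧)) ∷
  (facts "010214234567" "0304050607122425262789" ,
    (split 1 5 (triple 1 4 5) $
     split 3 4 (pentagon 0 1 4 3 2) $
     split 1 3 (use 9 ⟦ "1032456789" ⟧) $
     split 1 6 (use 9 ⟦ "1045672389" ⟧) $
     split 1 7 (use 9 ⟦ "1045762389" ⟧) $
     split 4 6 (use 9 ⟦ "4510672389" ⟧) $
     split 4 7 (use 9 ⟦ "4510762389" ⟧) $
     split 0 8 (use 5 ⟦ "0123456789" ⟧) $
     split 0 9 (use 5 ⟦ "0123456798" ⟧) $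
     split 1 8 (use 5 ⟦ "1045236789" ⟧) $
     split 1 9 (use 5 ⟦ "1045236798" ⟧) $
     split 3 5
       (split 3 6 (use 9 ⟦ "3254670189" ⟧) $
        split 3 7 (use 9 ⟦ "3254760189" ⟧) $
        split 5 6 (use 9 ⟦ "5432670189" ⟧) $
        split 5 7 (use 9 ⟦ "5432760189" ⟧) $
        split 2 8 (use 5 ⟦ "2301546789" ⟧) $
        split 2 9 (use 5 ⟦ "2301546798" ⟧) $
        split 3 8 (use 5 ⟦ "3254016789" ⟧) $
        split 3 9 (use 5 ⟦ "3254016798" ⟧) $
        split 4 8 (use 5 ⟦ "4510326789" ⟧) $
        split 4 9 (use 5 ⟦ "4510326798" ⟧) $
        split 5 8 (use 5 ⟦ "5432106789" ⟧) $
        split 6 8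
          (split 7 8 (triple 6 7 8) $
           split 7 9 (matching ⟦ "0123456879" ⟧) $
           use 37 ⟦ "1067324589" ⟧) $
        split 6 9
          (split 7 8 (matching ⟦ "0123456978" ⟧) $
           apex 8 ⟦ "012345679" ⟧) $
        clique ⟦ "034689" ⟧) $
     split 3 6 (use 3 ⟦ "0123456789" ⟧) $
     split 3 7 (use 3 ⟦ "0123457689" ⟧) $
     split 5 6 (use 3 ⟦ "1045236789" ⟧) $
     split 5 7 (use 3 ⟦ "1045237689" ⟧) $
     split 2 8 (use 1 ⟦ "0123456789" ⟧) $
     split 2 9 (use 1 ⟦ "0123456798" ⟧) $
     split 4 8 (use 1 ⟦ "1045236789" ⟧) $
     split 4 9 (use 1 ⟦ "1045236798" ⟧) $
     split 6 8 (use 0 ⟦ "0123456789" ⟧) $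
     split 6 9 (use 0 ⟦ "0123456798" ⟧) $
     split 7 8 (use 0 ⟦ "0123457689" ⟧) $
     split 7 9 (use 0 ⟦ "0123457698" ⟧) $
     split 3 8
       (split 5 9 (matching ⟦ "0214385967" ⟧) $
        split 3 9
          (split 5 8 (matching ⟦ "0214395867" ⟧) $
           use 2 ⟦ "1045673298" ⟧) $
        use 16 ⟦ "0167234598" ⟧) $
     split 3 9
       (split 5 8 (matching ⟦ "0214395867" ⟧) $
        apex 8 ⟦ "012345679" ⟧) $
     clique ⟦ "034689" ⟧)) ∷
  (facts "012345465967" "0304070809343738394789" ,
    (split 4 9 (triple 4 5 9) $
     split 7 9 (pentagon 4 5 9 7 6) $
     split 7 8 (matching ⟦ "0123465978" ⟧) $
     split 4 8 (matching ⟦ "0123485967" ⟧) $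
     clique ⟦ "034789" ⟧)) ∷
  (facts "01021823454667" "03040506070809141516242734353637383989" ,
    (split 5 6 (triple 4 5 6) $
     split 4 7 (triple 4 6 7) $
     split 5 9 (use 0 ⟦ "0123456789" ⟧) $
     split 5 8 (use 0 ⟦ "0123456798" ⟧) $
     split 7 9 (use 0 ⟦ "0123674589" ⟧) $
     split 5 7
       (split 4 9 (use 0 ⟦ "0123547689" ⟧) $
        split 4 8 (use 0 ⟦ "0123547698" ⟧) $
        split 6 9 (use 0 ⟦ "0123765489" ⟧) $
        split 6 8 (use 0 ⟦ "0123765498" ⟧) $
        split 2 9 (use 31 ⟦ "2345016798" ⟧) $
        use 39 ⟦ "5410237689" ⟧) $
     use 4 ⟦ "3245761098" ⟧)) ∷
  (facts "010218234567" "030405060714151617242526273435363789" ,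
    (split 0 8 (triple 0 1 8) $
     split 3 8 (pentagon 0 1 8 3 2) $
     split 3 9 (matching ⟦ "0218394567" ⟧) $
     split 0 9 (matching ⟦ "0918234567" ⟧) $
     split 4 6 (use 0 ⟦ "0123456789" ⟧) $
     split 4 7 (use 0 ⟦ "0123457689" ⟧) $
     split 5 6 (use 0 ⟦ "0123546789" ⟧) $
     split 5 7 (use 0 ⟦ "0123547689" ⟧) $
     split 4 9
       (split 5 9 (triple 4 5 9) $
        split 6 8 (use 5 ⟦ "0123546798" ⟧) $
        use 5 ⟦ "0123674589" ⟧) $
     split 6 8 (use 5 ⟦ "0123456798" ⟧) $
     split 7 8 (use 5 ⟦ "0123457698" ⟧) $
     split 7 9
       (split 6 9 (triple 6 7 9) $
        use 5 ⟦ "3276451098" ⟧) $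
     use 5 ⟦ "3267451098" ⟧)) ∷
  (facts "0123454667" "0304050607121415161718192425262734353637383989" ,
    (split 5 6 (triple 4 5 6) $
     split 4 7 (triple 4 6 7) $
     split 5 8 (use 0 ⟦ "4567012389" ⟧) $
     split 5 9 (use 0 ⟦ "4567012398" ⟧) $
     split 7 8 (use 0 ⟦ "6745012389" ⟧) $
     split 7 9 (use 0 ⟦ "6745012398" ⟧) $
     split 1 3
       (split 0 8 (use 0 ⟦ "1032456789" ⟧) $
        split 0 9 (use 0 ⟦ "1032456798" ⟧) $
        split 5 7
          (split 4 9 (use 2 ⟦ "0123547689" ⟧) $
           split 4 8 (use 2 ⟦ "0123547698" ⟧) $
           clique ⟦ "034789" ⟧) $
        clique ⟦ "035789" ⟧) $
     split 5 7
       (split 4 9 (use 2 ⟦ "1023547689" ⟧) $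
        split 4 8 (use 2 ⟦ "1023547698" ⟧) $
        clique ⟦ "134789" ⟧) $
     clique ⟦ "135789" ⟧)) ∷
  (facts "0123454867" "0304050607080934353637383947565789" ,
    (split 5 8 (triple 4 5 8) $
     split 6 9 (use 7 ⟦ "0123546789" ⟧) $
     use 7 ⟦ "0123674598" ⟧)) ∷
  (facts "01234567" "03040506070809343536373839464748565789" ,
    (split 6 9 (use 8 ⟦ "0123456789" ⟧) $
     split 4 9 (use 0 ⟦ "0123456798" ⟧) $
     split 6 8 (use 8 ⟦ "0123456798" ⟧) $
     clique ⟦ "034689" ⟧)) ∷
  (facts "01234567" "030405060712141516171819242526273435363738394689" ,
    (split 4 7 (use 2 ⟦ "0123457689" ⟧) $
     split 5 6 (use 2 ⟦ "0123546789" ⟧) $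
     split 5 7 (use 2 ⟦ "0123547689" ⟧) $
     split 1 3
       (split 0 8 (use 3 ⟦ "1032456789" ⟧) $
        split 0 9 (use 3 ⟦ "1032456798" ⟧) $
        split 4 8 (use 1 ⟦ "0123456789" ⟧) $
        use 0 ⟦ "0123456789" ⟧) $
     split 4 8 (use 1 ⟦ "1023456789" ⟧) $
     use 0 ⟦ "1023456789" ⟧)) ∷
  (facts "0102234567" "030405060712142425262789" ,
    (split 1 5 (use 7 ⟦ "0123546789" ⟧) $
     split 1 6 (use 7 ⟦ "0123674589" ⟧) $
     split 1 7 (use 7 ⟦ "0123764589" ⟧) $
     split 3 4 (use 7 ⟦ "2301456789" ⟧) $
     split 3 5 (use 7 ⟦ "2301546789" ⟧) $
     split 3 6 (use 7 ⟦ "2301674589" ⟧) $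
     split 3 7 (use 7 ⟦ "2301764589" ⟧) $
     split 1 8 (use 4 ⟦ "0123456789" ⟧) $
     split 1 9 (use 4 ⟦ "0123456798" ⟧) $
     split 3 8 (use 4 ⟦ "2301456789" ⟧) $
     split 3 9 (use 4 ⟦ "2301456798" ⟧) $
     split 4 6 (use 3 ⟦ "0123456789" ⟧) $
     use 0 ⟦ "0123456789" ⟧)) ∷
  (facts "0102234567" "03041289" ,
    (split 0 5 (use 18 ⟦ "0123546789" ⟧) $
     split 0 6 (use 18 ⟦ "0123674589" ⟧) $
     split 0 7 (use 18 ⟦ "0123764589" ⟧) $
     split 2 4 (use 18 ⟦ "2301456789" ⟧) $
     split 2 5 (use 18 ⟦ "2301546789" ⟧) $
     split 2 6 (use 18 ⟦ "2301674589" ⟧) $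
     split 2 7 (use 18 ⟦ "2301764589" ⟧) $
     split 1 4 (use 8 ⟦ "0123456789" ⟧) $
     use 0 ⟦ "0123456789" ⟧)) ∷
  (facts "0102234567" "89" ,
    (split 1 2 (triple 0 1 2) $
     split 0 3 (triple 0 2 3) $
     split 0 4 (use 19 ⟦ "0123456789" ⟧) $
     use 0 ⟦ "0123456789" ⟧)) ∷
  (facts "0108234567" "020304050607131415161724252627343536374647565789" ,
    (split 1 8 (triple 0 1 8) $
     split 1 9 (matching ⟦ "0819234567" ⟧) $
     split 2 8
       (split 3 8 (triple 2 3 8) $
        split 3 9 (matching ⟦ "0128394567" ⟧) $
        split 5 8 (use 5 ⟦ "1023546789" ⟧) $
        split 5 9 (use 5 ⟦ "1023546798" ⟧) $
        use 5 ⟦ "3245016789" ⟧) $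
     split 2 9
       (split 3 9 (triple 2 3 9) $
        split 3 8 (matching ⟦ "0129384567" ⟧) $
        split 5 8 (use 5 ⟦ "1023546789" ⟧) $
        split 5 9 (use 5 ⟦ "1023546798" ⟧) $
        use 5 ⟦ "3245016789" ⟧) $
     use 3 ⟦ "0132456789" ⟧)) ∷
  []

tree4 : Tree
tree4 =
  split 8 9 (matching ⟦ "0123456789" ⟧) $
  split 0 2 (use 1 ⟦ "0123456789" ⟧) $
  split 0 3 (use 1 ⟦ "0132456789" ⟧) $
  split 1 2 (use 1 ⟦ "1023456789" ⟧) $
  split 1 3 (use 1 ⟦ "1032456789" ⟧) $
  split 0 4 (use 1 ⟦ "0145236789" ⟧) $
  split 0 5 (use 1 ⟦ "0154236789" ⟧) $
  split 1 4 (use 1 ⟦ "1045236789" ⟧) $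
  split 1 5 (use 2 ⟦ "1054236789" ⟧) $
  split 0 6 (use 1 ⟦ "0167234589" ⟧) $
  split 0 7 (use 1 ⟦ "0176234589" ⟧) $
  split 1 6 (use 1 ⟦ "1067234589" ⟧) $
  split 1 7 (use 2 ⟦ "1076234589" ⟧) $
  split 2 4 (use 1 ⟦ "2345016789" ⟧) $
  split 2 5 (use 1 ⟦ "2354016789" ⟧) $
  split 3 4 (use 1 ⟦ "3245016789" ⟧) $
  split 3 5 (use 2 ⟦ "3254016789" ⟧) $
  split 2 6 (use 1 ⟦ "2367014589" ⟧) $
  split 2 7 (use 1 ⟦ "2376014589" ⟧) $
  split 3 6 (use 1 ⟦ "3267014589" ⟧) $
  split 3 7 (use 2 ⟦ "3276014589" ⟧) $
  split 4 6 (use 1 ⟦ "4567012389" ⟧) $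
  split 4 7 (use 1 ⟦ "4576012389" ⟧) $
  split 5 6 (use 1 ⟦ "5467012389" ⟧) $
  split 5 7 (use 3 ⟦ "5476012389" ⟧) $
  split 1 8 (use 0 ⟦ "1023456789" ⟧) $
  split 1 9 (use 0 ⟦ "1023456798" ⟧) $
  split 2 8 (use 0 ⟦ "2301456789" ⟧) $
  split 2 9 (use 0 ⟦ "2301456798" ⟧) $
  use 4 ⟦ "0132456789" ⟧

verified0 : T (Checker.checkAll 6 0 [] [] [] tree0)
verified0 = tt

verified1 : T (Checker.checkAll 7 1 [] cases1 (facts "01" "") tree1)
verified1 = tt

verified2 : T (Checker.checkAll 8 2 [] cases2 (facts "0123" "") tree2)
verified2 = tt

verified3 : T (Checker.checkAll 9 3 [] cases3 (facts "012345" "") tree3)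
verified3 = tt

verified4 : T (Checker.checkAll 10 4 [] cases4 (facts "01234567" "") tree4)
verified4 = tt

-- The vertices at positions 2s and 2s+1 with s < t share the colour s.
pairColour : ℕ → ℕ → ℕ
pairColour zero    i             = i
pairColour (suc t) zero          = 0
pairColour (suc t) (suc zero)    = 0
pairColour (suc t) (suc (suc i)) = suc (pairColour t i)

-- Of the d + t positions, t repeat the colour of their partner.
pairColour< : ∀ t {d i} → t ≤ d → i < d + t → pairColour t i < d
pairColour< zero {d} _ i< = subst (_ <_) (+-identityʳ d) i<
pairColour< (suc t) {suc d} {zero}        _ _ = s≤s z≤n
pairColour< (suc t) {suc d} {suc zero}    _ _ = s≤s z≤n
pairColour< (suc t) {suc d} {suc (suc i)} (s≤s t≤d) (s≤s i<) =
  s≤s (pairColour< t t≤d (s≤s⁻¹ (subst (suc (suc i) ≤_) (+-suc d t) i<)))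

data SameColour (t : ℕ) : ℕ → ℕ → Set where
  equal : ∀ {i} → SameColour t i i
  up    : ∀ {s} → s < t → SameColour t (double s) (suc (double s))
  down  : ∀ {s} → s < t → SameColour t (suc (double s)) (double s)

pairColour-injective : ∀ t i j → pairColour t i ≡ pairColour t j → SameColour t i j
pairColour-injective zero    i             .i            refl = equal
pairColour-injective (suc t) zero          zero          _ = equal
pairColour-injective (suc t) zero          (suc zero)    _ = up (s≤s z≤n)
pairColour-injective (suc t) (suc zero)    zero          _ = down (s≤s z≤n)
pairColour-injective (suc t) (suc zero)    (suc zero)    _ = equal
pairColour-injective (suc t) (suc (suc i)) (suc (suc j)) e with pairColour-injective t i j (suc-injective e)
... | equal  = equal
... | up l   = up (s≤s l)
... | down l = down (s≤s l)

double-mono : ∀ {s t} → s < t → suc (double s) < double t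
double-mono {zero}  (s≤s _) = s≤s (s≤s z≤n)
double-mono {suc s} (s≤s l) = s≤s (s≤s (double-mono l))

-- Extending injective labellings

module _ {k : ℕ} where

  private V = Fin k

  Hit : (ℕ → V) → ℕ → V → Set
  Hit ρ N v = ∃[ i ] ρ (toℕ {N} i) ≡ v

  -- If every vertex were hit, choosing preimages would inject `Fin k` into `Fin N`.
  missed : ∀ {N} (ρ : ℕ → V) → N < k → ∃[ v ] ¬ Hit ρ N v
  missed {N} ρ N<k = F.¬∀⟶∃¬ k (Hit ρ N) (λ v → F.any? λ i → ρ (toℕ i) F.≟ v) λ hit →
    <⇒≱ N<k (F.injective⇒≤ {f = proj₁ ∘ hit} λ {u} {v} e →
      trans (sym (proj₂ (hit u))) (trans (cong (ρ ∘ toℕ) e) (proj₂ (hit v))))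

  override : (ℕ → V) → ℕ → V → ℕ → V
  override ρ N v i with i ≟ N
  ... | yes _ = v
  ... | no  _ = ρ i

  override-here : ∀ ρ N v → override ρ N v N ≡ v
  override-here ρ N v with N ≟ N
  ... | yes _ = refl
  ... | no ¬e = contradiction refl ¬e

  override-there : ∀ ρ {N} v {i} → i ≢ N → override ρ N v i ≡ ρ i
  override-there ρ {N} v {i} i≢N with i ≟ N
  ... | yes e = contradiction e i≢N
  ... | no  _ = refl

  override-injective : ∀ {ρ N v} → InjectiveBelow N ρ → (∀ i → i < N → ρ i ≢ v) → InjectiveBelow (suc N) (override ρ N v)
  override-injective {ρ} {N} {v} inj fresh {i} {j} i< j< e with i ≟ N | j ≟ N
  ... | yes refl | yes refl = refl
  ... | yes refl | no j≢    = contradiction (sym e) (fresh j (≤∧≢⇒< (s≤s⁻¹ j<) j≢))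
  ... | no i≢    | yes refl = contradiction e (fresh i (≤∧≢⇒< (s≤s⁻¹ i<) i≢))
  ... | no i≢    | no j≢    = inj (≤∧≢⇒< (s≤s⁻¹ i<) i≢) (≤∧≢⇒< (s≤s⁻¹ j<) j≢) e

  extend : ∀ {N ρ} d → InjectiveBelow N ρ → d + N ≤ k →
           ∃[ ρ′ ] InjectiveBelow (d + N) ρ′ × (∀ {i} → i < N → ρ′ i ≡ ρ i)
  extend {ρ = ρ} zero inj _ = ρ , inj , λ _ → refl
  extend {N} (suc d) inj le with extend d inj (≤-trans (n≤1+n _) le)
  ... | σ , σ-inj , agree with missed σ le
  ...   | v , ¬hit = override σ (d + N) v ,
          override-injective σ-inj (λ i i< e → ¬hit (fromℕ< i< , trans (cong σ (F.toℕ-fromℕ< i<)) e)) ,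
          λ i< → trans (override-there σ v (<⇒≢ (≤-trans i< (m≤n+m N d)))) (agree i<)

  -- A vertex that is not hit could be appended as one more value, giving k + 1 distinct elements of
  -- `Fin k`.
  covers : ∀ {ρ} → InjectiveBelow k ρ → ∀ v → Hit ρ k v
  covers {ρ} inj v with F.any? {n = k} (λ i → ρ (toℕ i) F.≟ v)
  ... | yes h = h
  ... | no ¬h = contradiction (F.injective⇒≤ {f = λ i → override ρ k v (toℕ {suc k} i)}
          (λ {i} {j} e → F.toℕ-injective (override-injective inj
            (λ i i< e → ¬h (fromℕ< i< , trans (cong ρ (F.toℕ-fromℕ< i<)) e)) (F.toℕ<n i) (F.toℕ<n j) e))) (<⇒≱ ≤-refl)

-- From matchings of the complement to colourings

module _ (G : Graph) where

  private V = Fin (n G)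

  -- The t pairs are t colour classes; the other 5 + t - 2t = 5 - t vertices get a colour each.
  matched⇒colorable : ∀ {t} → Matched G t → t ≤ 5 → n G ≡ 5 + t → Colorable G 5
  matched⇒colorable {t} (ρ , inj , mat) t≤5 eq = colour , proper
    where
    double≡ : ∀ t → double t ≡ t + t
    double≡ zero    = refl
    double≡ (suc t) = cong suc (trans (cong suc (double≡ t)) (sym (+-suc t t)))
    total : 5 ∸ t + double t ≡ n G
    total = trans (cong (5 ∸ t +_) (double≡ t))
      (trans (sym (+-assoc (5 ∸ t) t t)) (trans (cong (_+ t) (m∸n+n≡m t≤5)) (sym eq)))
    extension = extend (5 ∸ t) inj (≤-reflexive total)
    σ = proj₁ extension
    σ-inj = proj₁ (proj₂ extension)
    agree : ∀ {i} → i < double t → σ i ≡ ρ i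
    agree = proj₂ (proj₂ extension)
    pos : ∀ v → Hit σ (n G) v
    pos = covers {ρ = σ} (subst (λ N → InjectiveBelow N σ) total σ-inj)
    p : V → ℕ
    p v = toℕ (proj₁ (pos v))
    p< : ∀ v → pairColour t (p v) < 5
    p< v = pairColour< t t≤5 (subst (p v <_) eq (F.toℕ<n (proj₁ (pos v))))
    colour : V → Fin 5
    colour v = fromℕ< (p< v)
    nonadj : ∀ {i j} → SameColour t i j → adj G (σ i) (σ j) ≡ false
    nonadj equal = adj-irrefl G _
    nonadj (up {s} l) rewrite agree (double-mono l) | agree (<-trans (n<1+n _) (double-mono l)) = mat s l
    nonadj (down {s} l) rewrite agree (double-mono l) | agree (<-trans (n<1+n _) (double-mono l)) = trans (adj-sym G _ _) (mat s l)
    proper : ∀ u v → Edge G u v → colour u ≢ colour v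
    proper u v uv e with trans (sym uv) (trans (sym (cong₂ (adj G) (proj₂ (pos u)) (proj₂ (pos v))))
      (nonadj (pairColour-injective t (p u) (p v) (F.fromℕ<-injective _ _ (p< u) (p< v) e))))
    ... | ()

  inject-colour : n G ≤ 5 → Colorable G 5
  inject-colour le = (λ v → inject≤ v le) , λ u v uv e → 
    contradiction (trans (sym (adj-irrefl G u)) (trans (cong (adj G u) (F.inject≤-injective le le u v e)) uv)) λ ()

Conclusion : Graph → Set
Conclusion G =
  Contains G (K 6)
    ⊎ Contains G (coC 7 ⊕ K 2)
    ⊎ Contains G (coC 9 ⊕ K 1)
    ⊎ (IndependenceNumber G 2 × 11 ≤ n G)
    ⊎ (IndependenceNumber G 2 × MaxDegree≥ G 9)
    ⊎ (∃[ m ] (1 ≤ m × Σ (Fin (2 * m + 1) → ℕ) λ k →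
         (∀ i → 1 ≤ k i) × 5 * m < sumF (2 * m + 1) k × G ≅ cliqueExpansion (2 * m + 1) k))
    ⊎ Colorable G 5

pattern case-i x   = inj₁ x
pattern case-ii x  = inj₂ (inj₁ x)
pattern case-iv x  = inj₂ (inj₂ (inj₂ (inj₁ x)))
pattern case-v x   = inj₂ (inj₂ (inj₂ (inj₂ (inj₁ x))))
pattern case-vi x  = inj₂ (inj₂ (inj₂ (inj₂ (inj₂ (inj₁ x)))))
pattern case-vii x = inj₂ (inj₂ (inj₂ (inj₂ (inj₂ (inj₂ x)))))

-- Graphs without an independent triple

module _ (G : Graph) (noTriple : NoIndependentTriple G) (noC5 : ¬ ContainsInduced G (C 5)) where

  private V = Fin (n G)

  complete⇒K6 : 6 ≤ n G → (∀ u v → u ≢ v → Edge G u v) → Contains G (K 6)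
  complete⇒K6 le complete = (λ i → inject≤ i le) , (λ {i} {j} → F.inject≤-injective le le i j) ,
    λ i j ij → complete _ _ λ e → ≢-edge i j ij (F.inject≤-injective le le i j e)
    where
    ≢-edge : ∀ i j → Edge (K 6) i j → i ≢ j
    ≢-edge i .i e refl = contradiction (trans (sym (adj-irrefl (K 6) i)) e) λ ()

  independence : ∀ {u v} → u ≢ v → NonEdge G u v → IndependenceNumber G 2
  independence {u} {v} u≢v uv = (f , (λ {i} {j} → f-inj i j) , f-indep) , bound
    where
    f : Fin 2 → V
    f zero       = u
    f (suc zero) = v
    f-inj : ∀ i j → f i ≡ f j → i ≡ j
    f-inj zero       zero       _ = refl
    f-inj zero       (suc zero) e = contradiction e u≢v
    f-inj (suc zero) zero       e = contradiction (sym e) u≢v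
    f-inj (suc zero) (suc zero) _ = refl
    f-indep : ∀ i j → adj G (f i) (f j) ≡ false
    f-indep zero       zero       = adj-irrefl G u
    f-indep zero       (suc zero) = uv
    f-indep (suc zero) zero       = trans (adj-sym G v u) uv
    f-indep (suc zero) (suc zero) = adj-irrefl G v
    bound : ∀ m → HasIndep G m → m ≤ 2
    bound zero                _ = z≤n
    bound (suc zero)          _ = s≤s z≤n
    bound (suc (suc zero))    _ = s≤s (s≤s z≤n)
    bound (suc (suc (suc m))) (g , g-inj , indep) = ⊥-elim (noTriple (g zero) (g (suc zero)) (g (suc (suc zero)))
      (λ e → F.0≢1+n (g-inj e)) (λ e → F.0≢1+n (F.suc-injective (g-inj e))) (λ e → F.0≢1+n (g-inj e))
      (indep _ _) (indep _ _) (indep _ _))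

  -- The 6 - m vertices added to the m pairs, together with one end of each pair, are six candidates
  -- for K₆; this is where 6 + m labels come from.
  enlarge : ∀ m → m < 5 → 6 + m ≤ n G → Matched G m → Outcome G noTriple noC5 (6 + m) m
  enlarge m m<5 le (ρ , inj , mat) = apply m m<5 mat′ σ-inj
    where
    double-6 : ∀ m → m ≤ 6 → 6 ∸ m + double m ≡ 6 + m
    double-6 0 _ = refl
    double-6 1 _ = refl
    double-6 2 _ = refl
    double-6 3 _ = refl
    double-6 4 _ = refl
    double-6 5 _ = refl
    double-6 6 _ = refl
    double-6 (suc (suc (suc (suc (suc (suc (suc m))))))) (s≤s (s≤s (s≤s (s≤s (s≤s (s≤s ()))))))
    size = double-6 m (≤-trans (<⇒≤ m<5) (n≤1+n 5))
    extension = extend (6 ∸ m) inj (≤-trans (≤-reflexive size) le)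
    σ = proj₁ extension
    σ-inj : InjectiveBelow (6 + m) σ
    σ-inj = subst (λ N → InjectiveBelow N σ) size (proj₁ (proj₂ extension))
    agree : ∀ {i} → i < double m → σ i ≡ ρ i
    agree = proj₂ (proj₂ extension)
    mat′ : Matching G m σ
    mat′ i l rewrite agree (double-mono l) | agree (<-trans (n<1+n _) (double-mono l)) = mat i l
    apply : ∀ m → m < 5 → Matching G m σ → InjectiveBelow (6 + m) σ → Outcome G noTriple noC5 (6 + m) m
    apply 0 _ M inj = checkAll-sound G noTriple noC5 6 0 [] [] tree0 [] verified0 σ inj []
    apply 1 _ M inj = checkAll-sound G noTriple noC5 7 1 cases1 (facts "01" "") tree1 [] verified1 σ inj
      (M 0 (s≤s z≤n) ∷ [])
    apply 2 _ M inj = checkAll-sound G noTriple noC5 8 2 cases2 (facts "0123" "") tree2 [] verified2 σ inj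
      (M 0 (s≤s z≤n) ∷ M 1 (s≤s (s≤s z≤n)) ∷ [])
    apply 3 _ M inj = checkAll-sound G noTriple noC5 9 3 cases3 (facts "012345" "") tree3 [] verified3 σ inj
      (M 0 (s≤s z≤n) ∷ M 1 (s≤s (s≤s z≤n)) ∷ M 2 (s≤s (s≤s (s≤s z≤n))) ∷ [])
    apply 4 _ M inj = checkAll-sound G noTriple noC5 10 4 cases4 (facts "01234567" "") tree4 [] verified4 σ inj
      (M 0 (s≤s z≤n) ∷ M 1 (s≤s (s≤s z≤n)) ∷ M 2 (s≤s (s≤s (s≤s z≤n))) ∷ M 3 (s≤s (s≤s (s≤s (s≤s z≤n)))) ∷ [])
    apply (suc (suc (suc (suc (suc m))))) (s≤s (s≤s (s≤s (s≤s (s≤s ()))))) M inj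

  small-independence : Conclusion G
  small-independence with n G ≤? 5
  ... | yes le = case-vii (inject-colour G le)
  ... | no  gt with F.any? (λ u → F.any? λ v → ¬? (u F.≟ v) ×-dec (adj G u v 𝔹.≟ false))
  ...   | no complete = case-i (complete⇒K6 (≰⇒> gt) λ u v u≢v → 𝔹.¬-not λ uv → complete (u , v , u≢v , uv))
  ...   | yes (u , v , u≢v , uv) with 11 ≤? n G
  ...     | yes le = case-iv (independence u≢v uv , le)
  ...     | no  lt = finish (grow t ≤-refl)
    where
    t = n G ∸ 5
    size : n G ≡ 5 + t
    size = sym (m+[n∸m]≡n (<⇒≤ (≰⇒> gt)))
    t≤5 : t ≤ 5
    t≤5 = +-cancelˡ-≤ 5 t 5 (subst (_≤ 10) size (s≤s⁻¹ (≰⇒> lt)))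
    grow : ∀ m → m ≤ t → Conclusion G ⊎ Matched G m
    -- Even the empty matching comes with a total labelling, for which u is a junk value.
    grow zero    _   = inj₂ ((λ _ → u) , (λ ()) , λ _ ())
    grow (suc m) m<t with grow m (<⇒≤ m<t)
    ... | inj₁ c = inj₁ c
    ... | inj₂ M with enlarge m (≤-trans m<t t≤5) (subst (6 + m ≤_) (sym size) (+-monoʳ-≤ 5 m<t)) M
    ...   | inj₁ k                      = inj₁ (case-i k)
    ...   | inj₂ (inj₁ h)               = inj₁ (case-ii h)
    ...   | inj₂ (inj₂ (inj₁ d))        = inj₁ (case-v (independence u≢v uv , d))
    ...   | inj₂ (inj₂ (inj₂ M′))       = inj₂ M′
    finish : Conclusion G ⊎ Matched G t → Conclusion G
    finish (inj₁ c) = c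
    finish (inj₂ M) = case-vii (matched⇒colorable G M t≤5 size)

-- Expansions of paths and cycles

least : ∀ (P : ℕ → Bool) N →
  (∃[ i ] i < N × P i ≡ true × (∀ {j} → j < i → P j ≡ false)) ⊎ (∀ {j} → j < N → P j ≡ false)
least P zero = inj₂ λ ()
least P (suc N) with P 0 in eq
... | true  = inj₁ (0 , s≤s z≤n , eq , λ ())
... | false with least (P ∘ suc) N
...   | inj₁ (i , i< , Pi , below) = inj₁ (suc i , s≤s i< , Pi , λ { {zero} _ → eq ; {suc j} (s≤s l) → below l })
...   | inj₂ none = inj₂ λ { {zero} _ → eq ; {suc j} (s≤s l) → none l }

-- The comparison of the literals a and b is left to evaluation; this disposes of the index bounds
-- in the arguments along a path.
lift : ∀ a b {i} {_ : T (a ≤ᵇ b)} → a + i ≤ b + i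
lift a b {i} {t} = +-monoˡ-≤ i (≤ᵇ⇒≤ a b t)

lower : ∀ a b {i p} {_ : T (a ≤ᵇ b)} → b + i ≤ p → a + i ≤ p
lower a b {i} {p} {t} h = ≤-trans (lift a b {i} {t}) h

-- Forbidden subgraphs and induced paths

module _ (G : Graph) where

  private V = Fin (n G)

  -- This yields injectivity: a map that preserves adjacency and non-adjacency cannot identify
  -- vertices with different neighbourhoods.
  bull-twinless : ∀ i j → i ≡ j ⊎ (∃[ k ] adj bull i k ≢ adj bull j k)
  bull-twinless = from-yes (F.all? λ i → F.all? λ j → (i F.≟ j) ⊎-dec (F.any? λ k → ¬? (adj bull i k 𝔹.≟ adj bull j k)))

  module Forbidden (noBull : ¬ ContainsInduced G bull) (noClaw : ¬ ContainsInduced G claw) where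

    -- The triangle is x, y, z, and the horns p and q hang from x and y. The five vertices are
    -- distinct by `bull-twinless`.
    bull-free : ∀ x y z p q → Edge G x y → Edge G x z → Edge G y z → Edge G p x → Edge G q y →
      NonEdge G p y → NonEdge G p z → NonEdge G q x → NonEdge G q z → NonEdge G p q → ⊥
    bull-free x y z p q xy xz yz px qy py pz qx qz pq = noBull (f , (λ {i} {j} → f-inj i j) , f-adj)
      where
      f : Fin 5 → V
      f zero                         = p
      f (suc zero)                   = x
      f (suc (suc zero))             = z
      f (suc (suc (suc zero)))       = y
      f (suc (suc (suc (suc zero)))) = q
      upper : ∀ i j → T (toℕ i <ᵇ toℕ j) → adj G (f i) (f j) ≡ adj bull i j
      upper zero (suc zero) _ = px
      upper zero (suc (suc zero)) _ = pz
      upper zero (suc (suc (suc zero))) _ = py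
      upper zero (suc (suc (suc (suc zero)))) _ = pq
      upper (suc zero) (suc (suc zero)) _ = xz
      upper (suc zero) (suc (suc (suc zero))) _ = xy
      upper (suc zero) (suc (suc (suc (suc zero)))) _ = ≁-sym G qx
      upper (suc (suc zero)) (suc (suc (suc zero))) _ = ~-sym G yz
      upper (suc (suc zero)) (suc (suc (suc (suc zero)))) _ = ≁-sym G qz
      upper (suc (suc (suc zero))) (suc (suc (suc (suc zero)))) _ = ~-sym G qy
      f-adj = induced G bull f upper
      f-inj : ∀ i j → f i ≡ f j → i ≡ j
      f-inj i j e with bull-twinless i j
      ... | inj₁ eq       = eq
      ... | inj₂ (k , ne) = contradiction (trans (sym (f-adj i k)) (trans (cong (λ v → adj G v (f k)) e) (f-adj j k))) ne

    -- The leaves of a claw are twins of each other, so their distinctness has to be supplied.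
    claw-free : ∀ c x y z → Edge G c x → Edge G c y → Edge G c z → x ≢ y → x ≢ z → y ≢ z →
      NonEdge G x y → NonEdge G x z → NonEdge G y z → ⊥
    claw-free c x y z cx cy cz x≢y x≢z y≢z xy xz yz = noClaw (f , (λ {i} {j} → f-inj i j) , induced G claw f upper)
      where
      f : Fin 4 → V
      f zero                   = c
      f (suc zero)             = x
      f (suc (suc zero))       = y
      f (suc (suc (suc zero))) = z
      upper : ∀ i j → T (toℕ i <ᵇ toℕ j) → adj G (f i) (f j) ≡ adj claw i j
      upper zero (suc zero) _ = cx
      upper zero (suc (suc zero)) _ = cy
      upper zero (suc (suc (suc zero))) _ = cz
      upper (suc zero) (suc (suc zero)) _ = xy
      upper (suc zero) (suc (suc (suc zero))) _ = xz
      upper (suc (suc zero)) (suc (suc (suc zero))) _ = yz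
      ne : ∀ {u v} → Edge G u v → u ≢ v
      ne e refl = clash G e (adj-irrefl G _)
      distinct : ∀ i j → T (toℕ i <ᵇ toℕ j) → f i ≢ f j
      distinct zero (suc zero) _ = ne cx
      distinct zero (suc (suc zero)) _ = ne cy
      distinct zero (suc (suc (suc zero))) _ = ne cz
      distinct (suc zero) (suc (suc zero)) _ = x≢y
      distinct (suc zero) (suc (suc (suc zero))) _ = x≢z
      distinct (suc (suc zero)) (suc (suc (suc zero))) _ = y≢z
      f-inj : ∀ i j → f i ≡ f j → i ≡ j
      f-inj i j e with <-cmp (toℕ i) (toℕ j)
      ... | tri< lt _ _ = contradiction e (distinct i j (<⇒<ᵇ lt))
      ... | tri≈ _ eq _ = F.toℕ-injective eq
      ... | tri> _ _ gt = contradiction (sym e) (distinct j i (<⇒<ᵇ gt))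

  -- Only the values of c below p matter.
  record InducedPath (p : ℕ) (c : ℕ → V) : Set where
    field
      edge : ∀ i → suc i < p → Edge G (c i) (c (suc i))
      far  : ∀ i {j} → 2 + i ≤ j → j < p → NonEdge G (c i) (c j)

  module _ {p c} (P : InducedPath (4 + p) c) where
    open InducedPath P

    private
      -- Adjacent positions differ because G has no loops; others are told apart by a path vertex
      -- adjacent to just one of them. For positions two apart this vertex lies beyond the stretch
      -- between them, hence the four vertices: the ends of a three-vertex path could coincide.
      distinct : ∀ {i j} → i < j → j < 4 + p → c i ≢ c j
      distinct {i} {suc j} (s≤s i≤j) j< e with m≤n⇒m<n∨m≡n i≤j
      ... | inj₂ refl = clash G (edge i j<) (subst (NonEdge G (c i)) e (adj-irrefl G _))
      ... | inj₁ i<j with m≤n⇒m<n∨m≡n i<j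
      ...   | inj₁ i<j′ = clash G (subst (Edge G (c j)) (sym e) (edge j j<)) (≁-sym G (far i i<j′ (<-trans (n<1+n j) j<)))
      ...   | inj₂ refl with 4 + i ≤? 4 + p
      ...     | yes h = clash G (edge (2 + i) h) (subst (λ v → NonEdge G v (c (3 + i))) e (far i (n≤1+n _) h))
      ...     | no ¬h with i
      ...       | zero  = ¬h (m≤m+n 4 p)
      ...       | suc k = clash G (edge k (lower 2 4 j<)) (subst (NonEdge G (c k)) (sym e) (far k (n≤1+n _) j<))

    path-injective : InjectiveBelow (4 + p) c
    path-injective {i} {j} i< j< e with <-cmp i j
    ... | tri< lt _ _ = contradiction e (distinct lt j<)
    ... | tri≈ _ eq _ = eq
    ... | tri> _ _ gt = contradiction (sym e) (distinct gt i<)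

  prepend : ∀ {p c v} → InducedPath (suc p) c → Edge G v (c 0) → (∀ i → 1 ≤ i → i < suc p → NonEdge G v (c i)) →
    ∃[ c′ ] InducedPath (2 + p) c′
  prepend {p} {c} {v} P e ne = c′ , record { edge = edge′ ; far = far′ }
    where
    open InducedPath P
    c′ : ℕ → V
    c′ zero    = v
    c′ (suc i) = c i
    edge′ : ∀ i → suc i < 2 + p → Edge G (c′ i) (c′ (suc i))
    edge′ zero    _       = e
    edge′ (suc i) (s≤s l) = edge i l
    far′ : ∀ i {j} → 2 + i ≤ j → j < 2 + p → NonEdge G (c′ i) (c′ j)
    far′ zero    {suc j} (s≤s k) (s≤s l) = ne j k l
    far′ (suc i) {suc j} (s≤s k) (s≤s l) = far i k l

  append : ∀ {p c v} → InducedPath (suc p) c → Edge G v (c p) → (∀ i → i < p → NonEdge G v (c i)) →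
    ∃[ c′ ] InducedPath (2 + p) c′
  append {p} {c} {v} P e ne = override c (suc p) v , record { edge = edge′ ; far = far′ }
    where
    open InducedPath P
    old : ∀ {i} → i < suc p → override c (suc p) v i ≡ c i
    old l = override-there c v (<⇒≢ l)
    new : override c (suc p) v (suc p) ≡ v
    new = override-here c (suc p) v
    edge′ : ∀ i → suc i < 2 + p → Edge G (override c (suc p) v i) (override c (suc p) v (suc i))
    edge′ i (s≤s l) with m≤n⇒m<n∨m≡n l
    ... | inj₁ k    = trans (cong₂ (adj G) (old l) (old k)) (edge i k)
    ... | inj₂ refl = trans (cong₂ (adj G) (old l) new) (~-sym G e)
    far′ : ∀ i {j} → 2 + i ≤ j → j < 2 + p → NonEdge G (override c (suc p) v i) (override c (suc p) v j)
    far′ i k (s≤s l) with m≤n⇒m<n∨m≡n l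
    ... | inj₁ l′   = trans (cong₂ (adj G) (old (≤-trans (n≤1+n _) (≤-trans k l))) (old l′)) (far i k l′)
    ... | inj₂ refl = trans (cong₂ (adj G) (old (≤-trans (n≤1+n _) k)) new) (≁-sym G (ne i (s≤s⁻¹ k)))

-- Vertices relative to an induced path with at least five vertices

module _ (G : Graph) (noBull : ¬ ContainsInduced G bull) (noClaw : ¬ ContainsInduced G claw) where

  open Forbidden G noBull noClaw
  private V = Fin (n G)

  module Along (q : ℕ) (c : ℕ → V) (P : InducedPath G (5 + q) c) where
    open InducedPath P

    injective : InjectiveBelow (5 + q) c
    injective = path-injective G P

    edge′ : ∀ i → suc i < 5 + q → Edge G (c (suc i)) (c i)
    edge′ i l = ~-sym G (edge i l)

    far′ : ∀ i {j} → 2 + i ≤ j → j < 5 + q → NonEdge G (c j) (c i)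
    far′ i k l = ≁-sym G (far i k l)

    -- Position k keeps distance at least two from each of i, i+1 and i+2, before or behind them.
    Away : ℕ → ℕ → Set
    Away k i = 2 + k ≤ i ⊎ 4 + i ≤ k

    away-far : ∀ {k i} d {_ : T (d ≤ᵇ 2)} → Away k i → k < 5 + q → d + i < 5 + q → NonEdge G (c k) (c (d + i))
    away-far {k} {i} d {_} (inj₁ l) _ h = far k (≤-trans l (m≤n+m i d)) h
    away-far {k} {i} d {t} (inj₂ l) h _ = far′ (d + i) (≤-trans (+-monoˡ-≤ i (s≤s (s≤s (≤ᵇ⇒≤ d 2 t)))) l) h

    apart : ∀ {i j} → i < j → j < 5 + q → c i ≢ c j
    apart i<j j< e = <⇒≢ i<j (injective (<-trans i<j j<) j< e)

    -- On the path, v sees what c l sees, and c l itself. At an end of the path `prev` or `next` is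
    -- vacuous.
    record Twin (v : V) (l : ℕ) : Set where
      field
        below : ∀ {i} → 2 + i ≤ l → NonEdge G v (c i)
        above : ∀ {i} → 2 + l ≤ i → i < 5 + q → NonEdge G v (c i)
        prev  : ∀ {i} → suc i ≡ l → Edge G v (c i)
        self  : Edge G v (c l)
        next  : suc l < 5 + q → Edge G v (c (suc l))

    record Closer (v : V) : Set where
      field
        first : Edge G v (c 0)
        final : Edge G v (c (4 + q))
        inner : ∀ {i} → 1 ≤ i → i < 4 + q → NonEdge G v (c i)

    Off : V → Set
    Off v = ∀ i → i < 5 + q → v ≢ c i

    Longer : Set
    Longer = ∃[ c′ ] InducedPath G (6 + q) c′

    data Class (v : V) : Set where
      remote : (∀ {i} → i < 5 + q → NonEdge G v (c i)) → Class v
      longer : Longer → Class v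
      twin   : ∀ {l} → l < 5 + q → Twin v l → Class v
      closer : Closer v → Class v

    module _ {v : V} (off : Off v) where

      private
        a : ℕ → Bool
        a i = adj G v (c i)

      claw-at : ∀ i → 3 + i ≤ 5 + q → a i ≡ false → a (1 + i) ≡ true → a (2 + i) ≡ false → ⊥
      claw-at i h n₀ e₁ n₂ = claw-free (c (1 + i)) (c i) (c (2 + i)) v
        (edge′ i (lower 2 3 h)) (edge (1 + i) h) (~-sym G e₁)
        (apart (s≤s (n≤1+n i)) h) (off i (lower 1 3 h) ∘ sym) (off (2 + i) h ∘ sym)
        (far i ≤-refl h) (≁-sym G n₀) (≁-sym G n₂)

      bull-between : ∀ i → 4 + i ≤ 5 + q → a i ≡ false → a (1 + i) ≡ true → a (2 + i) ≡ true → a (3 + i) ≡ false → ⊥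
      bull-between i h n₀ e₁ e₂ n₃ = bull-free (c (1 + i)) (c (2 + i)) v (c i) (c (3 + i))
        (edge (1 + i) (lower 3 4 h)) (~-sym G e₁) (~-sym G e₂) (edge i (lower 2 4 h)) (edge′ (2 + i) h)
        (far i ≤-refl (lower 3 4 h)) (≁-sym G n₀) (far′ (1 + i) ≤-refl h) (≁-sym G n₃) (far i (n≤1+n _) h)

      claw-centre : ∀ {i j k} → 2 + i ≤ j → 2 + j ≤ k → k < 5 + q → a i ≡ true → a j ≡ true → a k ≡ true → ⊥
      claw-centre {i} {j} {k} ij jk k< eᵢ eⱼ eₖ = claw-free v (c i) (c j) (c k) eᵢ eⱼ eₖ
        (apart (lower 1 2 ij) j<) (apart (≤-trans (lower 1 2 ij) (≤-trans (m≤n+m j 2) jk)) k<) (apart (lower 1 2 jk) k<)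
        (far i ij j<) (far i (≤-trans ij (≤-trans (m≤n+m j 2) jk)) k<) (far j jk k<)
        where j< = <-trans (lower 1 2 jk) k<

      -- The triangle is v, c (1+i), c (2+i); c i hangs from c (1+i), and the remote c k from v.
      bull-left : ∀ i k → 3 + i ≤ 5 + q → k < 5 + q → Away k i →
        a i ≡ false → a (1 + i) ≡ true → a (2 + i) ≡ true → a k ≡ true → ⊥
      bull-left i k h k< away n₀ e₁ e₂ eₖ = bull-free (c (1 + i)) v (c (2 + i)) (c i) (c k)
        (~-sym G e₁) (edge (1 + i) h) e₂ (edge i (lower 2 3 h)) (~-sym G eₖ)
        (≁-sym G n₀) (far i ≤-refl h)
        (away-far 1 away k< (lower 2 3 h)) (away-far 2 away k< h) (≁-sym G (away-far 0 away k< (lower 1 3 h)))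

      -- The reflection of `bull-left`: c (2+i) hangs from c (1+i) in the triangle v, c i, c (1+i).
      bull-right : ∀ i k → 3 + i ≤ 5 + q → k < 5 + q → Away k i →
        a i ≡ true → a (1 + i) ≡ true → a (2 + i) ≡ false → a k ≡ true → ⊥
      bull-right i k h k< away e₀ e₁ n₂ eₖ = bull-free (c (1 + i)) v (c i) (c (2 + i)) (c k)
        (~-sym G e₁) (edge′ i (lower 2 3 h)) e₀ (edge′ (1 + i) h) (~-sym G eₖ)
        (≁-sym G n₂) (far′ i ≤-refl h)
        (away-far 1 away k< (lower 2 3 h)) (away-far 0 away k< (lower 1 3 h)) (≁-sym G (away-far 2 away k< h))

      0< : 0 < 5 + q
      0< = s≤s z≤n

      from-0-1-2 : a 0 ≡ true → a 1 ≡ true → a 2 ≡ true → Class v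
      from-0-1-2 e₀ e₁ e₂ = twin {l = 1} (s≤s (s≤s z≤n)) record
        { below = λ { (s≤s ()) } ; above = above ; prev = λ { refl → e₀ } ; self = e₁ ; next = λ _ → e₂ }
        where
        beyond : ∀ {k} → 4 ≤ k → k < 5 + q → a k ≡ false
        beyond k≥ k< = 𝔹.¬-not (claw-centre {0} {2} ≤-refl k≥ k< e₀ e₂)
        -- This needs the fifth path vertex: c 4 is missed by v and would hang from c 3.
        n₃ : a 3 ≡ false
        n₃ = 𝔹.¬-not λ e₃ → bull-right 2 0 (m≤m+n 5 q) 0< (inj₁ ≤-refl) e₂ e₃ (beyond ≤-refl (m≤m+n 5 q)) e₀
        above : ∀ {i} → 3 ≤ i → i < 5 + q → a i ≡ false
        above {i} i≥ i< with m≤n⇒m<n∨m≡n i≥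
        ... | inj₁ l    = beyond l i<
        ... | inj₂ refl = n₃

      from-0-1 : a 0 ≡ true → a 1 ≡ true → a 2 ≡ false → Class v
      from-0-1 e₀ e₁ n₂ = twin {l = 0} 0< record
        { below = λ () ; above = above ; prev = λ () ; self = e₀ ; next = λ _ → e₁ }
        where
        beyond : ∀ {k} → 4 ≤ k → k < 5 + q → a k ≡ false
        beyond k≥ k< = 𝔹.¬-not (bull-right 0 _ (m≤m+n 3 _) k< (inj₂ k≥) e₀ e₁ n₂)
        n₃ : a 3 ≡ false
        n₃ = 𝔹.¬-not λ e₃ → claw-at 2 (m≤m+n 5 q) n₂ e₃ (beyond ≤-refl (m≤m+n 5 q))
        above : ∀ {i} → 2 ≤ i → i < 5 + q → a i ≡ false
        above {i} i≥ i< with m≤n⇒m<n∨m≡n i≥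
        ... | inj₂ refl = n₂
        ... | inj₁ l with m≤n⇒m<n∨m≡n l
        ...   | inj₁ l′   = beyond l′ i<
        ...   | inj₂ refl = n₃

      -- The next neighbour after c 0 decides. If there is none, v prolongs the path at its front;
      -- if it is the last path vertex, v is a closer; anything between leads to a claw or a bull.
      from-0 : a 0 ≡ true → a 1 ≡ false → Class v
      from-0 e₀ n₁ with least (λ i → a (2 + i)) (3 + q)
      ... | inj₂ none = longer (prepend G P e₀ λ
              { (suc zero) _ _ → n₁ ; (suc (suc i)) _ (s≤s (s≤s l)) → none l })
      ... | inj₁ (j , s≤s j≤ , eⱼ , before) with m≤n⇒m<n∨m≡n j≤
      ...   | inj₂ refl = closer record { first = e₀ ; final = eⱼ ; inner = λ
                { {suc zero} _ _ → n₁ ; {suc (suc i)} _ (s≤s (s≤s l)) → before l } }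
      ...   | inj₁ j< with a (3 + j) in eq
      ...     | false = ⊥-elim (claw-at (1 + j) (s≤s (s≤s (s≤s j<))) (previous j before) eⱼ eq)
                where
                previous : ∀ j → (∀ {i} → i < j → a (2 + i) ≡ false) → a (1 + j) ≡ false
                previous zero    _ = n₁
                previous (suc j) b = b ≤-refl
      ...     | true with j
      ...       | suc j′ = ⊥-elim (bull-left (2 + j′) 0 (s≤s (s≤s (s≤s j<))) 0< (inj₁ (s≤s (s≤s z≤n))) (before ≤-refl) eⱼ eq e₀)
      -- With c 2 as the second neighbour, c 0 is too close to serve as the remote vertex of
      -- `bull-left`; c 4 decides instead.
      ...       | zero with a 4 in eq₄
      ...         | true  = ⊥-elim (claw-centre {0} {2} {4} ≤-refl ≤-refl (m≤m+n 5 q) e₀ eⱼ eq₄)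
      ...         | false = ⊥-elim (bull-right 2 0 (m≤m+n 5 q) 0< (inj₁ ≤-refl) eⱼ eq eq₄ e₀)

      -- If the path goes on after c (2+i), missing c (3+i) would give a bull, and so would any
      -- neighbour beyond c (3+i). Hence v is a twin of c (2+i).
      from-inner : ∀ i → 3 + i ≤ 5 + q → a i ≡ false → (∀ {j} → j < 1 + i → a j ≡ false) →
        a (1 + i) ≡ true → a (2 + i) ≡ true → Class v
      from-inner i h n₀ before e₁ e₂ with m≤n⇒m<n∨m≡n h
      ... | inj₂ eq = twin {l = 2 + i} h record
              { below = λ { (s≤s (s≤s l)) → before (s≤s l) } ; above = λ l l′ → contradiction (≤-trans (s≤s l) l′) (<⇒≱ (s≤s (≤-trans (≤-reflexive (sym eq)) (n≤1+n _))))
              ; prev = λ { refl → e₁ } ; self = e₂ ; next = λ l → contradiction l (<⇒≱ (s≤s (≤-reflexive (sym eq)))) }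
      ... | inj₁ h′ with a (3 + i) in eq₃
      ...   | false = ⊥-elim (bull-between i h′ n₀ e₁ e₂ eq₃)
      ...   | true  = twin {l = 2 + i} h record
              { below = λ { (s≤s (s≤s l)) → before (s≤s l) }
              ; above = λ {k} l l′ → 𝔹.¬-not (bull-left i k h l′ (inj₂ l) n₀ e₁ e₂)
              ; prev = λ { refl → e₁ } ; self = e₂ ; next = λ _ → eq₃ }

      classify : Class v
      classify with least a (5 + q)
      ... | inj₂ none = remote none
      ... | inj₁ (zero , _ , e₀ , _) with a 1 in eq₁ | a 2 in eq₂
      ...   | true  | true  = from-0-1-2 e₀ eq₁ eq₂
      ...   | true  | false = from-0-1 e₀ eq₁ eq₂
      ...   | false | _     = from-0 e₀ eq₁
      classify | inj₁ (suc i , i< , e , before) with m≤n⇒m<n∨m≡n i<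
      ... | inj₂ refl = longer (append G P e λ j l → before l)
      ... | inj₁ i<′ with a (2 + i) in eq
      ...   | false = ⊥-elim (claw-at i i<′ (before ≤-refl) e eq)
      ...   | true  = from-inner i i<′ (before ≤-refl) before e eq

    -- A closer completes the path to an induced cycle of length 6 + q and takes its last position.
    data Label (v : V) : ℕ → Set where
      on     : ∀ {l} → l < 5 + q → v ≡ c l → Label v l
      twin   : ∀ {l} → l < 5 + q → Off v → Twin v l → Label v l
      closer : Off v → Closer v → Label v (5 + q)

    -- Nonadjacent twins u and v would form a claw at c (1+l) with c (2+l). Where the path ends too
    -- early the reflected claw at c (l-1) is used; the same switch recurs in the next lemmas.
    twins-same : ∀ {u v} l → u ≢ v → Off u → Off v → l < 5 + q → Twin u l → Twin v l → Edge G u v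
    twins-same {u} {v} l u≢v offu offv l< U W = 𝔹.¬-not (absurd l l< U W)
      where
      absurd : ∀ l → l < 5 + q → Twin u l → Twin v l → NonEdge G u v → ⊥
      absurd l l< U W uv with 3 + l ≤? 5 + q
      ... | yes h = claw-free (c (1 + l)) u v (c (2 + l)) (~-sym G (Twin.next U (lower 2 3 h))) (~-sym G (Twin.next W (lower 2 3 h)))
              (edge (1 + l) h) u≢v (offu _ h) (offv _ h) uv (Twin.above U ≤-refl h) (Twin.above W ≤-refl h)
      ... | no ¬h with l
      ...   | zero = ¬h (m≤m+n 3 _)
      ...   | suc zero = ¬h (m≤m+n 4 _)
      ...   | suc (suc k) = claw-free (c (1 + k)) u v (c k) (~-sym G (Twin.prev U refl)) (~-sym G (Twin.prev W refl))
              (edge′ k (lower 2 3 l<)) u≢v (offu _ (lower 1 3 l<)) (offv _ (lower 1 3 l<)) uv (Twin.below U ≤-refl) (Twin.below W ≤-refl)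

    -- Otherwise v and c (3+l) hang from the triangle c (1+l), c (2+l), u, or the reflected bull
    -- appears.
    twins-next : ∀ {u v} l → 2 + l ≤ 5 + q → Twin v l → Twin u (1 + l) → Edge G v u
    twins-next {u} {v} l h W U = 𝔹.¬-not (absurd l h W U)
      where
      absurd : ∀ l → 2 + l ≤ 5 + q → Twin v l → Twin u (1 + l) → NonEdge G v u → ⊥
      absurd l h W U vu with 4 + l ≤? 5 + q
      ... | yes h′ = bull-free (c (1 + l)) (c (2 + l)) u v (c (3 + l))
              (edge (1 + l) (lower 3 4 h′)) (~-sym G (Twin.self U)) (~-sym G (Twin.next U (lower 3 4 h′))) (Twin.next W h) (edge′ (2 + l) h′)
              (Twin.above W ≤-refl (lower 3 4 h′)) vu (far′ (1 + l) ≤-refl h′) (≁-sym G (Twin.above U ≤-refl h′)) (Twin.above W (n≤1+n _) h′)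
      ... | no ¬h with l
      ...   | zero = ¬h (m≤m+n 4 _)
      ...   | suc zero = ¬h (m≤m+n 5 _)
      ...   | suc (suc k) = bull-free (c (2 + k)) (c (1 + k)) v u (c k)
              (edge′ (1 + k) (lower 3 4 h)) (~-sym G (Twin.self W)) (~-sym G (Twin.prev W refl)) (Twin.prev U refl) (edge k (lower 2 4 h))
              (Twin.below U ≤-refl) (≁-sym G vu) (far k ≤-refl (lower 3 4 h)) (≁-sym G (Twin.below W ≤-refl)) (Twin.below U (n≤1+n _))

    -- An edge between them would span a triangle with c (1+l), from which c (l-1) and c (3+l) hang;
    -- near either end of the path a different bull takes over.
    twins-two : ∀ {u v} l → 3 + l ≤ 5 + q → Twin v l → Twin u (2 + l) → NonEdge G v u
    twins-two {u} {v} l h W U = 𝔹.¬-not (absurd l h W U)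
      where
      absurd : ∀ l → 3 + l ≤ 5 + q → Twin v l → Twin u (2 + l) → Edge G v u → ⊥
      absurd l h W U vu with l
      ... | zero = bull-free (c 3) u (c 2) (c 4) v
              (~-sym G (Twin.next U (m≤m+n 4 _))) (edge′ 2 (m≤m+n 4 _)) (Twin.self U) (edge′ 3 (m≤m+n 5 _)) vu
              (≁-sym G (Twin.above U ≤-refl (m≤m+n 5 _))) (far′ 2 ≤-refl (m≤m+n 5 _))
              (Twin.above W (s≤s (s≤s z≤n)) (m≤m+n 4 _)) (Twin.above W ≤-refl (m≤m+n 3 _)) (≁-sym G (Twin.above W (s≤s (s≤s z≤n)) (m≤m+n 5 _)))
      ... | suc k with 5 + k ≤? 5 + q
      ...   | yes h′ = bull-free v u (c (2 + k)) (c k) (c (4 + k))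
              vu (Twin.next W (lower 3 5 h′)) (Twin.prev U refl) (~-sym G (Twin.prev W refl)) (~-sym G (Twin.next U h′))
              (≁-sym G (Twin.below U (n≤1+n _))) (far k ≤-refl (lower 3 5 h′))
              (≁-sym G (Twin.above W (n≤1+n _) h′)) (far′ (2 + k) ≤-refl h′) (far k (lift 2 4) h′)
      ...   | no ¬h with k
      ...     | zero  = ¬h (m≤m+n 5 _)
      ...     | suc k = bull-free (c (1 + k)) v (c (2 + k)) (c k) u
                (~-sym G (Twin.prev W refl)) (edge (1 + k) (lower 3 5 h)) (Twin.self W) (edge k (lower 2 5 h)) (~-sym G vu)
                (≁-sym G (Twin.below W ≤-refl)) (far k ≤-refl (lower 3 5 h))
                (Twin.below U (n≤1+n _)) (Twin.below U ≤-refl) (≁-sym G (Twin.below U (lift 2 4)))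

    -- An edge would make v a third leaf beside the two outer path neighbours of u. If u is a twin
    -- of the last vertex, u and v exchange roles; if v is a twin of c 0 as well, a bull on c 0, c
    -- 1, c 2 remains.
    twins-far : ∀ {u v} l i → 3 + l ≤ i → i < 5 + q → Off u → Off v → Twin v l → Twin u i → NonEdge G v u
    twins-far {u} {v} l (suc i) (s≤s k) i< offu offv W U = 𝔹.¬-not (absurd l k W)
      where
      absurd : ∀ l → 2 + l ≤ i → Twin v l → Edge G v u → ⊥
      absurd l k W vu with 3 + i ≤? 5 + q
      ... | yes h = claw-free u v (c i) (c (2 + i)) (~-sym G vu) (Twin.prev U refl) (Twin.next U h)
              (offv _ (lower 1 3 h)) (offv _ h) (apart (s≤s (n≤1+n i)) h)
              (Twin.above W k (lower 1 3 h)) (Twin.above W (≤-trans k (m≤n+m i 2)) h) (far i ≤-refl h)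
      ... | no ¬h with l
      ...   | suc j = claw-free v u (c j) (c (2 + j)) vu (Twin.prev W refl) (Twin.next W (≤-trans k (<⇒≤ i<′)))
              (offu _ (lower 1 3 (≤-trans k (<⇒≤ i<′)))) (offu _ (≤-trans k (<⇒≤ i<′))) (apart (s≤s (n≤1+n j)) (≤-trans k (<⇒≤ i<′)))
              (Twin.below U (s≤s (≤-trans (n≤1+n _) (≤-trans (n≤1+n _) k)))) (Twin.below U (s≤s k)) (far j ≤-refl (≤-trans k (<⇒≤ i<′)))
              where i<′ = <-trans (n<1+n i) i<
      ...   | zero with 3 ≤? i
      ...     | no ¬3 = ¬h (≤-trans (+-monoʳ-≤ 3 (s≤s⁻¹ (≰⇒> ¬3))) (m≤m+n 5 _))
      ...     | yes 3≤ = bull-free (c 1) v (c 0) (c 2) u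
                (~-sym G (Twin.next W (m≤m+n 2 _))) (edge′ 0 (m≤m+n 2 _)) (Twin.self W) (edge′ 1 (m≤m+n 3 _)) (~-sym G vu)
                (≁-sym G (Twin.above W ≤-refl (m≤m+n 3 _))) (far′ 0 ≤-refl (m≤m+n 3 _))
                (Twin.below U (s≤s (≤-trans (n≤1+n 2) 3≤))) (Twin.below U (s≤s (≤-trans (s≤s z≤n) 3≤))) (≁-sym G (Twin.below U (s≤s 3≤)))

    0∈ : 0 < 5 + q
    0∈ = m≤m+n 1 _

    1∈ : 1 < 5 + q
    1∈ = m≤m+n 2 _

    2∈ : 2 < 5 + q
    2∈ = m≤m+n 3 _

    -- Nonadjacent u and v would form a claw at c 0 with c 1. The lemmas on closers transfer those
    -- on twins to the cycle position between c (4+q) and c 0.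
    closers-same : ∀ {u v} → u ≢ v → Off u → Off v → Closer u → Closer v → Edge G u v
    closers-same {u} {v} u≢v offu offv U W = 𝔹.¬-not λ uv → claw-free (c 0) u v (c 1)
      (~-sym G (Closer.first U)) (~-sym G (Closer.first W)) (edge 0 1∈) u≢v (offu _ 1∈) (offv _ 1∈)
      uv (Closer.inner U ≤-refl (m≤m+n 2 _)) (Closer.inner W ≤-refl (m≤m+n 2 _))

    -- Otherwise z and c 2 hang from the triangle c 0, c 1, u.
    closer-first : ∀ {u z} → Twin u 0 → Closer z → Edge G u z
    closer-first {u} {z} U Z = 𝔹.¬-not λ uz → bull-free (c 0) (c 1) u z (c 2)
      (edge 0 1∈) (~-sym G U.self) (~-sym G (U.next 1∈)) Z.first (edge′ 1 2∈)
      (Z.inner ≤-refl (m≤m+n 2 _)) (≁-sym G uz) (far′ 0 ≤-refl 2∈) (≁-sym G (U.above ≤-refl 2∈)) (Z.inner (s≤s z≤n) (m≤m+n 3 _))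
      where
      module U = Twin U
      module Z = Closer Z

    closer-final : ∀ {u z} → Twin u (4 + q) → Closer z → Edge G u z
    closer-final {u} {z} U Z = 𝔹.¬-not λ uz → bull-free (c (4 + q)) (c (3 + q)) u z (c (2 + q))
      (edge′ (3 + q) ≤-refl) (~-sym G U.self) (~-sym G (U.prev refl)) Z.final (edge (2 + q) (n≤1+n _))
      (Z.inner (s≤s z≤n) ≤-refl) (≁-sym G uz) (far (2 + q) ≤-refl ≤-refl) (≁-sym G (U.below ≤-refl)) (Z.inner (s≤s z≤n) (n≤1+n _))
      where
      module U = Twin U
      module Z = Closer Z

    -- With an edge, c 0, c (4+q) and u would be leaves of a claw at z, unless u sees an end of the
    -- path; in that case z, u and this end span the triangle of a bull.
    closer-inner : ∀ {u z} i → 2 + i ≤ 4 + q → Off u → Twin u (1 + i) → Closer z → NonEdge G u z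
    closer-inner {u} {z} i i< offu U Z = 𝔹.¬-not (absurd i i< U)
      where
      absurd : ∀ i → 2 + i ≤ 4 + q → Twin u (1 + i) → Edge G u z → ⊥
      absurd i i< U uz with i
      ... | zero = bull-free z u (c 0) (c (4 + q)) (c 2)
              (~-sym G uz) (Closer.first Z) (Twin.prev U refl) (~-sym G (Closer.final Z)) (~-sym G (Twin.next U 2∈))
              (≁-sym G (Twin.above U (m≤m+n 3 _) ≤-refl)) (far′ 0 (m≤m+n 2 _) ≤-refl)
              (≁-sym G (Closer.inner Z (s≤s z≤n) (m≤m+n 3 _))) (far′ 0 ≤-refl 2∈) (far′ 2 (m≤m+n 4 _) ≤-refl)
      ... | suc k with m≤n⇒m<n∨m≡n i<
      ...   | inj₁ l = claw-free z (c 0) (c (4 + q)) u (Closer.first Z) (Closer.final Z) (~-sym G uz)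
                (apart (s≤s z≤n) ≤-refl) (offu _ 0∈ ∘ sym) (offu _ ≤-refl ∘ sym)
                (far 0 (m≤m+n 2 _) ≤-refl) (≁-sym G (Twin.below U (s≤s (s≤s z≤n)))) (≁-sym G (Twin.above U l ≤-refl))
      ...   | inj₂ refl = bull-free z u (c (4 + q)) (c 0) (c (2 + q))
                (~-sym G uz) (Closer.final Z) (Twin.next U ≤-refl) (~-sym G (Closer.first Z)) (~-sym G (Twin.prev U refl))
                (≁-sym G (Twin.below U (m≤m+n 2 _))) (far 0 (m≤m+n 2 _) ≤-refl)
                (≁-sym G (Closer.inner Z (s≤s z≤n) (n≤1+n _))) (far (2 + q) ≤-refl ≤-refl) (far 0 (m≤m+n 2 _) (lift 3 5))

    label< : ∀ {v l} → Label v l → l < 6 + q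
    label< (on l< _)     = ≤-trans l< (n≤1+n _)
    label< (twin l< _ _) = ≤-trans l< (n≤1+n _)
    label< (closer _ _)  = ≤-refl

    labels-same : ∀ {u v l} → u ≢ v → Label u l → Label v l → Edge G u v
    labels-same u≢v (on _ refl)       (on _ refl)     = contradiction refl u≢v
    labels-same u≢v (on _ refl)       (twin _ _ W)    = ~-sym G (Twin.self W)
    labels-same u≢v (twin _ _ U)      (on _ refl)     = Twin.self U
    labels-same u≢v (twin l< offu U)  (twin _ offv W) = twins-same _ u≢v offu offv l< U W
    labels-same u≢v (closer offu U)   (closer offv W) = closers-same u≢v offu offv U W
    labels-same u≢v (on l< _)         (closer _ _)    = contradiction l< (<⇒≱ ≤-refl)
    labels-same u≢v (twin l< _ _)     (closer _ _)    = contradiction l< (<⇒≱ ≤-refl)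
    labels-same u≢v (closer _ _)      (on l< _)       = contradiction l< (<⇒≱ ≤-refl)
    labels-same u≢v (closer _ _)      (twin l< _ _)   = contradiction l< (<⇒≱ ≤-refl)

    labels-next : ∀ {u v l} → Label u l → Label v (suc l) → Edge G u v
    labels-next (on _ refl)    (on l< refl)    = edge _ l<
    labels-next (on _ refl)    (twin _ _ W)    = ~-sym G (Twin.prev W refl)
    labels-next (on _ refl)    (closer _ W)    = ~-sym G (Closer.final W)
    labels-next (twin _ _ U)   (on l< refl)    = Twin.next U l<
    labels-next (twin _ _ U)   (twin l< _ W)   = twins-next _ l< U W
    labels-next (twin _ _ U)   (closer _ W)    = closer-final U W
    labels-next (closer _ _)   (on l< _)       = contradiction l< (<⇒≱ (n≤1+n _))
    labels-next (closer _ _)   (twin l< _ _)   = contradiction l< (<⇒≱ (n≤1+n _))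

    labels-wrap : ∀ {u v} → Label u 0 → Label v (5 + q) → Edge G u v
    labels-wrap _           (on l< _)     = contradiction l< (<⇒≱ ≤-refl)
    labels-wrap _           (twin l< _ _) = contradiction l< (<⇒≱ ≤-refl)
    labels-wrap (on _ refl) (closer _ W)  = ~-sym G (Closer.first W)
    labels-wrap (twin _ _ U) (closer _ W) = closer-first U W

    -- The excluded pair 0 and 5+q is where the cycle closes.
    labels-apart : ∀ {u v s t} → Label u s → Label v t → 2 + s ≤ t → ¬ (s ≡ 0 × t ≡ 5 + q) → NonEdge G u v
    labels-apart (on _ refl) (on t< refl)   le _ = far _ le t<
    labels-apart (on _ refl) (twin _ _ W)   le _ = ≁-sym G (Twin.below W le)
    labels-apart {s = zero}  (on _ refl) (closer _ W) le ne = contradiction (refl , refl) ne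
    labels-apart {s = suc s} (on _ refl) (closer _ W) le _  = ≁-sym G (Closer.inner W (s≤s z≤n) (s≤s⁻¹ le))
    labels-apart (twin _ _ U) (on t< refl)  le _ = Twin.above U le t<
    labels-apart (twin s< offu U) (twin t< offv W) le _ with m≤n⇒m<n∨m≡n le
    ... | inj₁ lt   = twins-far _ _ lt t< offv offu U W
    ... | inj₂ refl = twins-two _ t< U W
    labels-apart {s = zero}  (twin _ _ U)    (closer _ W) le ne = contradiction (refl , refl) ne
    labels-apart {s = suc s} (twin _ offu U) (closer _ W) le _  = closer-inner s (s≤s⁻¹ le) offu U W
    labels-apart (closer _ _) L le _ = contradiction (s≤s⁻¹ (label< L)) (<⇒≱ (≤-trans (n≤1+n _) le))

    -- A closer or a twin of an inner vertex sees two nonadjacent path vertices, which form a claw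
    -- with w; a twin of an end gives a bull.
    reaching-out : ∀ {v w l} → Label v l → Edge G v w → Off w → (∀ {i} → i < 5 + q → NonEdge G w (c i)) → ⊥
    reaching-out (on l< refl) vw _ away = clash G (~-sym G vw) (away l<)
    reaching-out {v} {w} (closer offv W) vw offw away = claw-free v (c 0) (c (4 + q)) w
      (Closer.first W) (Closer.final W) vw (apart (s≤s z≤n) ≤-refl) (offw _ 0∈ ∘ sym) (offw _ ≤-refl ∘ sym)
      (far 0 (m≤m+n 2 _) ≤-refl) (≁-sym G (away 0∈)) (≁-sym G (away ≤-refl))
    reaching-out {v} {w} {zero} (twin _ _ W) vw _ away = bull-free v (c 1) (c 0) w (c 2)
      (Twin.next W 1∈) (Twin.self W) (edge′ 0 1∈) (~-sym G vw) (edge′ 1 2∈)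
      (away 1∈) (away 0∈) (≁-sym G (Twin.above W ≤-refl 2∈)) (far′ 0 ≤-refl 2∈) (away 2∈)
    reaching-out {v} {w} {suc l} (twin l< _ W) vw offw away with m≤n⇒m<n∨m≡n l<
    ... | inj₁ lt   = claw-free v (c l) (c (2 + l)) w
      (Twin.prev W refl) (Twin.next W lt) vw (apart (s≤s (n≤1+n l)) lt) (offw _ (lower 1 3 lt) ∘ sym) (offw _ lt ∘ sym)
      (far l ≤-refl lt) (≁-sym G (away (lower 1 3 lt))) (≁-sym G (away lt))
    ... | inj₂ refl = bull-free v (c (3 + q)) (c (4 + q)) w (c (2 + q))
      (Twin.prev W refl) (Twin.self W) (edge (3 + q) ≤-refl) (~-sym G vw) (edge (2 + q) (n≤1+n _))
      (away (n≤1+n _)) (away ≤-refl) (≁-sym G (Twin.below W ≤-refl)) (far (2 + q) ≤-refl ≤-refl) (away (lift 3 5))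

    Located : V → Set
    Located v = Longer ⊎ (∃[ l ] Label v l)

    -- Labels spread along walks from c 0: the labelled predecessor prevents the next vertex from
    -- being remote.
    locate : ∀ {v} → Reach G (c 0) v → Located v
    locate here = inj₂ (0 , on 0∈ refl)
    locate {w} (step r vw) with locate r
    ... | inj₁ m = inj₁ m
    ... | inj₂ (l , L) with F.any? {n = 5 + q} (λ i → w F.≟ c (toℕ i))
    ...   | yes (i , eq) = inj₂ (toℕ i , on (F.toℕ<n i) eq)
    ...   | no ¬on = place (classify offw)
      where
      offw : Off w
      offw i i< e = ¬on (fromℕ< i< , trans e (cong c (sym (F.toℕ-fromℕ< i<))))
      place : Class w → Located w
      place (remote away) = ⊥-elim (reaching-out L vw offw away)
      place (longer m)    = inj₁ m
      place (twin l< W)   = inj₂ (_ , twin l< offw W)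
      place (closer W)    = inj₂ (_ , closer offw W)

  record Ring : Set where
    field
      q      : ℕ
      c      : ℕ → V
      path   : InducedPath G (5 + q) c
      label  : V → ℕ
      labelled : ∀ v → Along.Label q c path v (label v)

  choose : ∀ {k} {A : Set} {B : Fin k → Set} → (∀ i → A ⊎ B i) → A ⊎ (∀ i → B i)
  choose {zero} f = inj₂ λ ()
  choose {suc k} f with f zero | choose (f ∘ suc)
  ... | inj₁ a | _      = inj₁ a
  ... | inj₂ _ | inj₁ a = inj₁ a
  ... | inj₂ b | inj₂ g = inj₂ λ { zero → b ; (suc i) → g i }

  path-length : ∀ {p c} → InducedPath G (4 + p) c → 4 + p ≤ n G
  path-length {c = c} P = F.injective⇒≤ {f = c ∘ toℕ} λ {i} {j} e →
    F.toℕ-injective (path-injective G P (F.toℕ<n i) (F.toℕ<n j) e)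

  -- The number d bounds how often the path can still be prolonged; its vertices are distinct, so it
  -- cannot outgrow G.
  ring : Connected G → ∀ d {q c} → InducedPath G (5 + q) c → n G ≤ d + (5 + q) → Ring
  ring conn d {q} {c} P bound with choose (λ v → Along.locate q c P (conn (c 0) v))
  ... | inj₂ labels = record { path = P ; label = proj₁ ∘ labels ; labelled = proj₂ ∘ labels }
  ring conn zero    P bound | inj₁ (_ , P′) = contradiction (path-length P′) (<⇒≱ (s≤s bound))
  ring conn (suc d) P bound | inj₁ (_ , P′) = ring conn d P′ (≤-trans bound (≤-reflexive (sym (+-suc d _))))

-- An induced P₅ from an independent triple

module _ (G : Graph) (noBull : ¬ ContainsInduced G bull) (noClaw : ¬ ContainsInduced G claw) where

  open Forbidden G noBull noClaw
  private V = Fin (n G)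

  P5 : Set
  P5 = ∃[ c ] InducedPath G 5 c

  path5 : ∀ a b c d e → Edge G a b → Edge G b c → Edge G c d → Edge G d e →
    NonEdge G a c → NonEdge G a d → NonEdge G a e → NonEdge G b d → NonEdge G b e → NonEdge G c e → P5
  path5 a b c d e ab bc cd de ac ad ae bd be ce = f , record { edge = edge ; far = far }
    where
    f : ℕ → V
    f 0 = a
    f 1 = b
    f 2 = c
    f 3 = d
    f _ = e
    edge : ∀ i → suc i < 5 → Edge G (f i) (f (suc i))
    edge 0 _ = ab
    edge 1 _ = bc
    edge 2 _ = cd
    edge 3 _ = de
    edge (suc (suc (suc (suc i)))) (s≤s (s≤s (s≤s (s≤s (s≤s ())))))
    far : ∀ i {j} → 2 + i ≤ j → j < 5 → NonEdge G (f i) (f j)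
    far 0 {2} _ _ = ac
    far 0 {3} _ _ = ad
    far 0 {4} _ _ = ae
    far 1 {3} _ _ = bd
    far 1 {4} _ _ = be
    far 2 {4} _ _ = ce
    far 0 {1} (s≤s ()) _
    far 1 {1} (s≤s ()) _
    far 1 {2} (s≤s (s≤s ())) _
    far (suc (suc i)) {1} (s≤s ()) _
    far (suc (suc i)) {2} (s≤s (s≤s ())) _
    far (suc (suc i)) {3} (s≤s (s≤s (s≤s ()))) _
    far (suc (suc (suc i))) {4} (s≤s (s≤s (s≤s (s≤s ())))) _
    far i {suc (suc (suc (suc (suc j))))} _ (s≤s (s≤s (s≤s (s≤s (s≤s ())))))

  distinguish : ∀ {u v w} → Edge G w u → NonEdge G w v → u ≢ v
  distinguish e ne refl = clash G e ne

  -- Witnesses for distance at most three. Since `NonEdge` admits equal vertices, `two` is also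
  -- possible for v = a.
  data Near (a : V) : V → Set where
    equal : Near a a
    one   : ∀ {v} → Edge G a v → Near a v
    two   : ∀ {x v} → Edge G a x → Edge G x v → NonEdge G a v → Near a v
    three : ∀ {x y v} → Edge G a x → Edge G x y → Edge G y v → NonEdge G a y → NonEdge G a v → NonEdge G x v → Near a v

  -- A step that would bring the distance from a to four completes an induced P₅.
  nearby : ∀ {a v} → Reach G a v → P5 ⊎ Near a v
  nearby here = inj₂ equal
  nearby {a} {w} (step {v} r vw) with nearby r
  ... | inj₁ p = inj₁ p
  ... | inj₂ near with adj G a w in aw
  ...   | true  = inj₂ (one aw)
  ...   | false with F.any? (λ x → (adj G a x 𝔹.≟ true) ×-dec (adj G x w 𝔹.≟ true))
  ...     | yes (x , ax , xw) = inj₂ (two ax xw aw)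
  ...     | no none with near
  ...       | equal    = clash G vw aw
  ...       | one av   = contradiction (v , av , vw) none
  ...       | two {x} ax xv av = inj₂ (three ax xv vw av aw (𝔹.¬-not λ xw → none (x , ax , xw)))
  ...       | three {x} {y} ax xy yv ay av xv with adj G y w in yw
  ...         | true  = inj₂ (three ax xy yw ay aw (𝔹.¬-not λ xw → none (x , ax , xw)))
  ...         | false = inj₁ (path5 a x y v w ax xy yv vw ay av aw xv (𝔹.¬-not λ xw → none (x , ax , xw)) yw)

  -- Applied to the vertices that miss a short path, this finds a vertex touching the path with a
  -- neighbour that misses it.
  leaving : ∀ {Far : V → Set} → (∀ v → Dec (Far v)) → ∀ {c v} → Far c → Reach G c v → ¬ Far v →
    ∃[ w′ ] ∃[ w ] Far w′ × Edge G w′ w × ¬ Far w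
  leaving far? Fc here ¬Fv = contradiction Fc ¬Fv
  leaving far? Fc (step {v} {w} r vw) ¬Fw with far? v
  ... | yes Fv = v , w , Fv , vw , ¬Fw
  ... | no ¬Fv = leaving far? Fc r ¬Fv

  module _ (connected : Connected G) where

    -- On the walk from c to a, let u miss the path and its neighbour w touch it. If w sees just one
    -- end, then u, w and the path form a P₅; any other set of neighbours gives a claw or a bull.
    P3+vertex : ∀ a x b c → Edge G a x → Edge G x b → NonEdge G a b → a ≢ b →
      NonEdge G c a → NonEdge G c x → NonEdge G c b → P5
    P3+vertex a x b c ax xb ab a≢b ca cx cb
      with leaving {λ v → NonEdge G v a × NonEdge G v x × NonEdge G v b}
             (λ v → (adj G v a 𝔹.≟ false) ×-dec (adj G v x 𝔹.≟ false) ×-dec (adj G v b 𝔹.≟ false))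
             (ca , cx , cb) (connected c a) (λ { (_ , ne , _) → clash G ax ne })
    ... | u , w , (ua , ux , ub) , uw , ¬Fw with adj G w a in wa | adj G w x in wx | adj G w b in wb
    ...   | false | false | false = contradiction (refl , refl , refl) ¬Fw
    ...   | true  | _     | true  = ⊥-elim (claw-free w a b u wa wb (~-sym G uw) a≢b
              (distinguish (~-sym G ax) (≁-sym G ux)) (distinguish xb (≁-sym G ux)) ab (≁-sym G ua) (≁-sym G ub))
    ...   | true  | true  | false = ⊥-elim (bull-free w x a u b wx wa (~-sym G ax) uw (~-sym G xb)
              ux ua (≁-sym G wb) (≁-sym G ab) ub)
    ...   | true  | false | false = path5 u w a x b uw wa ax xb ua ux ub wx wb ab
    ...   | false | true  | true  = ⊥-elim (bull-free w x b u a wx wb xb uw ax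
              ux ub (≁-sym G wa) ab ua)
    ...   | false | false | true  = path5 u w b x a uw wb (~-sym G xb) (~-sym G ax) ub ux ua wx wa (≁-sym G ab)
    ...   | false | true  | false = ⊥-elim (claw-free x a b w (~-sym G ax) xb (~-sym G wx) a≢b
              (distinguish uw ua ∘ sym) (distinguish uw ub ∘ sym) ab (≁-sym G wa) (≁-sym G wb))

    -- As for three vertices: only a single neighbour at an end survives, and u, w with three of the
    -- four path vertices are the P₅.
    P4+vertex : ∀ a x y b c → Edge G a x → Edge G x y → Edge G y b → NonEdge G a y → NonEdge G a b → NonEdge G x b →
      a ≢ y → a ≢ b → x ≢ b → NonEdge G c a → NonEdge G c x → NonEdge G c y → NonEdge G c b → P5
    P4+vertex a x y b c ax xy yb ay ab xb a≢y a≢b x≢b ca cx cy cb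
      with leaving {λ v → NonEdge G v a × NonEdge G v x × NonEdge G v y × NonEdge G v b}
             (λ v → (adj G v a 𝔹.≟ false) ×-dec (adj G v x 𝔹.≟ false) ×-dec (adj G v y 𝔹.≟ false) ×-dec (adj G v b 𝔹.≟ false))
             (ca , cx , cy , cb) (connected c a) (λ { (_ , ne , _) → clash G ax ne })
    ... | u , w , (ua , ux , uy , ub) , uw , ¬Fw with adj G w a in wa | adj G w x in wx | adj G w y in wy | adj G w b in wb
    ...   | false | false | false | false = contradiction (refl , refl , refl , refl) ¬Fw
    ...   | true  | _     | true  | _     = ⊥-elim (claw-free w a y u wa wy (~-sym G uw) a≢y
              (distinguish (~-sym G ax) (≁-sym G ux)) (distinguish xy (≁-sym G ux)) ay (≁-sym G ua) (≁-sym G uy))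
    ...   | true  | _     | false | true  = ⊥-elim (claw-free w a b u wa wb (~-sym G uw) a≢b
              (distinguish (~-sym G ax) (≁-sym G ux)) (distinguish yb (≁-sym G uy)) ab (≁-sym G ua) (≁-sym G ub))
    ...   | true  | true  | false | false = ⊥-elim (bull-free w x a u y wx wa (~-sym G ax) uw (~-sym G xy)
              ux ua (≁-sym G wy) (≁-sym G ay) uy)
    ...   | true  | false | false | false = path5 u w a x y uw wa ax xy ua ux uy wx wy ay
    ...   | false | true  | _     | true  = ⊥-elim (claw-free w x b u wx wb (~-sym G uw) x≢b
              (distinguish ax (≁-sym G ua)) (distinguish yb (≁-sym G uy)) xb (≁-sym G ux) (≁-sym G ub))
    ...   | false | false | true  | true  = ⊥-elim (bull-free w y b u x wy wb yb uw xy
              uy ub (≁-sym G wx) xb ux)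
    ...   | false | false | false | true  = path5 u w b y x uw wb (~-sym G yb) (~-sym G xy) ub uy ux wy wx (≁-sym G xb)
    ...   | false | true  | true  | false = ⊥-elim (bull-free x y w a b xy (~-sym G wx) (~-sym G wy) ax (~-sym G yb)
              ay (≁-sym G wa) (≁-sym G xb) (≁-sym G wb) ab)
    ...   | false | true  | false | false = ⊥-elim (claw-free x a y w (~-sym G ax) xy (~-sym G wx) a≢y
              (distinguish uw ua ∘ sym) (distinguish uw uy ∘ sym) ay (≁-sym G wa) (≁-sym G wy))
    ...   | false | false | true  | false = ⊥-elim (claw-free y x b w (~-sym G xy) yb (~-sym G wy) x≢b
              (distinguish uw ux ∘ sym) (distinguish uw ub ∘ sym) xb (≁-sym G wx) (≁-sym G wb))

    -- Unless a P₅ has turned up, a and b are at distance two or three. On the path joining them, c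
    -- either sees an inner vertex, which gives a claw or a bull, or misses the path altogether.
    triple⇒P5 : ∀ a b c → a ≢ b → b ≢ c → a ≢ c → NonEdge G a b → NonEdge G b c → NonEdge G a c → P5
    triple⇒P5 a b c a≢b b≢c a≢c ab bc ac with nearby (connected a b)
    ... | inj₁ p = p
    ... | inj₂ equal = contradiction refl a≢b
    ... | inj₂ (one e) = clash G e ab
    ... | inj₂ (two {x} ax xb _) with adj G x c in xc
    ...   | true  = ⊥-elim (claw-free x a b c (~-sym G ax) xb xc a≢b a≢c b≢c ab ac bc)
    ...   | false = P3+vertex a x b c ax xb ab a≢b (≁-sym G ac) (≁-sym G xc) (≁-sym G bc)
    triple⇒P5 a b c a≢b b≢c a≢c ab bc ac | inj₂ (three {x} {y} ax xy yb ay _ xb) with adj G x c in xc | adj G y c in yc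
    ... | true  | true  = ⊥-elim (bull-free x y c a b xy xc yc ax (~-sym G yb) ay ac (≁-sym G xb) bc ab)
    ... | true  | false = ⊥-elim (claw-free x a y c (~-sym G ax) xy xc (distinguish (~-sym G yb) (≁-sym G ab) ∘ sym) a≢c (distinguish (~-sym G yb) bc) ay ac yc)
    ... | false | true  = ⊥-elim (claw-free y x b c (~-sym G xy) yb yc (distinguish ax ab) (distinguish ax ac) b≢c xb xc bc)
    ... | false | false = P4+vertex a x y b c ax xy yb ay ab xb (distinguish (~-sym G yb) (≁-sym G ab) ∘ sym) a≢b (distinguish ax ab) (≁-sym G ac) (≁-sym G xc) (≁-sym G yc) (≁-sym G bc)

-- Colouring clique expansions

-- The value of k at i, and 0 beyond the range of k.
nth : ∀ p → (Fin p → ℕ) → ℕ → ℕ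
nth zero    k _       = 0
nth (suc p) k zero    = k zero
nth (suc p) k (suc i) = nth p (k ∘ suc) i

nth-toℕ : ∀ p k i → nth p k (toℕ i) ≡ k i
nth-toℕ (suc p) k zero    = refl
nth-toℕ (suc p) k (suc i) = nth-toℕ p (k ∘ suc) i

Σ< : (ℕ → ℕ) → ℕ → ℕ
Σ< f zero    = 0
Σ< f (suc i) = Σ< f i + f i

Σ<-shift : ∀ f i → Σ< f (suc i) ≡ f 0 + Σ< (f ∘ suc) i
Σ<-shift f zero    = +-comm 0 (f 0)
Σ<-shift f (suc i) = trans (cong (_+ f (suc i)) (Σ<-shift f i)) (+-assoc (f 0) _ _)

sumF≡Σ< : ∀ p k → sumF p k ≡ Σ< (nth p k) p
sumF≡Σ< zero    k = refl
sumF≡Σ< (suc p) k = trans (cong (k zero +_) (sumF≡Σ< p (k ∘ suc))) (sym (Σ<-shift (nth (suc p) k) p))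

block-range : ∀ p k x → Σ< (nth p k) (toℕ (block p k x)) ≤ toℕ x × toℕ x < Σ< (nth p k) (suc (toℕ (block p k x)))
block-range (suc p) k x with splitAt (k zero) x in eq
... | inj₁ t = z≤n , subst (_< k zero) (trans (sym (F.toℕ-↑ˡ t _)) (cong toℕ (F.splitAt⁻¹-↑ˡ eq))) (F.toℕ<n t)
... | inj₂ y with block-range p (k ∘ suc) y
...   | lo , hi = subst₂ _≤_ (sym (Σ<-shift (nth (suc p) k) b)) x≡ (+-monoʳ-≤ (k zero) lo) ,
                  subst₂ _<_ x≡ (sym (Σ<-shift (nth (suc p) k) (suc b))) (+-monoʳ-< (k zero) hi)
  where
  b = toℕ (block p (k ∘ suc) y)
  x≡ : k zero + toℕ y ≡ toℕ x
  x≡ = trans (sym (F.toℕ-↑ʳ (k zero) y)) (cong toℕ (F.splitAt⁻¹-↑ʳ eq))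

-- With equal remainders the larger number has the larger quotient and is ahead by at least 5.
%5-distinct : ∀ {a b} → a < b → b < a + 5 → a % 5 ≢ b % 5
%5-distinct {a} {b} a<b b<a+5 e = <⇒≱ b<a+5 (begin
  a + 5                       ≡⟨ cong (_+ 5) a≡ ⟩
  b % 5 + a / 5 * 5 + 5       ≡⟨ +-assoc (b % 5) _ 5 ⟩
  b % 5 + (a / 5 * 5 + 5)     ≡⟨ cong (b % 5 +_) (+-comm (a / 5 * 5) 5) ⟩
  b % 5 + suc (a / 5) * 5     ≤⟨ +-monoʳ-≤ (b % 5) (*-monoˡ-≤ 5 quotients) ⟩
  b % 5 + b / 5 * 5           ≡⟨ sym (m≡m%n+[m/n]*n b 5) ⟩
  b                           ∎)
  where
  open ≤-Reasoning
  a≡ : a ≡ b % 5 + a / 5 * 5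
  a≡ = trans (m≡m%n+[m/n]*n a 5) (cong (_+ a / 5 * 5) e)
  quotients : a / 5 < b / 5
  quotients = *-cancelʳ-< 5 _ _ (+-cancelˡ-< (b % 5) _ _ (subst₂ _<_ a≡ (m≡m%n+[m/n]*n b 5) a<b))

-- This is the symmetrised relation inside `cliqueExpansion`, written in terms of blocks so that
-- `expansion-adj` holds by computation.
touching : ∀ {p} → Fin p → Fin p → Bool
touching {p} i j = (does (i F.≟ j) ∨ consec p i j) ∨ (does (j F.≟ i) ∨ consec p j i)

data Touch (p i j : ℕ) : Set where
  equal : i ≡ j → Touch p i j
  next  : suc i ≡ j → Touch p i j
  wrap  : suc i ≡ p → j ≡ 0 → Touch p i j
  next′ : suc j ≡ i → Touch p i j
  wrap′ : suc j ≡ p → i ≡ 0 → Touch p i j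

touching-sound : ∀ {p} (i j : Fin p) → T (touching i j) → Touch p (toℕ i) (toℕ j)
touching-sound {p} i j t with i F.≟ j
... | yes refl = equal refl
... | no  i≢j with Equivalence.to (T-∨ {consec p i j}) t
...   | inj₁ ij with Equivalence.to (T-∨ {suc (toℕ i) ≡ᵇ toℕ j}) ij
...     | inj₁ s = next (≡ᵇ⇒≡ _ _ s)
...     | inj₂ w = wrap (≡ᵇ⇒≡ _ _ (proj₁ (∧-split w))) (≡ᵇ⇒≡ _ _ (proj₂ (∧-split {suc (toℕ i) ≡ᵇ p} w)))
touching-sound {p} i j t | no i≢j | inj₂ ji with j F.≟ i
... | yes e = contradiction (sym e) i≢j
... | no _ with Equivalence.to (T-∨ {suc (toℕ j) ≡ᵇ toℕ i}) ji
...   | inj₁ s = next′ (≡ᵇ⇒≡ _ _ s)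
...   | inj₂ w = wrap′ (≡ᵇ⇒≡ _ _ (proj₁ (∧-split w))) (≡ᵇ⇒≡ _ _ (proj₂ (∧-split {suc (toℕ j) ≡ᵇ p} w)))

touching-refl : ∀ {p} (i : Fin p) → touching i i ≡ true
touching-refl i with i F.≟ i
... | yes _ = refl
... | no ¬r = contradiction refl ¬r

touching-sym : ∀ {p} (i j : Fin p) → touching i j ≡ touching j i
touching-sym {p} i j = 𝔹.∨-comm (does (i F.≟ j) ∨ consec p i j) _

touching-consec : ∀ {p} (i j : Fin p) → T (consec p i j) → touching i j ≡ true
touching-consec {p} i j t = Equivalence.to T-≡
  (Equivalence.from (T-∨ {does (i F.≟ j) ∨ consec p i j}) (inj₁ (Equivalence.from (T-∨ {does (i F.≟ j)}) (inj₂ t))))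

touching-next : ∀ {p} (i j : Fin p) → suc (toℕ i) ≡ toℕ j → touching i j ≡ true
touching-next {p} i j e = touching-consec i j (Equivalence.from T-∨ (inj₁ (≡⇒≡ᵇ _ _ e)))

touching-wrap : ∀ {p} (i j : Fin p) → suc (toℕ i) ≡ p → toℕ j ≡ 0 → touching i j ≡ true
touching-wrap {p} i j e f = touching-consec i j
  (Equivalence.from (T-∨ {suc (toℕ i) ≡ᵇ toℕ j}) (inj₂ (Equivalence.from T-∧ (≡⇒≡ᵇ _ _ e , ≡⇒≡ᵇ _ _ f))))

module Expansion (p : ℕ) (k : Fin p → ℕ) where

  E : Graph
  E = cliqueExpansion p k

  expansion-adj : ∀ {x y} → x ≢ y → adj E x y ≡ touching (block p k x) (block p k y)
  expansion-adj {x} {y} x≢y with x F.≟ y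
  ... | yes e = contradiction e x≢y
  ... | no  _ = refl

  place : ∀ p (k : Fin p → ℕ) i → Fin (k i) → Fin (sumF p k)
  place (suc p) k zero    t = t ↑ˡ sumF p (k ∘ suc)
  place (suc p) k (suc i) t = k zero ↑ʳ place p (k ∘ suc) i t

  place-injective : ∀ p k i {s t} → place p k i s ≡ place p k i t → s ≡ t
  place-injective (suc p) k zero    e = F.↑ˡ-injective _ _ _ e
  place-injective (suc p) k (suc i) e = place-injective p (k ∘ suc) i (F.↑ʳ-injective (k zero) _ _ e)

  block-place : ∀ p k i t → block p k (place p k i t) ≡ i
  block-place (suc p) k zero    t rewrite F.splitAt-↑ˡ (k zero) t (sumF p (k ∘ suc)) = refl
  block-place (suc p) k (suc i) t
    rewrite F.splitAt-↑ʳ (k zero) (sumF p (k ∘ suc)) (place p (k ∘ suc) i t) = cong suc (block-place p (k ∘ suc) i t)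

  -- Two touching blocks together form a single clique.
  heavy⇒K6 : ∀ i j → i ≢ j → touching i j ≡ true → 6 ≤ k i + k j → Contains E (K 6)
  heavy⇒K6 i j i≢j ij le = g , g-inj , edges
    where
    spot : Fin (k i) ⊎ Fin (k j) → Fin (sumF p k)
    spot = [ place p k i , place p k j ]′
    spot-inj : ∀ s t → spot s ≡ spot t → s ≡ t
    spot-inj (inj₁ s) (inj₁ t) e = cong inj₁ (place-injective p k i e)
    spot-inj (inj₂ s) (inj₂ t) e = cong inj₂ (place-injective p k j e)
    spot-inj (inj₁ s) (inj₂ t) e = contradiction
      (trans (sym (block-place p k i s)) (trans (cong (block p k) e) (block-place p k j t))) i≢j
    spot-inj (inj₂ s) (inj₁ t) e = contradiction
      (trans (sym (block-place p k i t)) (trans (cong (block p k) (sym e)) (block-place p k j s))) i≢j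
    spot-touching : ∀ s t → touching (block p k (spot s)) (block p k (spot t)) ≡ true
    spot-touching (inj₁ s) (inj₁ t) rewrite block-place p k i s | block-place p k i t = touching-refl i
    spot-touching (inj₁ s) (inj₂ t) rewrite block-place p k i s | block-place p k j t = ij
    spot-touching (inj₂ s) (inj₁ t) rewrite block-place p k j s | block-place p k i t = trans (touching-sym j i) ij
    spot-touching (inj₂ s) (inj₂ t) rewrite block-place p k j s | block-place p k j t = touching-refl j
    g : Fin 6 → Fin (sumF p k)
    g u = spot (splitAt (k i) (inject≤ u le))
    g-inj : ∀ {u v} → g u ≡ g v → u ≡ v
    g-inj {u} {v} e = F.inject≤-injective le le u v (splitAt-injective (spot-inj _ _ e))
      where
      splitAt-injective : ∀ {x y} → splitAt (k i) {k j} x ≡ splitAt (k i) y → x ≡ y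
      splitAt-injective {x} {y} e = trans (sym (F.join-splitAt (k i) (k j) x))
        (trans (cong (join (k i) (k j)) e) (F.join-splitAt (k i) (k j) y))
    edges : ∀ u v → Edge (K 6) u v → Edge E (g u) (g v)
    edges u v uv = trans (expansion-adj λ e → irreflexive (g-inj {u} {v} e)) (spot-touching (splitAt (k i) (inject≤ u le)) (splitAt (k i) (inject≤ v le)))
      where
      irreflexive : u ≢ v
      irreflexive refl = contradiction (trans (sym (adj-irrefl (K 6) u)) uv) λ ()

-- Block i occupies the κ i consecutive residues mod 5 that start at Σ< κ i + shift i.
-- Going once around the cycle, the start has to advance by 5m in total; the slack
-- 5 − κ i − κ (i+1) is what each step can contribute beyond κ i, and it is spent greedily.
module Arcs (L m : ℕ) (k : Fin (suc L) → ℕ) where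

  open Expansion (suc L) k

  κ slack spare : ℕ → ℕ
  κ       = nth (suc L) k
  slack i = 5 ∸ (κ i + κ (suc i))
  spare   = Σ< slack

  S target : ℕ
  S      = Σ< κ (suc L)
  target = 5 * m ∸ S

  shift : ℕ → ℕ
  shift i = target ⊓ spare i

  module _ (pairs : ∀ i → i < L → κ i + κ (suc i) ≤ 5) (closing : κ L + κ 0 ≤ 5)
           (light : S ≤ 5 * m) (enough : 2 * m ≤ suc L) where

    -- Each of the first i steps supplies slack j + κ j + κ (j+1) = 5; the κ 0 on the right is the
    -- one summand of the prefix sums that no step supplies.
    spare-total : ∀ i → i ≤ L → spare i + Σ< κ i + Σ< κ (suc i) ≡ 5 * i + κ 0
    spare-total zero    _   = refl
    spare-total (suc i) i<L = begin
      spare i + slack i + (Σ< κ i + κ i) + (Σ< κ i + κ i + κ (suc i))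
        ≡⟨ regroup (spare i) (slack i) (Σ< κ i) (κ i) (κ (suc i)) ⟩
      spare i + Σ< κ i + (Σ< κ i + κ i) + (slack i + (κ i + κ (suc i)))
        ≡⟨ cong₂ _+_ (spare-total i (<⇒≤ i<L)) (m∸n+n≡m (pairs i i<L)) ⟩
      5 * i + κ 0 + 5
        ≡⟨ advance i (κ 0) ⟩
      5 * suc i + κ 0 ∎
      where
      open ≡-Reasoning
      regroup : ∀ a b c d e → a + b + (c + d) + (c + d + e) ≡ a + c + (c + d) + (b + (d + e))
      regroup = solve-∀
      advance : ∀ i a → 5 * i + a + 5 ≡ 5 * suc i + a
      advance = solve-∀

    shift-mono : ∀ i → shift i ≤ shift (suc i)
    shift-mono i = ⊓-monoʳ-≤ target (m≤m+n (spare i) (slack i))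

    shift-step : ∀ i → shift (suc i) ≤ shift i + slack i
    shift-step i with ⊓-sel target (spare i)
    ... | inj₁ e rewrite e = ≤-trans (m⊓n≤m target _) (m≤m+n target (slack i))
    ... | inj₂ e rewrite e = m⊓n≤n target _

    -- Block 0, raised by a full turn 5m, has to end within five of the start of block L. If the
    -- shift has reached `target`, this is `closing`. Otherwise all slack is spent, and
    -- `spare-total` reduces the claim to S + 5m ≤ 5 (L+1), a consequence of S ≤ 5m and 2m ≤ L+1.
    wrap-bound : κ 0 + κ L + target ≤ shift L + 5
    wrap-bound with ⊓-sel target (spare L)
    ... | inj₁ e rewrite e | +-comm (κ 0) (κ L) | +-comm target 5 = +-monoˡ-≤ target closing
    ... | inj₂ e rewrite e = +-cancelʳ-≤ (Σ< κ L + S) _ _ (begin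
      κ 0 + κ L + target + (Σ< κ L + S)      ≡⟨ regroup (κ 0) (κ L) target (Σ< κ L) ⟩
      κ 0 + (target + S) + S                 ≡⟨ cong (λ t → κ 0 + t + S) (m∸n+n≡m light) ⟩
      κ 0 + 5 * m + S                        ≤⟨ +-monoʳ-≤ (κ 0 + 5 * m) light ⟩
      κ 0 + 5 * m + 5 * m                    ≡⟨ twice (κ 0) m ⟩
      κ 0 + 5 * (2 * m)                      ≤⟨ +-monoʳ-≤ (κ 0) (*-monoʳ-≤ 5 enough) ⟩
      κ 0 + 5 * suc L                        ≡⟨ advance (κ 0) L ⟩
      5 * L + κ 0 + 5                        ≡⟨ cong (_+ 5) (sym (spare-total L ≤-refl)) ⟩
      spare L + Σ< κ L + S + 5               ≡⟨ collect (spare L) (Σ< κ L) S ⟩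
      spare L + 5 + (Σ< κ L + S)             ∎)
      where
      open ≤-Reasoning
      regroup : ∀ a l t c → a + l + t + (c + (c + l)) ≡ a + (t + (c + l)) + (c + l)
      regroup = solve-∀
      twice : ∀ a m → a + 5 * m + 5 * m ≡ a + 5 * (2 * m)
      twice = solve-∀
      advance : ∀ a l → a + 5 * suc l ≡ 5 * l + a + 5
      advance = solve-∀
      collect : ∀ a b c → a + b + c + 5 ≡ a + 5 + (b + c)
      collect = solve-∀

    private
      W = Fin (sumF (suc L) k)

    at-block : W → ℕ
    at-block x = toℕ (block (suc L) k x)

    value : W → ℕ
    value x = toℕ x + shift (at-block x)

    start≤ : ∀ x → Σ< κ (at-block x) ≤ toℕ x
    start≤ x = proj₁ (block-range (suc L) k x)

    <finish : ∀ x → toℕ x < Σ< κ (at-block x) + κ (at-block x)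
    <finish x = proj₂ (block-range (suc L) k x)

    small : ∀ i → i ≤ L → κ i ≤ 5
    small i i≤L with m≤n⇒m<n∨m≡n i≤L
    ... | inj₁ lt   = ≤-trans (m≤m+n _ _) (pairs i lt)
    ... | inj₂ refl = ≤-trans (m≤m+n _ _) closing

    same-block : ∀ x y → at-block x ≡ at-block y → toℕ x < toℕ y → value x % 5 ≢ value y % 5
    same-block x y e lt = %5-distinct
      (subst (λ i → value x < toℕ y + shift i) e (+-monoˡ-< (shift (at-block x)) lt))
      (begin-strict
        toℕ y + shift (at-block y)        ≡⟨ cong (λ i → toℕ y + shift i) (sym e) ⟩
        toℕ y + shift i                   <⟨ +-monoˡ-< (shift i) (subst (λ i → toℕ y < Σ< κ i + κ i) (sym e) (<finish y)) ⟩
        Σ< κ i + κ i + shift i            ≤⟨ +-monoˡ-≤ (shift i) (+-mono-≤ (start≤ x) (small i (s≤s⁻¹ (F.toℕ<n (block (suc L) k x))))) ⟩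
        toℕ x + 5 + shift i               ≡⟨ swap (toℕ x) (shift i) ⟩
        value x + 5                       ∎)
      where
      open ≤-Reasoning
      i = at-block x
      swap : ∀ a b → a + 5 + b ≡ a + b + 5
      swap = solve-∀

    -- The arcs of both blocks lie in a window of length κ i + κ (i+1) + slack i = 5, that of x in
    -- front.
    next-block : ∀ x y → suc (at-block x) ≡ at-block y → value x % 5 ≢ value y % 5
    next-block x y e = %5-distinct
      (begin-strict
        toℕ x + shift i                    <⟨ +-mono-<-≤ (<-≤-trans (<finish x) (subst (λ j → Σ< κ j ≤ toℕ y) (sym e) (start≤ y))) (shift-mono i) ⟩
        toℕ y + shift (suc i)              ≡⟨ cong (λ j → toℕ y + shift j) e ⟩
        value y                            ∎)
      (begin-strict
        value y                            ≡⟨ cong (λ j → toℕ y + shift j) (sym e) ⟩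
        toℕ y + shift (suc i)              <⟨ +-mono-<-≤ (subst (λ j → toℕ y < Σ< κ j + κ j) (sym e) (<finish y)) (shift-step i) ⟩
        Σ< κ i + κ i + κ (suc i) + (shift i + slack i)      ≡⟨ regroup (Σ< κ i) (κ i) (κ (suc i)) (shift i) (slack i) ⟩
        Σ< κ i + shift i + (slack i + (κ i + κ (suc i)))    ≡⟨ cong (Σ< κ i + shift i +_) (m∸n+n≡m (pairs i i<L)) ⟩
        Σ< κ i + shift i + 5               ≤⟨ +-monoˡ-≤ 5 (+-monoˡ-≤ (shift i) (start≤ x)) ⟩
        value x + 5                        ∎)
      where
      open ≤-Reasoning
      i = at-block x
      i<L : i < L
      i<L = s≤s⁻¹ (subst (_< suc L) (sym e) (F.toℕ<n (block (suc L) k y)))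
      regroup : ∀ a b c d e → a + b + c + (d + e) ≡ a + d + (e + (b + c))
      regroup = solve-∀

    -- Here y is compared one turn later: adding S + `target` = 5m does not change its residue and
    -- puts it behind x.
    wrap-block : ∀ x y → at-block x ≡ L → at-block y ≡ 0 → value x % 5 ≢ value y % 5
    wrap-block x y eL e0 e = %5-distinct
      (begin-strict
        value x                            ≡⟨ cong (λ i → toℕ x + shift i) eL ⟩
        toℕ x + shift L                    <⟨ +-mono-<-≤ (subst (λ i → toℕ x < Σ< κ i + κ i) eL (<finish x)) (m⊓n≤m target (spare L)) ⟩
        S + target                         ≤⟨ m≤n+m _ (toℕ y) ⟩
        toℕ y + (S + target)               ∎)
      (begin-strict
        toℕ y + (S + target)               <⟨ +-monoˡ-< (S + target) (subst (λ i → toℕ y < Σ< κ i + κ i) e0 (<finish y)) ⟩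
        κ 0 + (Σ< κ L + κ L + target)      ≡⟨ regroup (κ 0) (Σ< κ L) (κ L) target ⟩
        Σ< κ L + (κ 0 + κ L + target)      ≤⟨ +-mono-≤ (subst (λ i → Σ< κ i ≤ toℕ x) eL (start≤ x)) wrap-bound ⟩
        toℕ x + (shift L + 5)              ≡⟨ sym (+-assoc (toℕ x) (shift L) 5) ⟩
        toℕ x + shift L + 5                ≡⟨ cong (λ i → toℕ x + shift i + 5) (sym eL) ⟩
        value x + 5                        ∎)
      (trans e (trans (cong (_% 5) value-y) (sym full-turn)))
      where
      open ≤-Reasoning
      regroup : ∀ a b c d → a + (b + c + d) ≡ b + (a + c + d)
      regroup = solve-∀
      value-y : value y ≡ toℕ y
      value-y = trans (cong (λ i → toℕ y + shift i) e0) (trans (cong (toℕ y +_) (⊓-zeroʳ target)) (+-identityʳ _))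
      full-turn : (toℕ y + (S + target)) % 5 ≡ toℕ y % 5
      full-turn = trans (cong (λ t → (toℕ y + t) % 5) (trans (m+[n∸m]≡n light) (*-comm 5 m))) ([m+kn]%n≡m%n (toℕ y) m 5)

    separated : ∀ x y → x ≢ y → Touch (suc L) (at-block x) (at-block y) → value x % 5 ≢ value y % 5
    separated x y x≢y (equal e) with <-cmp (toℕ x) (toℕ y)
    ... | tri< lt _ _ = same-block x y e lt
    ... | tri≈ _ eq _ = contradiction (F.toℕ-injective eq) x≢y
    ... | tri> _ _ gt = same-block y x (sym e) gt ∘ sym
    separated x y x≢y (next e)    = next-block x y e
    separated x y x≢y (wrap e f)  = wrap-block x y (suc-injective e) f
    separated x y x≢y (next′ e)   = next-block y x e ∘ sym
    separated x y x≢y (wrap′ e f) = wrap-block y x (suc-injective e) f ∘ sym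

    arc-colouring : Colorable E 5
    arc-colouring = (λ x → fromℕ< (m%n<n (value x) 5)) , proper
      where
      proper : ∀ x y → Edge E x y → fromℕ< (m%n<n (value x) 5) ≢ fromℕ< (m%n<n (value y) 5)
      proper x y xy e = separated x y x≢y
        (touching-sound _ _ (Equivalence.from T-≡ (trans (sym (expansion-adj x≢y)) xy)))
        (F.fromℕ<-injective _ _ (m%n<n (value x) 5) (m%n<n (value y) 5) e)
        where
        x≢y : x ≢ y
        x≢y refl = contradiction (trans (sym (adj-irrefl E x)) xy) λ ()

-- Sorting vertices by blocks

-- One block is split off in front, as in the recursions of `sumF` and `block`; the bijection is
-- kept as two inverse functions so that it composes by computation.
record ZeroFibre {N p} (β : Fin N → Fin (suc p)) : Set where
  field
    {a b} : ℕ
    to    : Fin N → Fin a ⊎ Fin b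
    from  : Fin a ⊎ Fin b → Fin N
    to∘from : ∀ s → to (from s) ≡ s
    from∘to : ∀ v → from (to v) ≡ v
    rest  : Fin b → Fin p
    β≡    : ∀ v → β v ≡ [ const zero , suc ∘ rest ]′ (to v)

zero-fibre : ∀ N {p} (β : Fin N → Fin (suc p)) → ZeroFibre β
zero-fibre zero β = record
  { a = 0 ; b = 0 ; to = λ () ; from = λ { (inj₁ ()) ; (inj₂ ()) } ; to∘from = λ { (inj₁ ()) ; (inj₂ ()) }
  ; from∘to = λ () ; rest = λ () ; β≡ = λ () }
zero-fibre (suc N) β with zero-fibre N (β ∘ suc) | β zero in eq
... | Z | zero = record
  { to = to′ ; from = from′
  ; to∘from = λ { (inj₁ zero) → refl ; (inj₁ (suc s)) → cong (Sum.map₁ suc) (to∘from (inj₁ s))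
                ; (inj₂ t) → cong (Sum.map₁ suc) (to∘from (inj₂ t)) }
  ; from∘to = λ { zero → refl ; (suc v) → trans (lifted (to v)) (cong suc (from∘to v)) }
  ; rest    = rest
  ; β≡      = λ { zero → eq ; (suc v) → trans (β≡ v) (unchanged (to v)) }
  }
  where
  open ZeroFibre Z
  to′ : Fin (suc N) → Fin (suc a) ⊎ Fin b
  to′ zero    = inj₁ zero
  to′ (suc v) = Sum.map₁ suc (to v)
  from′ : Fin (suc a) ⊎ Fin b → Fin (suc N)
  from′ (inj₁ zero)    = zero
  from′ (inj₁ (suc s)) = suc (from (inj₁ s))
  from′ (inj₂ t)       = suc (from (inj₂ t))
  lifted : ∀ s → from′ (Sum.map₁ suc s) ≡ suc (from s)
  lifted (inj₁ s) = refl
  lifted (inj₂ t) = refl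
  unchanged : ∀ s → [ const zero , suc ∘ rest ]′ s ≡ [ const zero , suc ∘ rest ]′ (Sum.map₁ (Fin.suc {a}) s)
  unchanged (inj₁ s) = refl
  unchanged (inj₂ t) = refl
... | Z | suc i = record
  { to = to′ ; from = from′
  ; to∘from = λ { (inj₂ zero) → refl ; (inj₂ (suc t)) → cong (Sum.map₂ suc) (to∘from (inj₂ t))
                ; (inj₁ s) → cong (Sum.map₂ suc) (to∘from (inj₁ s)) }
  ; from∘to = λ { zero → refl ; (suc v) → trans (lifted (to v)) (cong suc (from∘to v)) }
  ; rest    = rest′
  ; β≡      = λ { zero → eq ; (suc v) → trans (β≡ v) (unchanged (to v)) }
  }
  where
  open ZeroFibre Z
  to′ : Fin (suc N) → Fin a ⊎ Fin (suc b)
  to′ zero    = inj₂ zero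
  to′ (suc v) = Sum.map₂ suc (to v)
  from′ : Fin a ⊎ Fin (suc b) → Fin (suc N)
  from′ (inj₁ s)       = suc (from (inj₁ s))
  from′ (inj₂ zero)    = zero
  from′ (inj₂ (suc t)) = suc (from (inj₂ t))
  rest′ : Fin (suc b) → Fin _
  rest′ zero    = i
  rest′ (suc t) = rest t
  lifted : ∀ s → from′ (Sum.map₂ suc s) ≡ suc (from s)
  lifted (inj₁ s) = refl
  lifted (inj₂ t) = refl
  unchanged : ∀ s → [ const zero , suc ∘ rest ]′ s ≡ [ const zero , suc ∘ rest′ ]′ (Sum.map₂ suc s)
  unchanged (inj₁ s) = refl
  unchanged (inj₂ t) = refl

record Fibres {N p} (β : Fin N → Fin p) : Set where
  field
    k       : Fin p → ℕ
    to      : Fin N → Fin (sumF p k)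
    from    : Fin (sumF p k) → Fin N
    to∘from : ∀ x → to (from x) ≡ x
    from∘to : ∀ v → from (to v) ≡ v
    block-to : ∀ v → block p k (to v) ≡ β v

fibres : ∀ {N} p (β : Fin N → Fin p) → Fibres β
fibres zero β = record
  { k = λ () ; to = λ v → ⊥-elim (F.¬Fin0 (β v)) ; from = λ () ; to∘from = λ () ; from∘to = λ v → ⊥-elim (F.¬Fin0 (β v))
  ; block-to = λ v → ⊥-elim (F.¬Fin0 (β v)) }
fibres {N} (suc p) β = record
  { k = k ; to = to ; from = from ; to∘from = to∘from ; from∘to = from∘to ; block-to = block-to }
  where
  module Z = ZeroFibre (zero-fibre N β)
  module R = Fibres (fibres p Z.rest)
  k : Fin (suc p) → ℕ
  k zero    = Z.a
  k (suc i) = R.k i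
  to : Fin N → Fin (sumF (suc p) k)
  to v = join Z.a _ (Sum.map₂ R.to (Z.to v))
  from : Fin (sumF (suc p) k) → Fin N
  from x = Z.from (Sum.map₂ R.from (splitAt Z.a x))
  map-inverse : ∀ {A B C : Set} {f : B → C} {g : C → B} → (∀ y → f (g y) ≡ y) → ∀ (s : A ⊎ C) → Sum.map₂ f (Sum.map₂ g s) ≡ s
  map-inverse h (inj₁ _) = refl
  map-inverse h (inj₂ y) = cong inj₂ (h y)
  to∘from : ∀ x → to (from x) ≡ x
  to∘from x = trans
    (cong (join Z.a _) (trans (cong (Sum.map₂ R.to) (Z.to∘from _)) (map-inverse R.to∘from (splitAt Z.a x))))
    (F.join-splitAt Z.a _ x)
  from∘to : ∀ v → from (to v) ≡ v
  from∘to v = trans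
    (cong Z.from (trans (cong (Sum.map₂ R.from) (F.splitAt-join Z.a _ (Sum.map₂ R.to (Z.to v)))) (map-inverse R.from∘to (Z.to v))))
    (Z.from∘to v)
  block-join : ∀ s → block (suc p) k (join Z.a _ (Sum.map₂ R.to s)) ≡ [ const zero , suc ∘ Z.rest ]′ s
  block-join (inj₁ s) rewrite F.splitAt-↑ˡ Z.a s (sumF p R.k) = refl
  block-join (inj₂ t) rewrite F.splitAt-↑ʳ Z.a (sumF p R.k) (R.to t) = cong suc (R.block-to t)
  block-to : ∀ v → block (suc p) k (to v) ≡ β v
  block-to v = trans (block-join (Z.to v)) (sym (Z.β≡ v))

halve : ∀ p → (∃[ m ] p ≡ 2 * m) ⊎ (∃[ m ] p ≡ 2 * m + 1)
halve zero = inj₁ (0 , refl)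
halve (suc p) with halve p
... | inj₁ (m , refl) = inj₂ (m , +-comm 1 (2 * m))
... | inj₂ (m , refl) = inj₁ (suc m , (begin
  suc (2 * m + 1)   ≡⟨ cong suc (+-comm (2 * m) 1) ⟩
  2 + 2 * m         ≡⟨ sym (*-suc 2 m) ⟩
  2 * suc m         ∎))
  where open ≡-Reasoning

-- The 2m terms fall into m disjoint consecutive pairs.
paired-sum : ∀ f m → (∀ i → suc i < m + m → f i + f (suc i) ≤ 5) → Σ< f (m + m) ≤ 5 * m
paired-sum f zero h = z≤n
paired-sum f (suc m) h rewrite +-suc m m = begin
  Σ< f (m + m) + f (m + m) + f (suc (m + m))     ≡⟨ +-assoc (Σ< f (m + m)) _ _ ⟩
  Σ< f (m + m) + (f (m + m) + f (suc (m + m)))   ≤⟨ +-mono-≤ (paired-sum f m (λ i l → h i (≤-trans l (m≤n+m _ 2)))) (h (m + m) ≤-refl) ⟩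
  5 * m + 5                                      ≡⟨ +-comm (5 * m) 5 ⟩
  5 + 5 * m                                      ≡⟨ sym (*-suc 5 m) ⟩
  5 * suc m                                      ∎
  where open ≤-Reasoning

-- From labels to clique expansions

module _ (G : Graph) where

  private V = Fin (n G)

  -- `positive` spares the last clique, that of the closers, which may be empty.
  record Expanded : Set where
    field
      p     : ℕ
      6≤p   : 6 ≤ p
      k     : Fin p → ℕ
      iso   : G ≅ cliqueExpansion p k
      positive : ∀ i → suc (toℕ i) < p → 1 ≤ k i

  expand : ∀ p → 6 ≤ p → (β : V → Fin p) → (∀ {u v} → u ≢ v → adj G u v ≡ touching (β u) (β v)) →
    (∀ i → suc (toℕ i) < p → ∃[ v ] β v ≡ i) → Expanded
  expand p 6≤p β adj≡ onto = record
    { p = p ; 6≤p = 6≤p ; k = k ; positive = positive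
    ; iso = mk⤖ {to = to} ((λ {u} {v} → to-injective u v) , λ x → from x , λ { refl → to∘from x }) , adj-to }
    where
    open Fibres (fibres p β)
    to-injective : ∀ u v → to u ≡ to v → u ≡ v
    to-injective u v e = trans (sym (from∘to u)) (trans (cong from e) (from∘to v))
    adj-to : ∀ u v → adj (cliqueExpansion p k) (to u) (to v) ≡ adj G u v
    adj-to u v with u F.≟ v
    ... | yes refl = trans (adj-irrefl (cliqueExpansion p k) (to u)) (sym (adj-irrefl G u))
    ... | no  u≢v  = trans (Expansion.expansion-adj p k (u≢v ∘ to-injective u v))
                       (trans (cong₂ touching (block-to u) (block-to v)) (sym (adj≡ u≢v)))
    positive : ∀ i → suc (toℕ i) < p → 1 ≤ k i
    positive i l with onto i l
    ... | v , refl with block-range p k (to v)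
    ...   | lo , hi rewrite block-to v = subst (1 ≤_) (nth-toℕ p k (β v)) (+-cancelˡ-< (Σ< (nth p k) (toℕ (β v))) 0 _
              (subst (_< Σ< (nth p k) (toℕ (β v)) + nth p k (toℕ (β v))) (sym (+-identityʳ _)) (≤-<-trans lo hi)))

  module _ (noBull : ¬ ContainsInduced G bull) (noClaw : ¬ ContainsInduced G claw) where

    ring⇒expanded : Ring G noBull noClaw → Expanded
    ring⇒expanded R = expand (6 + q) (m≤m+n 6 q) β adjacency onto
      where
      open Ring R
      open Along G noBull noClaw q c path
      β : V → Fin (6 + q)
      β v = fromℕ< (label< (labelled v))
      toℕ-β : ∀ v → toℕ (β v) ≡ label v
      toℕ-β v = F.toℕ-fromℕ< (label< (labelled v))
      label-at : ∀ v → Label v (toℕ (β v))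
      label-at v = subst (Label v) (sym (toℕ-β v)) (labelled v)
      not-touching : ∀ {i j : Fin (6 + q)} → 2 + toℕ i ≤ toℕ j → ¬ (toℕ i ≡ 0 × toℕ j ≡ 5 + q) → touching i j ≡ false
      not-touching {i} {j} le ne = 𝔹.¬-not λ t → absurd (touching-sound i j (Equivalence.from T-≡ t))
        where
        absurd : Touch (6 + q) (toℕ i) (toℕ j) → ⊥
        absurd (equal e)  = <⇒≢ (≤-trans (n≤1+n _) le) e
        absurd (next e)   = <⇒≢ le e
        absurd (wrap e z) = contradiction (subst (2 + toℕ i ≤_) z le) λ ()
        absurd (next′ e)  = <⇒≢ (≤-trans (n≤1+n _) (≤-trans le (n≤1+n _))) (sym e)
        absurd (wrap′ e z) = ne (z , suc-injective e)
      ordered : ∀ u v → u ≢ v → toℕ (β u) ≤ toℕ (β v) → adj G u v ≡ touching (β u) (β v)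
      ordered u v u≢v le with m≤n⇒m<n∨m≡n le
      ... | inj₂ eq = trans (labels-same u≢v (label-at u) (subst (Label v) (sym eq) (label-at v)))
                        (sym (trans (cong (touching (β u)) (sym (F.toℕ-injective eq))) (touching-refl (β u))))
      ... | inj₁ lt with m≤n⇒m<n∨m≡n lt
      ...   | inj₂ eq = trans (labels-next (label-at u) (subst (Label v) (sym eq) (label-at v)))
                          (sym (touching-next (β u) (β v) eq))
      ...   | inj₁ lt′ with (toℕ (β u) ≟ 0) ×-dec (toℕ (β v) ≟ 5 + q)
      ...     | yes (e , f) = trans (labels-wrap (subst (Label u) e (label-at u)) (subst (Label v) f (label-at v)))
                                (sym (trans (touching-sym (β u) (β v)) (touching-wrap (β v) (β u) (cong suc f) e)))
      ...     | no ne = trans (labels-apart (label-at u) (label-at v) lt′ ne) (sym (not-touching {β u} {β v} lt′ ne))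
      adjacency : ∀ {u v} → u ≢ v → adj G u v ≡ touching (β u) (β v)
      adjacency {u} {v} u≢v with ≤-total (toℕ (β u)) (toℕ (β v))
      ... | inj₁ le = ordered u v u≢v le
      ... | inj₂ ge = trans (adj-sym G u v) (trans (ordered v u (u≢v ∘ sym) ge) (touching-sym (β v) (β u)))
      -- Twins and closers are off the path, so a path vertex can only carry its own index; this
      -- makes all cliques but the last nonempty.
      label-on : ∀ {i l} → i < 5 + q → Label (c i) l → l ≡ i
      label-on i< (on l< e)       = sym (injective i< l< e)
      label-on i< (twin _ off _)  = contradiction refl (off _ i<)
      label-on i< (closer off _)  = contradiction refl (off _ i<)
      onto : ∀ i → suc (toℕ i) < 6 + q → ∃[ v ] β v ≡ i
      onto i (s≤s l) = c (toℕ i) , F.toℕ-injective (trans (toℕ-β (c (toℕ i))) (label-on l (labelled (c (toℕ i)))))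

  module _ (H : Graph) (iso : G ≅ H) where

    private
      f = Bijection.to (proj₁ iso)

    ≅-colorable : ∀ {d} → Colorable H d → Colorable G d
    ≅-colorable (col , proper) = col ∘ f , λ u v uv → proper (f u) (f v) (trans (proj₂ iso u v) uv)

    ≅-contains : ∀ F → Contains H F → Contains G F
    ≅-contains F (g , g-inj , edges) = proj₁ ∘ preimage , (λ {u} {v} e → g-inj (trans (sym (image u)) (trans (cong f e) (image v)))) ,
      λ u v uv → trans (sym (proj₂ iso _ _)) (trans (cong₂ (adj H) (image u) (image v)) (edges u v uv))
      where
      preimage : ∀ u → ∃[ v ] f v ≡ g u
      preimage u = proj₁ (Bijection.surjective (proj₁ iso) (g u)) , proj₂ (Bijection.surjective (proj₁ iso) (g u)) refl
      image : ∀ u → f (proj₁ (preimage u)) ≡ g u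
      image = proj₂ ∘ preimage

module _ (L : ℕ) (k : Fin (suc L) → ℕ) (0<L : 0 < L) where

  private κ = nth (suc L) k

  nth-fromℕ< : ∀ {i} (i< : i < suc L) → κ i ≡ k (fromℕ< i<)
  nth-fromℕ< i< = trans (cong κ (sym (F.toℕ-fromℕ< i<))) (nth-toℕ (suc L) k (fromℕ< i<))

  light-or-K6 : Contains (cliqueExpansion (suc L) k) (K 6) ⊎ ((∀ i → i < L → κ i + κ (suc i) ≤ 5) × κ L + κ 0 ≤ 5)
  light-or-K6 with F.any? (λ i → F.any? λ j → ¬? (i F.≟ j) ×-dec (touching i j 𝔹.≟ true) ×-dec (6 ≤? k i + k j))
  ... | yes (i , j , i≢j , ij , le) = inj₁ (Expansion.heavy⇒K6 (suc L) k i j i≢j ij le)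
  ... | no none = inj₂ (pairs , closing)
    where
    bound : ∀ {i j} (i< : i < suc L) (j< : j < suc L) → i ≢ j → touching (fromℕ< i<) (fromℕ< j<) ≡ true → κ i + κ j ≤ 5
    bound i< j< i≢j ij = subst₂ (λ a b → a + b ≤ 5) (sym (nth-fromℕ< i<)) (sym (nth-fromℕ< j<))
      (s≤s⁻¹ (≰⇒> λ le → none (_ , _ , (λ e → i≢j (F.fromℕ<-injective _ _ i< j< e)) , ij , le)))
    pairs : ∀ i → i < L → κ i + κ (suc i) ≤ 5
    pairs i l = bound (≤-trans l (n≤1+n L)) (s≤s l) (<⇒≢ (n<1+n i))
      (touching-next (fromℕ< (≤-trans l (n≤1+n L))) (fromℕ< (s≤s l)) (trans (cong suc (F.toℕ-fromℕ< (≤-trans l (n≤1+n L)))) (sym (F.toℕ-fromℕ< (s≤s l)))))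
    closing : κ L + κ 0 ≤ 5
    closing = bound (n<1+n L) (s≤s z≤n) (<⇒≢ 0<L ∘ sym)
      (touching-wrap (fromℕ< (n<1+n L)) zero (cong suc (F.toℕ-fromℕ< (n<1+n L))) refl)

-- Parity of the cycle and conclusion

module _ (G : Graph) where

  2*≡ : ∀ m → 2 * m ≡ m + m
  2*≡ m = cong (m +_) (+-identityʳ m)

  -- On an even cycle neighbouring pairs keep the total within 5m. An odd one with a larger total is
  -- (vi), provided that it is not a path in the guise of a cycle with an empty clique.
  expanded⇒conclusion : Expanded G → Conclusion G
  expanded⇒conclusion X = go (Expanded.p X) (Expanded.6≤p X) (Expanded.k X) (Expanded.iso X) (Expanded.positive X)
    where
    go : ∀ p → 6 ≤ p → (k : Fin p → ℕ) → G ≅ cliqueExpansion p k →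
         (∀ i → suc (toℕ i) < p → 1 ≤ k i) → Conclusion G
    go (suc L) (s≤s 5≤L) k iso positive with light-or-K6 L k (≤-trans (s≤s z≤n) 5≤L)
    ... | inj₁ K6 = case-i (≅-contains G (cliqueExpansion (suc L) k) iso (K 6) K6)
    ... | inj₂ (pairs , closing) with halve (suc L)
    ...   | inj₁ (m , eq) = case-vii (≅-colorable G (cliqueExpansion (suc L) k) iso (Arcs.arc-colouring L m k pairs closing light (≤-reflexive (sym eq))))
      where
      light : Σ< (nth (suc L) k) (suc L) ≤ 5 * m
      light = subst (λ t → Σ< (nth (suc L) k) t ≤ 5 * m) (sym (trans eq (2*≡ m)))
        (paired-sum (nth (suc L) k) m λ i l → pairs i (s≤s⁻¹ (subst (suc i <_) (sym (trans eq (2*≡ m))) l)))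
    ...   | inj₂ (m , eq) with Σ< (nth (suc L) k) (suc L) ≤? 5 * m
    ...     | yes light = case-vii (≅-colorable G (cliqueExpansion (suc L) k) iso (Arcs.arc-colouring L m k pairs closing light
                (≤-trans (m≤m+n (2 * m) 1) (≤-reflexive (sym eq)))))
    ...     | no heavy = odd (suc L) eq k iso all-positive (subst (5 * m <_) (sym (sumF≡Σ< (suc L) k)) (≰⇒> heavy))
      where
      L≡ : L ≡ m + m
      L≡ = suc-injective (trans eq (trans (+-comm (2 * m) 1) (cong suc (2*≡ m))))
      -- If the last clique were empty, the other 2m would fall into m pairs and total at most 5m.
      last-positive : 1 ≤ nth (suc L) k L
      last-positive = n≢0⇒n>0 λ z → heavy (begin
        Σ< κ L + κ L   ≡⟨ trans (cong (Σ< κ L +_) z) (+-identityʳ _) ⟩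
        Σ< κ L         ≡⟨ cong (Σ< κ) L≡ ⟩
        Σ< κ (m + m)   ≤⟨ paired-sum κ m (λ i l → pairs i (subst (i <_) (sym L≡) (<-trans (n<1+n i) l))) ⟩
        5 * m          ∎)
        where
        open ≤-Reasoning
        κ = nth (suc L) k
      all-positive : ∀ i → 1 ≤ k i
      all-positive i with m≤n⇒m<n∨m≡n (F.toℕ<n i)
      ... | inj₁ l = positive i l
      ... | inj₂ e = subst (1 ≤_) (trans (cong (nth (suc L) k) (sym (suc-injective e))) (nth-toℕ (suc L) k i)) last-positive
      -- The length is generalised so that k and the isomorphism can be matched with length 2m + 1
      -- by `refl`.
      odd : ∀ p → p ≡ 2 * m + 1 → (k : Fin p → ℕ) → G ≅ cliqueExpansion p k → (∀ i → 1 ≤ k i) → 5 * m < sumF p k → Conclusion G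
      odd _ refl k iso pos heavy = case-vi (m , 1≤m m L≡ , k , pos , heavy , iso)
        where
        1≤m : ∀ m → L ≡ m + m → 1 ≤ m
        1≤m zero    refl = contradiction 5≤L λ ()
        1≤m (suc m) _    = s≤s z≤n

  triple? : Dec (∃[ a ] ∃[ b ] ∃[ c ] a ≢ b × b ≢ c × a ≢ c × NonEdge G a b × NonEdge G b c × NonEdge G a c)
  triple? = F.any? λ a → F.any? λ b → F.any? λ c → ¬? (a F.≟ b) ×-dec ¬? (b F.≟ c) ×-dec ¬? (a F.≟ c) ×-dec
    (adj G a b 𝔹.≟ false) ×-dec (adj G b c 𝔹.≟ false) ×-dec (adj G a c 𝔹.≟ false)

theorem1p8 : (G : Graph) → Connected G →
    ¬ ContainsInduced G bull → ¬ ContainsInduced G claw → ¬ ContainsInduced G (C 5) →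
    Contains G (K 6)
    ⊎ Contains G (coC 7 ⊕ K 2)
    ⊎ Contains G (coC 9 ⊕ K 1)
    ⊎ (IndependenceNumber G 2 × 11 ≤ n G)
    ⊎ (IndependenceNumber G 2 × MaxDegree≥ G 9)
    ⊎ (∃[ m ] (1 ≤ m × Σ (Fin (2 * m + 1) → ℕ) λ k →
    (∀ i → 1 ≤ k i) × 5 * m < sumF (2 * m + 1) k × G ≅ cliqueExpansion (2 * m + 1) k))
    ⊎ Colorable G 5
theorem1p8 G connected noBull noClaw noC5 with triple? G
... | no none = small-independence G
        (λ a b c a≢b b≢c a≢c ab bc ac → none (a , b , c , a≢b , b≢c , a≢c , ab , bc , ac)) noC5
... | yes (a , b , c , a≢b , b≢c , a≢c , ab , bc , ac)
    with triple⇒P5 G noBull noClaw connected a b c a≢b b≢c a≢c ab bc ac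
-- The starting path has q = 0, and `n G` prolongations are ample.
...   | _ , P = expanded⇒conclusion G (ring⇒expanded G noBull noClaw
                  (ring G noBull noClaw connected (n G) P (m≤m+n (n G) 5)))
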